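{- Let $w \in \mathfrak{S}_n$. There exist an integer $k \ge 3$ and an integer $r\ge 0$ such that $B(w) \cong B(w_0^{(k)})^r$ (a power permutation) if and only if there exists an integer $k \ge 3$ such that every inversion of $w$ lies in exactly one occurrence of the pattern $w_0^{(k)}$ in $w$.
   Context: $w_0^{(k)} = k(k-1)\cdots 21 \in \mathfrak{S}_k$. The Bruhat order on $\mathfrak{S}_m$ is the partial order generated by $w\lessdot w'$ whenever $\ell(w')=\ell(w)+1$ and $w'=tw$ for a transposition $t$ ($\ell$ = number of inversions); $B(w)=\{v: v\le w\}$ is the principal order ideal, and $B(w_0^{(k)})^r$ is the $r$-fold direct (product) power of posets. An inversion of $w$ is a pair $(i,j)$ with $i<j$, $w(i)>w(j)$. An occurrence of $w_0^{(k)}$ in $w$ is a set of positions $i_1<\cdots<i_k$ with $w(i_1)>\cdots>w(i_k)$; an inversion $(i,j)$ lies in it if $i,j$ are among these positions. -}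

module Defs where

open import Data.Nat using (ℕ; zero; suc)
open import Data.Nat.ListAction using (sum)
open import Data.Fin using (Fin; _<_; _<?_; opposite)
open import Data.Fin.Properties using (opposite-involutive)
open import Data.Fin.Permutation using (Permutation′; permutation; transpose; _⟨$⟩ʳ_)
open import Data.List using (List; map; allFin)
open import Data.Bool using (if_then_else_)
open import Data.Product using (Σ; ∃; _×_; _,_; proj₁; proj₂)
open import Relation.Nullary using (¬_; does)
open import Relation.Nullary.Decidable using (_×-dec_)
open import Relation.Binary.PropositionalEquality using (_≡_)

Perm : ℕ → Set
Perm n = Permutation′ n

_≈ₚ_ : ∀ {n} → Perm n → Perm n → Set
v ≈ₚ w = ∀ x → v ⟨$⟩ʳ x ≡ w ⟨$⟩ʳ x

IsInversion : ∀ {n} → Perm n → Fin n → Fin n → Set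
IsInversion w i j = (i < j) × (w ⟨$⟩ʳ j < w ⟨$⟩ʳ i)

ℓ : ∀ {n} → Perm n → ℕ
ℓ {n} w = sum (map (λ i → sum (map (λ j →
            if does ((i <? j) ×-dec (w ⟨$⟩ʳ j <? w ⟨$⟩ʳ i)) then 1 else 0)
          (allFin n))) (allFin n))

_⋖_ : ∀ {n} → Perm n → Perm n → Set
_⋖_ {n} v w = Σ (Fin n) λ i → Σ (Fin n) λ j →
  (¬ (i ≡ j)) × (ℓ w ≡ suc (ℓ v)) ×
  (∀ x → w ⟨$⟩ʳ x ≡ transpose i j ⟨$⟩ʳ (v ⟨$⟩ʳ x))

data _≤B_ {n : ℕ} : Perm n → Perm n → Set where
  ≤B-refl : ∀ {v w} → v ≈ₚ w → v ≤B w
  ≤B-step : ∀ {u v w} → u ⋖ v → v ≤B w → u ≤B w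

record PosetData : Set₁ where
  field
    Carrier : Set
    _≈ᴾ_    : Carrier → Carrier → Set
    _≤ᴾ_    : Carrier → Carrier → Set

open PosetData

record _≅ᴾ_ (P Q : PosetData) : Set where
  field
    to       : Carrier P → Carrier Q
    from     : Carrier Q → Carrier P
    from-to  : ∀ x → _≈ᴾ_ P (from (to x)) x
    to-from  : ∀ y → _≈ᴾ_ Q (to (from y)) y
    to-mono  : ∀ x y → _≤ᴾ_ P x y → _≤ᴾ_ Q (to x) (to y)
    to-refl  : ∀ x y → _≤ᴾ_ Q (to x) (to y) → _≤ᴾ_ P x y

B : ∀ {n} → Perm n → PosetData
B {n} w = record
  { Carrier = Σ (Perm n) (λ v → v ≤B w)
  ; _≈ᴾ_    = λ x y → proj₁ x ≈ₚ proj₁ y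
  ; _≤ᴾ_    = λ x y → proj₁ x ≤B proj₁ y
  }

_^ᴾ_ : PosetData → ℕ → PosetData
P ^ᴾ r = record
  { Carrier = Fin r → Carrier P
  ; _≈ᴾ_    = λ x y → ∀ i → _≈ᴾ_ P (x i) (y i)
  ; _≤ᴾ_    = λ x y → ∀ i → _≤ᴾ_ P (x i) (y i)
  }

w₀ : (k : ℕ) → Perm k
w₀ k = permutation opposite opposite opposite-involutive opposite-involutive

-- An occurrence of the pattern w₀^(k) in w: positions p(0) < ⋯ < p(k-1)
-- (a strictly increasing map Fin k → Fin n, i.e. a k-subset of positions)
-- with w(p(0)) > ⋯ > w(p(k-1)).
Occurrence : ∀ {n} → Perm n → ℕ → Set
Occurrence {n} w k = Σ (Fin k → Fin n) λ p →
  (∀ a b → a < b → p a < p b) × (∀ a b → a < b → w ⟨$⟩ʳ (p b) < w ⟨$⟩ʳ (p a))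

InOcc : ∀ {n} (w : Perm n) {k} → Fin n → Occurrence w k → Set
InOcc w i o = ∃ λ a → proj₁ o a ≡ i

EveryInversionInUniqueOcc : ∀ {n} → Perm n → ℕ → Set
EveryInversionInUniqueOcc {n} w k = ∀ i j → IsInversion w i j →
  Σ (Occurrence w k) λ o → InOcc w i o × InOcc w j o ×
    (∀ (o′ : Occurrence w k) → InOcc w i o′ → InOcc w j o′ → ∀ a → proj₁ o′ a ≡ proj₁ o a)

{-# OPTIONS --safe #-}

-- Both conditions say that w is a product, in some order, of the longest elements of parabolic
-- subgroups generated by pairwise disjoint intervals of k - 1 consecutive transpositions s_i.
--
-- If u fixes the points above d and v fixes those below d, then every cover below u ∘ v lowers
-- exactly one of the two factors, so B(u ∘ v) ≅ B(u) × B(v) and such products are power permutations.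
-- Moreover each factor contributes one decreasing block to w, and an inversion belongs to one block only.
--
-- Conversely, let B(w) ≅ B(w₀)^r. The atoms of B(w) are the generators s_i ≤ w, and they split into
-- r families of k - 1. Neighbouring atoms of one family have two common covers, which forces their
-- indices to be consecutive, so a family is an interval and the top of its factor is a longest element.
-- Generators of different families have a join, so at most one of s_i s_(i+1) and s_(i+1) s_i lies
-- below w at the border of two families, and w factors there.
--
-- Now suppose that every inversion lies in a unique occurrence. No decreasing sequence is longer than k,
-- and decreasing x, y, z lie in one occurrence as soon as x and y do. Hence w has no pattern 3412 whose
-- first entry is preceded by no larger one. Therefore, up to inverting w, the occurrence through the first
-- point moved by w and its preimage takes consecutive values, at positions that are consecutive but for the last.
-- It is the block of a factor that can be split off.
module Submission where

open import Defs
open import Data.Nat using (ℕ; zero; suc; _+_; _∸_; _≤_; _<_; z≤n; s≤s; s≤s⁻¹; s<s; _≤?_; _<?_)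
open import Data.Nat.Properties
open import Data.Nat.Tactic.RingSolver using (solve-∀)
open import Data.Fin as Fin using (Fin; toℕ; fromℕ<; opposite; punchIn; inject₁; punchOut) renaming (_<_ to _<ᶠ_; _<?_ to _<ᶠ?_; _≟_ to _≟ᶠ_)
open import Data.Fin.Properties as Finₚ using (toℕ-injective; toℕ<n; toℕ-fromℕ<; any?)
open import Data.Fin.Patterns using (0F; 1F; 2F; 3F)
open import Data.Fin.Permutation using (permutation; transpose; flip; _∘ₚ_; inverseˡ; inverseʳ) renaming (_⟨$⟩ʳ_ to infixl 9 _∙_; _⟨$⟩ˡ_ to infixl 9 _∙⁻¹_; id to idₚ)
open import Data.List using (List; map; allFin; tabulate)
open import Data.List.Properties using (map-tabulate)
open import Data.Nat.ListAction using () renaming (sum to sumᴸ)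
open import Algebra.Properties.CommutativeMonoid.Sum +-0-commutativeMonoid using (sum; sum-cong-≗; ∑-distrib-+)
open import Data.Bool using (if_then_else_)
open import Data.Product using (Σ; ∃; _×_; _,_; proj₁; proj₂)
open import Data.Sum using (_⊎_; inj₁; inj₂; [_,_]′)
open import Data.Empty using (⊥; ⊥-elim)
open import Data.Unit using (⊤; tt)
open import Function using (_∘_; id)
open import Function.Bundles using (_⇔_; mk⇔)
open import Relation.Nullary using (¬_; Dec; yes; no; does; contradiction)
open import Relation.Nullary.Decidable using (_×-dec_; dec-true; dec-false; decidable-stable; map′)
open import Relation.Binary.Definitions using (tri<; tri≈; tri>)
open import Relation.Binary.PropositionalEquality using (_≡_; _≢_; refl; sym; trans; ≢-sym; cong; cong₂; subst; subst₂; module ≡-Reasoning)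

-- The two factors of u ∘ v share the point d, which both may move. This shapes every statement
-- about a block: its last entry may be carried out of the interval by v, so reversal is only ever
-- required at the other positions, and once a block is stripped the scan resumes at the last point
-- of its interval. Which of two neighbouring factors comes first is not known beforehand, whence
-- the constructor `inverse` and the tests on both `w` and `flip w`. No reduced words occur. That a
-- generator or a product of two lies below `w` is expressed by inequalities on a position and its
-- value; such tests pass upwards along covers, and an element that fulfils one is brought down to a
-- minimal one by undoing inversions. The bound k ≥ 3 gives the condition on inversions its force:
-- for k = 2 each inversion is by itself its only occurrence. It is used through the fourth entry of
-- a sequence longer than k and through the third entry of an occurrence.

private variable
  n : ℕ

-- Covers and the length

∙-inj : (w : Perm n) {x y : Fin n} → w ∙ x ≡ w ∙ y → x ≡ y
∙-inj w e = trans (sym (inverseˡ w)) (trans (cong (w ∙⁻¹_) e) (inverseˡ w))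

module _ (i j : Fin n) where

  transpose-l : transpose i j ∙ i ≡ j
  transpose-l rewrite dec-true (i ≟ᶠ i) refl = refl

  transpose-r : transpose i j ∙ j ≡ i
  transpose-r with j ≟ᶠ i
  ... | yes e = e
  ... | no _ rewrite dec-true (j ≟ᶠ j) refl = refl

  transpose-o : ∀ {x} → x ≢ i → x ≢ j → transpose i j ∙ x ≡ x
  transpose-o {x} p q rewrite dec-false (x ≟ᶠ i) p | dec-false (x ≟ᶠ j) q = refl

-- Opaque, so that the case distinctions inside transpose do not leak into goals.
abstract
  swap : Fin n → Fin n → Perm n → Perm n
  swap i j w = transpose i j ∘ₚ w

  swap-l : (w : Perm n) (i j : Fin n) → swap i j w ∙ i ≡ w ∙ j
  swap-l w i j = cong (w ∙_) (transpose-l i j)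

  swap-r : (w : Perm n) (i j : Fin n) → swap i j w ∙ j ≡ w ∙ i
  swap-r w i j = cong (w ∙_) (transpose-r i j)

  swap-o : (w : Perm n) (i j : Fin n) {x : Fin n} → x ≢ i → x ≢ j → swap i j w ∙ x ≡ w ∙ x
  swap-o w i j p q = cong (w ∙_) (transpose-o i j p q)

Between : Perm n → Fin n → Fin n → Fin n → Set
Between v i j m = ((i <ᶠ m) × (m <ᶠ j)) × ((v ∙ i <ᶠ v ∙ m) × (v ∙ m <ᶠ v ∙ j))

between? : (v : Perm n) (i j m : Fin n) → Dec (Between v i j m)
between? v i j m = ((i <ᶠ? m) ×-dec (m <ᶠ? j)) ×-dec ((v ∙ i <ᶠ? v ∙ m) ×-dec (v ∙ m <ᶠ? v ∙ j))

-- A relation rather than a function, since covers are met only up to `≈ₚ`. It exchanges positions,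
-- although `⋖` exchanges values: the positions are the preimages of those values.
record SwapOf {n} (v w : Perm n) (i j : Fin n) : Set where
  constructor swapped
  field
    at-l : w ∙ i ≡ v ∙ j
    at-r : w ∙ j ≡ v ∙ i
    away : ∀ {x} → x ≢ i → x ≢ j → w ∙ x ≡ v ∙ x

swap-SwapOf : (v : Perm n) (i j : Fin n) → SwapOf v (swap i j v) i j
swap-SwapOf v i j = swapped (swap-l v i j) (swap-r v i j) (swap-o v i j)

SwapOf-sym : ∀ {v w : Perm n} {i j} → SwapOf v w i j → SwapOf w v i j
SwapOf-sym (swapped a b c) = swapped (sym b) (sym a) λ p q → sym (c p q)

-- Equivalent to ⋖, without reference to lengths.
infix 4 _⊲_
record _⊲_ {n} (v w : Perm n) : Set where
  constructor cover
  field
    {i j} : Fin n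
    i<j   : i <ᶠ j
    vi<vj : v ∙ i <ᶠ v ∙ j
    isSwap : SwapOf v w i j
    none  : ∀ m → ¬ Between v i j m

[_] : ∀ {A : Set} → Dec A → ℕ
[ d ] = if does d then 1 else 0

[yes] : ∀ {A : Set} (d : Dec A) → A → [ d ] ≡ 1
[yes] d a rewrite dec-true d a = refl

[no] : ∀ {A : Set} (d : Dec A) → ¬ A → [ d ] ≡ 0
[no] d a rewrite dec-false d a = refl

inversion? : (w : Perm n) (a b : Fin n) → Dec (IsInversion w a b)
inversion? w a b = (a <ᶠ? b) ×-dec (w ∙ b <ᶠ? w ∙ a)

inv : Perm n → Fin n → Fin n → ℕ
inv w a b = [ inversion? w a b ]

sumᴸ-tabulate : (f : Fin n → ℕ) → sumᴸ (tabulate f) ≡ sum f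
sumᴸ-tabulate {zero} f = refl
sumᴸ-tabulate {suc n} f = cong (f Fin.zero +_) (sumᴸ-tabulate (f ∘ Fin.suc))

sumᴸ-allFin : (f : Fin n → ℕ) → sumᴸ (map f (allFin n)) ≡ sum f
sumᴸ-allFin f = trans (cong sumᴸ (map-tabulate id f)) (sumᴸ-tabulate f)

ℓ-sum : (w : Perm n) → ℓ w ≡ sum (λ a → sum (inv w a))
ℓ-sum {n} w = trans (sumᴸ-allFin (λ a → sumᴸ (map (inv w a) (allFin n)))) (sum-cong-≗ λ a → sumᴸ-allFin (inv w a))

ℓ-cong : {v w : Perm n} → v ≈ₚ w → ℓ v ≡ ℓ w
ℓ-cong {v = v} {w} e = trans (ℓ-sum v) (trans (sum-cong-≗ λ a → sum-cong-≗ λ b → go a b) (sym (ℓ-sum w)))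
  where
  go : ∀ a b → inv v a b ≡ inv w a b
  go a b rewrite e a | e b = refl

-- Zeroing a term instead of deleting it keeps the index set, so that a second term can be removed
-- in the same way.
infixl 9 _off_
_off_ : (Fin n → ℕ) → Fin n → Fin n → ℕ
(f off i) x = if does (x ≟ᶠ i) then 0 else f x

sum-off : (f : Fin n → ℕ) (i : Fin n) → sum f ≡ f i + sum (f off i)
sum-off f Fin.zero = refl
sum-off f (Fin.suc i) = trans (cong (f Fin.zero +_) (sum-off (f ∘ Fin.suc) i))
  (trans (lem (f Fin.zero) (f (Fin.suc i)) _) (cong (λ s → f (Fin.suc i) + (f Fin.zero + s)) (sum-cong-≗ λ x → eq x)))
  where
  lem : ∀ a b c → a + (b + c) ≡ b + (a + c)
  lem = solve-∀
  eq : ∀ x → ((f ∘ Fin.suc) off i) x ≡ (f off (Fin.suc i)) (Fin.suc x)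
  eq x with x ≟ᶠ i
  ... | yes _ = refl
  ... | no _ = refl

-- Used for the entries of one row of the inversion table, for the two exchanged rows together, and
-- for the row sums. The number `e` is the change at `i` and `j` that `h` does not account for.
sum-two : (f g h : Fin n → ℕ) {i j : Fin n} (e : ℕ) → i ≢ j →
  (∀ x → x ≢ i → x ≢ j → f x ≡ g x + h x) → f i + f j ≡ g i + g j + (h i + h j) + e →
  sum f ≡ sum g + sum h + e
sum-two f g h {i} {j} e i≢j rest two = begin
  sum f                                     ≡⟨ split f ⟩
  f i + f j + sum f'                        ≡⟨ cong₂ _+_ two (trans (sum-cong-≗ pt) (∑-distrib-+ g' h')) ⟩
  g i + g j + (h i + h j) + e + (sum g' + sum h') ≡⟨ lem (g i) (g j) (h i) (h j) e _ _ ⟩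
  (g i + g j + sum g') + (h i + h j + sum h') + e ≡⟨ cong₂ (λ a b → a + b + e) (split g) (split h) ⟨
  sum g + sum h + e ∎
  where
  open ≡-Reasoning
  f' = (f off i) off j
  g' = (g off i) off j
  h' = (h off i) off j
  lem : ∀ a b c d e x y → a + b + (c + d) + e + (x + y) ≡ (a + b + x) + (c + d + y) + e
  lem = solve-∀
  split : ∀ k → sum k ≡ k i + k j + sum ((k off i) off j)
  split k = trans (sum-off k i) (trans (cong (k i +_) (trans (sum-off (k off i) j) (cong (_+ sum ((k off i) off j)) eq))) (sym (+-assoc (k i) (k j) _)))
    where
    eq : (k off i) j ≡ k j
    eq rewrite dec-false (j ≟ᶠ i) (λ p → i≢j (sym p)) = refl
  pt : ∀ x → f' x ≡ g' x + h' x
  pt x with x ≟ᶠ j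
  ... | yes _ = refl
  ... | no q with x ≟ᶠ i
  ...   | yes _ = refl
  ...   | no p = rest x p q

<⇒≢ᶠ : {i j : Fin n} → i <ᶠ j → i ≢ j
<⇒≢ᶠ lt refl = n≮n _ lt

module _ {v w : Perm n} {i j : Fin n} (i<j : i <ᶠ j) (vi<vj : v ∙ i <ᶠ v ∙ j) (sw : SwapOf v w i j) where
  private
    wi = SwapOf.at-l sw
    wj = SwapOf.at-r sw
    wo = λ {x} → SwapOf.away sw {x}
    i≢j = <⇒≢ᶠ i<j

    β : Fin n → ℕ
    β m = [ between? v i j m ]

    inv-yes : (u : Perm n) {a b : Fin n} → a <ᶠ b → u ∙ b <ᶠ u ∙ a → inv u a b ≡ 1
    inv-yes u {a} {b} p q = [yes] (inversion? u a b) (p , q)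

    inv-no₁ : (u : Perm n) {a b : Fin n} → ¬ (a <ᶠ b) → inv u a b ≡ 0
    inv-no₁ u {a} {b} p = [no] (inversion? u a b) (p ∘ proj₁)

    inv-no₂ : (u : Perm n) {a b : Fin n} → ¬ (u ∙ b <ᶠ u ∙ a) → inv u a b ≡ 0
    inv-no₂ u {a} {b} p = [no] (inversion? u a b) (p ∘ proj₂)

    β-no : ∀ {m} → ¬ Between v i j m → β m ≡ 0
    β-no {m} = [no] (between? v i j m)

    -- In the row and in the column of a third point a, the changes cancel unless a lies between i and j in position and in value.
    row : ∀ a → a ≢ i → a ≢ j → inv w a i + inv w a j ≡ inv v a i + inv v a j + (β a + 0) + 0
    row a a≢i a≢j with Finₚ.<-cmp a i | Finₚ.<-cmp a j
    ... | tri≈ _ e _ | _ = contradiction e a≢i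
    ... | _ | tri≈ _ e _ = contradiction e a≢j
    ... | tri< a<i _ _ | tri> _ _ a>j = contradiction (<-trans a<i i<j) (<-asym a>j)
    ... | tri> _ _ i<a | tri> _ _ j<a
        rewrite β-no {a} (λ b → <-asym j<a (proj₂ (proj₁ b))) | inv-no₁ w (<-asym i<a) | inv-no₁ w (<-asym j<a) | inv-no₁ v (<-asym i<a) | inv-no₁ v (<-asym j<a)
               = refl
    ... | tri< a<i _ _ | tri< a<j _ _
        rewrite β-no {a} (λ b → <-asym a<i (proj₁ (proj₁ b))) | wi | wj | wo a≢i a≢j | dec-true (a <ᶠ? i) a<i | dec-true (a <ᶠ? j) a<j 
        = trans (+-comm [ v ∙ j <ᶠ? v ∙ a ] _) (sym (trans (+-identityʳ _) (+-identityʳ _)))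
    ... | tri> _ _ i<a | tri< a<j _ _ with Finₚ.<-cmp (v ∙ a) (v ∙ i) | Finₚ.<-cmp (v ∙ a) (v ∙ j)
    ...   | tri≈ _ e _ | _ = contradiction (∙-inj v e) a≢i
    ...   | _ | tri≈ _ e _ = contradiction (∙-inj v e) a≢j
    ...   | tri< va<vi _ _ | _
        rewrite β-no {a} (λ b → <-asym va<vi (proj₁ (proj₂ b))) | inv-no₁ w (<-asym i<a) | inv-no₁ v (<-asym i<a) | wj | wo a≢i a≢j
              | dec-true (a <ᶠ? j) a<j | dec-false (v ∙ i <ᶠ? v ∙ a) (<-asym va<vi) | dec-false (v ∙ j <ᶠ? v ∙ a) (<-asym (<-trans va<vi vi<vj))
               = refl
    ...   | tri> _ _ vi<va | tri> _ _ vj<va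
        rewrite β-no {a} (λ b → <-asym vj<va (proj₂ (proj₂ b))) | inv-no₁ w (<-asym i<a) | inv-no₁ v (<-asym i<a) | wj | wo a≢i a≢j
              | dec-true (a <ᶠ? j) a<j | dec-true (v ∙ i <ᶠ? v ∙ a) vi<va | dec-true (v ∙ j <ᶠ? v ∙ a) vj<va
               = refl
    ...   | tri> _ _ vi<va | tri< va<vj _ _
        rewrite [yes] (between? v i j a) ((i<a , a<j) , (vi<va , va<vj)) | inv-no₁ w (<-asym i<a) | inv-no₁ v (<-asym i<a) | wj | wo a≢i a≢j
              | dec-true (a <ᶠ? j) a<j | dec-true (v ∙ i <ᶠ? v ∙ a) vi<va | dec-false (v ∙ j <ᶠ? v ∙ a) (<-asym va<vj)
               = refl

    col : ∀ a → a ≢ i → a ≢ j → inv w i a + inv w j a ≡ inv v i a + inv v j a + β a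
    col a a≢i a≢j with Finₚ.<-cmp a i | Finₚ.<-cmp a j
    ... | tri≈ _ e _ | _ = contradiction e a≢i
    ... | _ | tri≈ _ e _ = contradiction e a≢j
    ... | tri< a<i _ _ | tri> _ _ a>j = contradiction (<-trans a<i i<j) (<-asym a>j)
    ... | tri< a<i _ _ | tri< a<j _ _
        rewrite β-no {a} (λ b → <-asym a<i (proj₁ (proj₁ b))) | inv-no₁ w (<-asym a<i) | inv-no₁ w (<-asym a<j) | inv-no₁ v (<-asym a<i) | inv-no₁ v (<-asym a<j)
               = refl
    ... | tri> _ _ i<a | tri> _ _ j<a
        rewrite β-no {a} (λ b → <-asym j<a (proj₂ (proj₁ b))) | wi | wj | wo a≢i a≢j | dec-true (i <ᶠ? a) i<a | dec-true (j <ᶠ? a) j<a 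
        = trans (+-comm [ v ∙ a <ᶠ? v ∙ j ] _) (sym (+-identityʳ _))
    ... | tri> _ _ i<a | tri< a<j _ _ with Finₚ.<-cmp (v ∙ a) (v ∙ i) | Finₚ.<-cmp (v ∙ a) (v ∙ j)
    ...   | tri≈ _ e _ | _ = contradiction (∙-inj v e) a≢i
    ...   | _ | tri≈ _ e _ = contradiction (∙-inj v e) a≢j
    ...   | tri< va<vi _ _ | _
        rewrite β-no {a} (λ b → <-asym va<vi (proj₁ (proj₂ b))) | inv-no₁ w (<-asym a<j) | inv-no₁ v (<-asym a<j) | wi | wo a≢i a≢j
              | dec-true (i <ᶠ? a) i<a | dec-true (v ∙ a <ᶠ? v ∙ i) va<vi | dec-true (v ∙ a <ᶠ? v ∙ j) (<-trans va<vi vi<vj)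
               = refl
    ...   | tri> _ _ vi<va | tri> _ _ vj<va
        rewrite β-no {a} (λ b → <-asym vj<va (proj₂ (proj₂ b))) | inv-no₁ w (<-asym a<j) | inv-no₁ v (<-asym a<j) | wi | wo a≢i a≢j
              | dec-true (i <ᶠ? a) i<a | dec-false (v ∙ a <ᶠ? v ∙ i) (<-asym vi<va) | dec-false (v ∙ a <ᶠ? v ∙ j) (<-asym vj<va)
               = refl
    ...   | tri> _ _ vi<va | tri< va<vj _ _
        rewrite [yes] (between? v i j a) ((i<a , a<j) , (vi<va , va<vj)) | inv-no₁ w (<-asym a<j) | inv-no₁ v (<-asym a<j) | wi | wo a≢i a≢j
              | dec-true (i <ᶠ? a) i<a | dec-false (v ∙ a <ᶠ? v ∙ i) (<-asym vi<va) | dec-true (v ∙ a <ᶠ? v ∙ j) va<vj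
               = refl

    R : Perm n → Fin n → ℕ
    R u a = sum (inv u a)

    βi : β i ≡ 0
    βi = β-no {i} λ b → n≮n _ (proj₁ (proj₁ b))

    βj : β j ≡ 0
    βj = β-no {j} λ b → n≮n _ (proj₂ (proj₁ b))

    off-rows : ∀ a → a ≢ i → a ≢ j → R w a ≡ R v a + β a
    off-rows a a≢i a≢j = trans (sum-two (inv w a) (inv v a) (λ _ → 0) (β a) i≢j
        (λ x x≢i x≢j → trans (cong₂ (λ s t → [ (a <ᶠ? x) ×-dec (s <ᶠ? t) ]) (wo x≢i x≢j) (wo a≢i a≢j)) (sym (+-identityʳ _)))
        (trans (row a a≢i a≢j) (lem (inv v a i) (inv v a j) (β a))))
      (cong (_+ β a) (trans (cong (R v a +_) (zeros {n})) (+-identityʳ _)))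
      where
      lem : ∀ x y z → x + y + (z + 0) + 0 ≡ x + y + 0 + z
      lem = solve-∀
      zeros : ∀ {m} → sum {m} (λ (_ : Fin m) → 0) ≡ 0
      zeros {zero} = refl
      zeros {suc m} = zeros {m}

    -- Taken together, because the swap moves entries from one of these rows to the other. The 1 is
    -- the inversion (i, j) itself.
    on-rows : R w i + R w j ≡ R v i + R v j + sum β + 1
    on-rows = trans (sym (∑-distrib-+ (inv w i) (inv w j)))
      (trans (sum-two _ (λ x → inv v i x + inv v j x) β 1 i≢j (λ x p q → col x p q) two)
        (cong (λ s → s + sum β + 1) (∑-distrib-+ (inv v i) (inv v j))))
      where
      wj<wi : w ∙ j <ᶠ w ∙ i
      wj<wi = subst₂ _<ᶠ_ (sym wj) (sym wi) vi<vj
      two : inv w i i + inv w j i + (inv w i j + inv w j j) ≡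
            inv v i i + inv v j i + (inv v i j + inv v j j) + (β i + β j) + 1
      two rewrite inv-no₁ w {i} {i} (n≮n _) | inv-no₁ w {j} {j} (n≮n _) | inv-no₁ w (<-asym i<j) | inv-yes w i<j wj<wi
                | inv-no₁ v {i} {i} (n≮n _) | inv-no₁ v {j} {j} (n≮n _) | inv-no₁ v (<-asym i<j) | inv-no₂ v {i} {j} (<-asym vi<vj)
                | βi | βj = refl

  -- A point between `i` and `j` in position and value creates two inversions, one with each of
  -- them, and the pair itself creates one. So the length rises by exactly one if and only if there
  -- is no such point.
  ℓ-swap : ℓ w ≡ ℓ v + sum (λ m → [ between? v i j m ]) + (sum (λ m → [ between? v i j m ]) + 1)
  ℓ-swap = trans (ℓ-sum w) (trans (sum-two (R w) (R v) β (sum β + 1) i≢j off-rows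
      (trans on-rows (trans (lem (R v i) (R v j) (sum β)) (cong₂ (λ s t → R v i + R v j + (s + t) + (sum β + 1)) (sym βi) (sym βj)))))
    (cong (λ s → s + sum β + (sum β + 1)) (sym (ℓ-sum v))))
    where
    lem : ∀ x y z → x + y + z + 1 ≡ x + y + (0 + 0) + (z + 1)
    lem = solve-∀

-- The Bruhat order

≈ₚ-sym : {v w : Perm n} → v ≈ₚ w → w ≈ₚ v
≈ₚ-sym e x = sym (e x)

≈ₚ-trans : {u v w : Perm n} → u ≈ₚ v → v ≈ₚ w → u ≈ₚ w
≈ₚ-trans e f x = trans (e x) (f x)

sum-zero : (f : Fin n → ℕ) → (∀ x → f x ≡ 0) → sum f ≡ 0
sum-zero {zero} f z = refl
sum-zero {suc n} f z rewrite z Fin.zero = sum-zero (f ∘ Fin.suc) (z ∘ Fin.suc)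

term≤sum : (f : Fin n → ℕ) (x : Fin n) → f x ≤ sum f
term≤sum f Fin.zero = m≤m+n _ _
term≤sum f (Fin.suc x) = ≤-trans (term≤sum (f ∘ Fin.suc) x) (m≤n+m _ _)

ℓ-swap-< : {v w : Perm n} {i j : Fin n} → i <ᶠ j → v ∙ i <ᶠ v ∙ j → SwapOf v w i j → ℓ v < ℓ w
ℓ-swap-< {v = v} {w} {i} {j} p q s = subst (suc (ℓ v) ≤_) (sym (trans (ℓ-swap p q s) (lem (ℓ v) S))) (m≤m+n _ _)
  where
  S = sum (λ m → [ between? v i j m ])
  lem : ∀ x y → x + y + (y + 1) ≡ suc x + (y + y)
  lem = solve-∀

⊲⇒ℓ : {v w : Perm n} → v ⊲ w → ℓ w ≡ suc (ℓ v)
⊲⇒ℓ {v = v} {w} (cover {i} {j} p q s none) = trans (ℓ-swap p q s)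
  (trans (cong (λ S → ℓ v + S + (S + 1)) (sum-zero (λ m → [ between? v i j m ]) (λ m → [no] (between? v i j m) (none m))))
    (trans (cong (_+ 1) (+-identityʳ (ℓ v))) (+-comm (ℓ v) 1)))

-- If v i > v j, the swap would shorten `v`. In the other case the length formula leaves no room for
-- a point between.
SwapOf⇒⊲ : {v w : Perm n} {i j : Fin n} → i <ᶠ j → SwapOf v w i j → ℓ w ≡ suc (ℓ v) → v ⊲ w
SwapOf⇒⊲ {v = v} {w} {i} {j} i<j s e with Finₚ.<-cmp (v ∙ i) (v ∙ j)
... | tri≈ _ x _ = contradiction (∙-inj v x) (<⇒≢ᶠ i<j)
... | tri> _ _ x = contradiction (ℓ-swap-< i<j (subst₂ _<ᶠ_ (sym (SwapOf.at-l s)) (sym (SwapOf.at-r s)) x) (SwapOf-sym s))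
                     (λ lt → 1+n≰n (≤-trans (≤-reflexive (sym e)) (<⇒≤ lt)))
... | tri< x _ _ = cover i<j x s none
  where
  S = sum (λ m → [ between? v i j m ])
  lem : ∀ x y → x + y + (y + 1) ≡ suc x + (y + y)
  lem = solve-∀
  S≡0 : S ≡ 0
  S≡0 = m+n≡0⇒m≡0 S (+-cancelˡ-≡ (suc (ℓ v)) _ 0
    (trans (sym (trans (ℓ-swap i<j x s) (lem (ℓ v) S))) (trans e (sym (+-identityʳ _)))))
  none : ∀ m → ¬ Between v i j m
  none m b = 1+n≰n (subst₂ _≤_ ([yes] (between? v i j m) b) S≡0 (term≤sum (λ m → [ between? v i j m ]) m))

⋖⇒⊲ : (v w : Perm n) → v ⋖ w → v ⊲ w
⋖⇒⊲ {n} v w (i , j , i≢j , e , t) with Finₚ.<-cmp (v ∙⁻¹ i) (v ∙⁻¹ j)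
... | tri≈ _ x _ = contradiction (trans (sym (inverseʳ v)) (trans (cong (v ∙_) x) (inverseʳ v))) i≢j
... | tri< x _ _ = SwapOf⇒⊲ x s e
  where
  s : SwapOf v w (v ∙⁻¹ i) (v ∙⁻¹ j)
  s = swapped
    (trans (t _) (trans (cong (transpose i j ∙_) (inverseʳ v)) (trans (transpose-l i j) (sym (inverseʳ v)))))
    (trans (t _) (trans (cong (transpose i j ∙_) (inverseʳ v)) (trans (transpose-r i j) (sym (inverseʳ v)))))
    λ {x} p q → trans (t x) (transpose-o i j (λ r → p (trans (sym (inverseˡ v)) (cong (v ∙⁻¹_) r)))
                                               (λ r → q (trans (sym (inverseˡ v)) (cong (v ∙⁻¹_) r))))
... | tri> _ _ x = SwapOf⇒⊲ x s e
  where
  s : SwapOf v w (v ∙⁻¹ j) (v ∙⁻¹ i)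
  s = swapped
    (trans (t _) (trans (cong (transpose i j ∙_) (inverseʳ v)) (trans (transpose-r i j) (sym (inverseʳ v)))))
    (trans (t _) (trans (cong (transpose i j ∙_) (inverseʳ v)) (trans (transpose-l i j) (sym (inverseʳ v)))))
    λ {x} p q → trans (t x) (transpose-o i j (λ r → q (trans (sym (inverseˡ v)) (cong (v ∙⁻¹_) r)))
                                               (λ r → p (trans (sym (inverseˡ v)) (cong (v ∙⁻¹_) r))))

⊲⇒⋖ : {v w : Perm n} → v ⊲ w → v ⋖ w
⊲⇒⋖ {v = v} {w} c@(cover {i} {j} p q (swapped wi wj wo) none) = v ∙ i , v ∙ j , (λ e → <⇒≢ᶠ p (∙-inj v e)) , ⊲⇒ℓ c , t
  where
  t : ∀ x → w ∙ x ≡ transpose (v ∙ i) (v ∙ j) ∙ (v ∙ x)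
  t x with x ≟ᶠ i | x ≟ᶠ j
  ... | yes refl | _ = trans wi (sym (transpose-l (v ∙ i) (v ∙ j)))
  ... | no _ | yes refl = trans wj (sym (transpose-r (v ∙ i) (v ∙ j)))
  ... | no a | no b = trans (wo a b) (sym (transpose-o _ _ (a ∘ ∙-inj v) (b ∘ ∙-inj v)))

⊲-resp : {v v' w w' : Perm n} → v ≈ₚ v' → w ≈ₚ w' → v ⊲ w → v' ⊲ w'
⊲-resp e f (cover {i} {j} p q (swapped wi wj wo) none) = cover p (subst₂ _<ᶠ_ (e i) (e j) q)
  (swapped (trans (sym (f i)) (trans wi (e j))) (trans (sym (f j)) (trans wj (e i))) λ {x} a b → trans (sym (f x)) (trans (wo a b) (e x)))
  (λ m b → none m (proj₁ b , subst₂ _<ᶠ_ (sym (e i)) (sym (e m)) (proj₁ (proj₂ b)) , subst₂ _<ᶠ_ (sym (e m)) (sym (e j)) (proj₂ (proj₂ b))))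

step : {u v w : Perm n} → u ⊲ v → v ≤B w → u ≤B w
step {u = u} {v} {w} c = ≤B-step {u = u} {v} {w} (⊲⇒⋖ c)

≤B-respˡ : {v v' w : Perm n} → v ≈ₚ v' → v ≤B w → v' ≤B w
≤B-respˡ {v' = v'} {w} e (≤B-refl f) = ≤B-refl (λ x → trans (sym (e x)) (f x))
≤B-respˡ {v = v} {v'} e (≤B-step {v = y} c p) = step (⊲-resp {v = v} {v'} {y} {y} e (λ _ → refl) (⋖⇒⊲ v y c)) p

≤B-trans : {u v w : Perm n} → u ≤B v → v ≤B w → u ≤B w
≤B-trans {u = u} {v} (≤B-refl e) q = ≤B-respˡ (≈ₚ-sym {v = u} {v} e) q
≤B-trans {u = u} (≤B-step {v = y} c p) q = ≤B-step {u = u} {y} c (≤B-trans p q)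

≈⇒≤B : {v w : Perm n} → v ≈ₚ w → v ≤B w
≈⇒≤B {v = v} {w} = ≤B-refl {v = v} {w}

refl≤B : {v : Perm n} → v ≤B v
refl≤B {v = v} = ≤B-refl {v = v} {v} λ _ → refl

≤B-respʳ : {v w w' : Perm n} → w ≈ₚ w' → v ≤B w → v ≤B w'
≤B-respʳ {w = w} {w'} e p = ≤B-trans p (≤B-refl {v = w} {w'} e)

⊲⇒≤B : {v w : Perm n} → v ⊲ w → v ≤B w
⊲⇒≤B c = step c refl≤B

ℓ-id : ℓ (idₚ {n}) ≡ 0
ℓ-id {n} = trans (ℓ-sum (idₚ {n})) (sum-zero (λ a → sum (inv (idₚ {n}) a)) λ (a : Fin n) → sum-zero (inv idₚ a) λ b → [no] (inversion? idₚ a b) λ (p , q) → <-asym p q)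

-- An opaque copy of ℓ: unfolding the double sum during conversion checking is very costly.
abstract
  len : Perm n → ℕ
  len = ℓ

  len-cong : {v w : Perm n} → v ≈ₚ w → len v ≡ len w
  len-cong {v = v} {w} = ℓ-cong {v = v} {w}

  ⊲⇒len : {v w : Perm n} → v ⊲ w → len w ≡ suc (len v)
  ⊲⇒len = ⊲⇒ℓ

  len-swap-< : {v w : Perm n} {i j : Fin n} → i <ᶠ j → v ∙ i <ᶠ v ∙ j → SwapOf v w i j → len v < len w
  len-swap-< = ℓ-swap-<

  len-id : len (idₚ {n}) ≡ 0
  len-id {n} = ℓ-id {n}

-- Covers raise the length, so comparable elements of equal length are equal; antisymmetry and the
-- absence of elements inside a cover both rest on this.
≈⊎len< : {v w : Perm n} → v ≤B w → (v ≈ₚ w) ⊎ (len v < len w)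
≈⊎len< (≤B-refl e) = inj₁ e
≈⊎len< {v = u} {w} (≤B-step {v = v} c p) = inj₂ (≤-trans (≤-reflexive (sym (⊲⇒len (⋖⇒⊲ u v c))))
  ([ (λ e → ≤-reflexive (len-cong {v = v} {w} e)) , <⇒≤ ]′ (≈⊎len< p)))

len-mono : {v w : Perm n} → v ≤B w → len v ≤ len w
len-mono {v = v} {w} p = [ (λ e → ≤-reflexive (len-cong {v = v} {w} e)) , <⇒≤ ]′ (≈⊎len< p)

≤B-len≥⇒≈ : {v w : Perm n} → v ≤B w → len w ≤ len v → v ≈ₚ w
≤B-len≥⇒≈ p q = [ id , (λ lt → contradiction lt (≤⇒≯ q)) ]′ (≈⊎len< p)

≤B-antisym : {v w : Perm n} → v ≤B w → w ≤B v → v ≈ₚ w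
≤B-antisym {v = v} {w} p q = ≤B-len≥⇒≈ {v = v} {w} p (len-mono q)

⊲⇒≉ : {v w : Perm n} → v ⊲ w → ¬ (v ≈ₚ w)
⊲⇒≉ {v = v} {w} c e = <⇒≢ (≤-reflexive (sym (⊲⇒len c))) (len-cong {v = v} {w} e)

⊲-nothing-between : {x y z : Perm n} → x ⊲ y → x ≤B z → z ≤B y → (x ≈ₚ z) ⊎ (z ≈ₚ y)
⊲-nothing-between {x = x} {y} {z} c p q =
  [ inj₂ , (λ lt → inj₁ (≤B-len≥⇒≈ {v = x} {z} p (s≤s⁻¹ (≤-trans lt (≤-reflexive (⊲⇒len c)))))) ]′ (≈⊎len< q)

SwapOf-unique : {v w w' : Perm n} {i j : Fin n} → SwapOf v w i j → SwapOf v w' i j → w ≈ₚ w'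
SwapOf-unique {i = i} {j} (swapped a b c) (swapped a' b' c') x with x ≟ᶠ i | x ≟ᶠ j
... | yes refl | _ = trans a (sym a')
... | no _ | yes refl = trans b (sym b')
... | no p | no q = trans (c p q) (sym (c' p q))

-- A point m between p and q splits the step down into three shorter ones, since (p q) = (p m)(m q)(p m).
inversion-swap-≤ : {w x : Perm n} {p q : Fin n} → p <ᶠ q → w ∙ q <ᶠ w ∙ p → SwapOf w x p q → x ≤B w
inversion-swap-≤ {n} {p = p₀} {q₀} = λ lt → go (toℕ q₀) lt (m≤m+n _ _)
  where
  go : ∀ d {w x : Perm n} {p q : Fin n} → p <ᶠ q → toℕ q ≤ d + toℕ p → w ∙ q <ᶠ w ∙ p → SwapOf w x p q → x ≤B w
  go zero p<q b _ _ = contradiction p<q (≤⇒≯ b)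
  go (suc d) {w} {x} {p} {q} p<q b wq<wp s@(swapped xp xq xo) with any? (between? x p q)
  ... | no none = ⊲⇒≤B (cover p<q (subst₂ _<ᶠ_ (sym xp) (sym xq) wq<wp) (SwapOf-sym s) (λ m bt → none (m , bt)))
  ... | yes (m , ((p<m , m<q) , (xp<xm , xm<xq))) =
        ≤B-respˡ w₃≈x (≤B-trans (go d p<m b₁ w₂m<w₂p (swap-SwapOf w₂ p m))
          (≤B-trans (go d m<q b₂ w₁q<w₁m (swap-SwapOf w₁ m q)) (go d p<m b₁ wm<wp (swap-SwapOf w p m))))
    where
    p≢m = <⇒≢ᶠ p<m
    m≢q = <⇒≢ᶠ m<q
    p≢q = <⇒≢ᶠ p<q
    w₁ = swap p m w
    w₂ = swap m q w₁
    w₃ = swap p m w₂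
    b₁ : toℕ m ≤ d + toℕ p
    b₁ = s≤s⁻¹ (≤-trans m<q b)
    b₂ : toℕ q ≤ d + toℕ m
    b₂ = ≤-trans b (≤-trans (≤-reflexive (sym (+-suc d (toℕ p)))) (+-monoʳ-≤ d p<m))
    xm = xo (≢-sym p≢m) m≢q
    wm<wp : w ∙ m <ᶠ w ∙ p
    wm<wp = subst₂ _<ᶠ_ xm xq xm<xq
    wq<wm : w ∙ q <ᶠ w ∙ m
    wq<wm = subst₂ _<ᶠ_ xp xm xp<xm
    w₁q = swap-o w p m (≢-sym p≢q) (≢-sym m≢q)
    w₁q<w₁m : w₁ ∙ q <ᶠ w₁ ∙ m
    w₁q<w₁m = subst₂ _<ᶠ_ (sym w₁q) (sym (swap-r w p m)) wq<wp
    w₂m : w₂ ∙ m ≡ w ∙ q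
    w₂m = trans (swap-l w₁ m q) w₁q
    w₂p : w₂ ∙ p ≡ w ∙ m
    w₂p = trans (swap-o w₁ m q p≢m p≢q) (swap-l w p m)
    w₂q : w₂ ∙ q ≡ w ∙ p
    w₂q = trans (swap-r w₁ m q) (swap-r w p m)
    w₂m<w₂p : w₂ ∙ m <ᶠ w₂ ∙ p
    w₂m<w₂p = subst₂ _<ᶠ_ (sym w₂m) (sym w₂p) wq<wm
    w₃≈x : w₃ ≈ₚ x
    w₃≈x y = at (y ≟ᶠ p) (y ≟ᶠ q) (y ≟ᶠ m)
      where
      at : Dec (y ≡ p) → Dec (y ≡ q) → Dec (y ≡ m) → w₃ ∙ y ≡ x ∙ y
      at (yes refl) _ _ = trans (swap-l w₂ p m) (trans w₂m (sym xp))
      at (no a) (yes refl) _ = trans (swap-o w₂ p m a (≢-sym m≢q)) (trans w₂q (sym xq))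
      at (no a) (no c) (yes refl) = trans (swap-r w₂ p m) (trans w₂p (sym xm))
      at (no a) (no c) (no e) = trans (swap-o w₂ p m a e) (trans (swap-o w₁ m q e c) (trans (swap-o w p m a e) (sym (xo a c))))

-- Minimality only against undoing a single inversion. Such a step may lower the length by more than
-- one, but it stays below by `inversion-swap-≤`.
IsMinimal : (X : Perm n → Set) → Perm n → Set
IsMinimal X z = ∀ {p q} → IsInversion z p q → ¬ X (swap p q z)

minimal : (X : Perm n → Set) → (∀ v → Dec (X v)) → ∀ w → X w → Σ (Perm n) λ z → (z ≤B w) × X z × IsMinimal X z
minimal {n} X X? w₀ = go (suc (len w₀)) w₀ ≤-refl
  where
  go : ∀ d w → len w < d → X w → Σ (Perm n) λ z → (z ≤B w) × X z × IsMinimal X z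
  go (suc d) w b x with any? (λ p → any? (λ q → inversion? w p q ×-dec X? (swap p q w)))
  ... | no none = w , refl≤B , x , λ {p} {q} i x' → none (p , q , i , x')
  ... | yes (p , q , (p<q , wq<wp) , x') =
    let s = swap-SwapOf w p q
        lt = len-swap-< p<q (subst₂ _<ᶠ_ (sym (SwapOf.at-l s)) (sym (SwapOf.at-r s)) wq<wp) (SwapOf-sym s)
        z , z≤ , xz , m = go d (swap p q w) (≤-trans lt (s≤s⁻¹ b)) x'
    in z , ≤B-trans z≤ (inversion-swap-≤ p<q wq<wp s) , xz , m

increasing-≥ : (f : Fin n → Fin n) → (∀ {x y} → x <ᶠ y → f x <ᶠ f y) → ∀ x → toℕ x ≤ toℕ (f x)
increasing-≥ {n} f inc x = go (toℕ x) x refl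
  where
  go : ∀ a x → toℕ x ≡ a → a ≤ toℕ (f x)
  go zero x e = z≤n
  go (suc a) x e = ≤-trans (s≤s (go a y (toℕ-fromℕ< lt))) (inc (subst₂ _<_ (sym (toℕ-fromℕ< lt)) (sym e) ≤-refl))
    where
    lt : a < n
    lt = <-trans (≤-reflexive (sym e)) (toℕ<n x)
    y = fromℕ< lt

-- Both `w` and its inverse are increasing, and an increasing self-map moves no point down.
no-inversions⇒id : (w : Perm n) → (∀ {p q} → ¬ IsInversion w p q) → w ≈ₚ idₚ
no-inversions⇒id w none x = toℕ-injective (≤-antisym
    (subst (toℕ (w ∙ x) ≤_) (cong toℕ (inverseˡ w)) (increasing-≥ (w ∙⁻¹_) inc⁻¹ (w ∙ x)))
    (increasing-≥ (w ∙_) inc x))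
  where
  inc : ∀ {x y} → x <ᶠ y → w ∙ x <ᶠ w ∙ y
  inc {x} {y} lt with Finₚ.<-cmp (w ∙ x) (w ∙ y)
  ... | tri< a _ _ = a
  ... | tri≈ _ e _ = contradiction (∙-inj w e) (<⇒≢ᶠ lt)
  ... | tri> _ _ a = contradiction (lt , a) none
  inc⁻¹ : ∀ {x y} → x <ᶠ y → w ∙⁻¹ x <ᶠ w ∙⁻¹ y
  inc⁻¹ {x} {y} lt with Finₚ.<-cmp (w ∙⁻¹ x) (w ∙⁻¹ y)
  ... | tri< a _ _ = a
  ... | tri≈ _ e _ = contradiction (trans (sym (inverseʳ w)) (trans (cong (w ∙_) e) (inverseʳ w))) (<⇒≢ᶠ lt)
  ... | tri> _ _ a = contradiction (a , subst₂ _<ᶠ_ (sym (inverseʳ w)) (sym (inverseʳ w)) lt) none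

abstract
  -- An element minimal for the trivial property has no inversions.
  id-least : (w : Perm n) → idₚ ≤B w
  id-least w = let z , z≤w , _ , m = minimal (λ _ → ⊤) (λ _ → yes tt) w tt in
    ≤B-respˡ (no-inversions⇒id z λ i → m i tt) z≤w

-- Symmetries of the Bruhat order: inversion, and composition with the longest element

∙⁻¹-SwapOf : {v w : Perm n} {i j : Fin n} → SwapOf v w i j → SwapOf (flip v) (flip w) (v ∙ i) (v ∙ j)
∙⁻¹-SwapOf {v = v} {w} (swapped a b c) = swapped
  (trans (cong (w ∙⁻¹_) (sym b)) (trans (inverseˡ w) (sym (inverseˡ v))))
  (trans (cong (w ∙⁻¹_) (sym a)) (trans (inverseˡ w) (sym (inverseˡ v))))
  λ {x} p q → trans (cong (w ∙⁻¹_) (sym (trans (c (λ e → p (trans (sym (inverseʳ v)) (cong (v ∙_) e)))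
                                         (λ e → q (trans (sym (inverseʳ v)) (cong (v ∙_) e)))) (inverseʳ v))))
                      (inverseˡ w)

⊲-flip : {v w : Perm n} → v ⊲ w → flip v ⊲ flip w
⊲-flip {v = v} {w} (cover {i} {j} p q s none) = cover q (subst₂ _<ᶠ_ (sym (inverseˡ v)) (sym (inverseˡ v)) p) (∙⁻¹-SwapOf {v = v} {w} s)
  λ m ((a , b) , (c , d)) → none (v ∙⁻¹ m)
    ((subst (_<ᶠ _) (inverseˡ v) c , subst (_ <ᶠ_) (inverseˡ v) d) , (subst (_ <ᶠ_) (sym (inverseʳ v)) a , subst (_<ᶠ _) (sym (inverseʳ v)) b))

flip-cong : {v w : Perm n} → v ≈ₚ w → flip v ≈ₚ flip w
flip-cong {v = v} {w} e x = trans (cong (v ∙⁻¹_) (sym (inverseʳ w))) (trans (cong (v ∙⁻¹_) (sym (e _))) (inverseˡ v))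

≤B-flip : {v w : Perm n} → v ≤B w → flip v ≤B flip w
≤B-flip {v = v} {w} (≤B-refl e) = ≤B-refl (flip-cong {v = v} {w} e)
≤B-flip (≤B-step {u} {v} c p) = step (⊲-flip (⋖⇒⊲ u v c)) (≤B-flip p)

opposite-< : {a b : Fin n} → a <ᶠ b → opposite b <ᶠ opposite a
opposite-< {n} {a} {b} lt = subst₂ _<_ (sym (Finₚ.opposite-prop b)) (sym (Finₚ.opposite-prop a)) (∸-monoʳ-< (s<s lt) (toℕ<n b))

opposite-<⁻¹ : {a b : Fin n} → opposite b <ᶠ opposite a → a <ᶠ b
opposite-<⁻¹ {a = a} {b} lt = subst₂ _<ᶠ_ (Finₚ.opposite-involutive a) (Finₚ.opposite-involutive b) (opposite-< lt)

-- Reversing the values turns the order upside down, so that the greatest element is obtained from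
-- the least one.
⊲-opposite : {v w : Perm n} → v ⊲ w → (w ∘ₚ w₀ n) ⊲ (v ∘ₚ w₀ n)
⊲-opposite {v = v} {w} (cover {i} {j} p q s@(swapped a b c) none) =
  cover p (opposite-< (subst₂ _<ᶠ_ (sym b) (sym a) q))
    (swapped (cong opposite (sym b)) (cong opposite (sym a)) λ p' q' → cong opposite (sym (c p' q')))
    λ m ((i<m , m<j) , (r , t)) → none m ((i<m , m<j) ,
      ( subst₂ _<ᶠ_ b (c (≢-sym (<⇒≢ᶠ i<m)) (<⇒≢ᶠ m<j)) (opposite-<⁻¹ t)
      , subst₂ _<ᶠ_ (c (≢-sym (<⇒≢ᶠ i<m)) (<⇒≢ᶠ m<j)) a (opposite-<⁻¹ r)))

≤B-opposite : {v w : Perm n} → v ≤B w → (w ∘ₚ w₀ n) ≤B (v ∘ₚ w₀ n)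
≤B-opposite {v = v} {w} (≤B-refl e) = ≤B-refl λ x → cong opposite (sym (e x))
≤B-opposite (≤B-step {u} {v} c p) = ≤B-trans (≤B-opposite p) (⊲⇒≤B (⊲-opposite (⋖⇒⊲ u v c)))

abstract
  w₀-greatest : (w : Perm n) → w ≤B w₀ n
  w₀-greatest w = ≤B-respˡ {v = (w ∘ₚ w₀ _) ∘ₚ w₀ _} {w} (λ x → Finₚ.opposite-involutive (w ∙ x)) (≤B-opposite (id-least (w ∘ₚ w₀ _)))

-- Generators below a permutation

-- D i w says that the generator s_i, exchanging i and i + 1, lies below w; E i w says that a fixed
-- one of the two products of s_i and s_(i+1) does, and E i (flip w) that the other one does.
record T {n} (i j : ℕ) (w : Perm n) : Set where
  constructor exceed
  field
    a    : Fin n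
    a≤i  : toℕ a ≤ i
    j<wa : j < toℕ (w ∙ a)

D E : ℕ → Perm n → Set
D i = T i i
E i = T i (suc i)

T? : ∀ i j (w : Perm n) → Dec (T i j w)
T? i j w = map′ (λ (a , p , q) → exceed a p q) (λ (exceed a p q) → a , p , q) (any? λ a → (toℕ a ≤? i) ×-dec (j <? toℕ (w ∙ a)))

T-cong : ∀ {i j} {v w : Perm n} → v ≈ₚ w → T i j v → T i j w
T-cong {j = j} e (exceed a p q) = exceed a p (subst (λ x → j < toℕ x) (e a) q)

-- A cover moves the larger of the two values to the earlier position, so a witness survives,
-- possibly at the other position.
T-⊲ : ∀ {i j} {v w : Perm n} → v ⊲ w → T i j v → T i j w
T-⊲ {j = j} (cover {p} {q} p<q vp<vq (swapped wp wq wo) _) (exceed a a≤i j<va) with a ≟ᶠ p | a ≟ᶠ q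
... | yes refl | _ = exceed p a≤i (subst (λ x → j < toℕ x) (sym wp) (<-trans j<va vp<vq))
... | no _ | yes refl = exceed p (≤-trans (<⇒≤ p<q) a≤i) (subst (λ x → j < toℕ x) (sym wp) j<va)
... | no r | no s = exceed a a≤i (subst (λ x → j < toℕ x) (sym (wo r s)) j<va)

T-mono : ∀ {i j} {v w : Perm n} → v ≤B w → T i j v → T i j w
T-mono {v = v} {w} (≤B-refl e) t = T-cong {v = v} {w} e t
T-mono (≤B-step {u} {v} c p) t = T-mono p (T-⊲ (⋖⇒⊲ u v c) t)

-- Pigeonhole: if all values up to `i` came from positions up to `i`, these i + 1 positions would
-- all avoid `a`, which is itself one of the first i + 1.
D-flip : ∀ {i} {w : Perm n} → D i w → D i (flip w)
D-flip {n} {i} {w} (exceed a a≤i i<wa) = decidable-stable (T? i i (flip w)) absurd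
  where
  absurd : ¬ ¬ D i (flip w)
  absurd none = 1+n≰n (Finₚ.injective⇒≤ {f = h} h-inj)
    where
    i<n : i < n
    i<n = <-trans i<wa (toℕ<n (w ∙ a))
    emb : Fin (suc i) → Fin n
    emb b = fromℕ< (<-≤-trans (toℕ<n b) i<n)
    toℕ-emb : ∀ b → toℕ (emb b) ≡ toℕ b
    toℕ-emb b = toℕ-fromℕ< _
    emb≤ : ∀ b → toℕ (emb b) ≤ i
    emb≤ b = subst (_≤ i) (sym (toℕ-emb b)) (s≤s⁻¹ (toℕ<n b))
    g≤ : ∀ b → toℕ (w ∙⁻¹ emb b) ≤ i
    g≤ b = ≮⇒≥ λ lt → none (exceed (emb b) (emb≤ b) lt)
    g : Fin (suc i) → Fin (suc i)
    g b = fromℕ< (s≤s (g≤ b))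
    toℕ-g : ∀ b → toℕ (g b) ≡ toℕ (w ∙⁻¹ emb b)
    toℕ-g b = toℕ-fromℕ< (s≤s (g≤ b))
    a' = fromℕ< (s≤s a≤i)
    toℕ-a' : toℕ a' ≡ toℕ a
    toℕ-a' = toℕ-fromℕ< (s≤s a≤i)
    a'≢g : ∀ b → a' ≢ g b
    a'≢g b e = <⇒≱ i<wa (subst (λ x → toℕ x ≤ i) emb≡wa (emb≤ b))
      where
      a≡ : a ≡ w ∙⁻¹ emb b
      a≡ = toℕ-injective (trans (sym toℕ-a') (trans (cong toℕ e) (toℕ-g b)))
      emb≡wa : emb b ≡ w ∙ a
      emb≡wa = trans (sym (inverseʳ w)) (cong (w ∙_) (sym a≡))
    h : Fin (suc i) → Fin i
    h b = punchOut (a'≢g b)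
    h-inj : ∀ {b c} → h b ≡ h c → b ≡ c
    h-inj {b} {c} e = toℕ-injective (trans (sym (toℕ-emb b)) (trans (cong toℕ emb≡) (toℕ-emb c)))
      where
      gbc : g b ≡ g c
      gbc = Finₚ.punchOut-injective (a'≢g b) (a'≢g c) e
      emb≡ : emb b ≡ emb c
      emb≡ = ∙-inj (flip w) (toℕ-injective (trans (sym (toℕ-g b)) (trans (cong toℕ gbc) (toℕ-g c))))

flip-D : ∀ {i} {w : Perm n} → D i (flip w) → D i w
flip-D d with D-flip d
... | exceed a a≤i lt = exceed a a≤i lt

lo hi : ∀ {i} → suc i < n → Fin n
lo lt = fromℕ< (<⇒≤ lt)
hi lt = fromℕ< lt

gen : ∀ {i} → suc i < n → Perm n
gen lt = swap (lo lt) (hi lt) idₚ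

toℕ-lo : ∀ {i} (lt : suc i < n) → toℕ (lo lt) ≡ i
toℕ-lo lt = toℕ-fromℕ< (<⇒≤ lt)

toℕ-hi : ∀ {i} (lt : suc i < n) → toℕ (hi lt) ≡ suc i
toℕ-hi lt = toℕ-fromℕ< lt

lo<hi : ∀ {i} (lt : suc i < n) → lo lt <ᶠ hi lt
lo<hi lt = ≤-reflexive (trans (cong suc (toℕ-lo lt)) (sym (toℕ-hi lt)))

no-between-consecutive : ∀ {i} (lt : suc i < n) {m : Fin n} → lo lt <ᶠ m → m <ᶠ hi lt → ⊥
no-between-consecutive lt a b = <⇒≱ b (subst (_≤ _) (trans (cong suc (toℕ-lo lt)) (sym (toℕ-hi lt))) a)

swap-gen-⊲ : ∀ {i} (w : Perm n) (lt : suc i < n) → w ∙ lo lt <ᶠ w ∙ hi lt → w ⊲ swap (lo lt) (hi lt) w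
swap-gen-⊲ w lt a = cover (lo<hi lt) a (swap-SwapOf w (lo lt) (hi lt)) λ m ((p , q) , _) → no-between-consecutive lt p q

id⊲gen : ∀ {i} (lt : suc i < n) → idₚ ⊲ gen lt
id⊲gen lt = swap-gen-⊲ idₚ lt (lo<hi lt)

D-gen : ∀ {i} (lt : suc i < n) → D i (gen lt)
D-gen {i = i} lt = exceed (lo lt) (≤-reflexive (toℕ-lo lt)) (≤-reflexive (sym (trans (cong toℕ (swap-l idₚ (lo lt) (hi lt))) (toℕ-hi lt))))

¬D-id : ∀ {i} → ¬ D i (idₚ {n})
¬D-id (exceed a p q) = <⇒≱ q p

D-swap⇒ : ∀ {i l} {v : Perm n} (lt : suc i < n) → D l (swap (lo lt) (hi lt) v) → D l v ⊎ (l ≡ i)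
D-swap⇒ {i = i} {l} {v} lt (exceed a p q) with a ≟ᶠ lo lt | a ≟ᶠ hi lt
... | no r | no s = inj₁ (exceed a p (subst (λ x → l < toℕ x) (swap-o v (lo lt) (hi lt) r s) q))
... | no _ | yes refl = inj₁ (exceed (lo lt) (≤-trans (<⇒≤ (lo<hi lt)) p) (subst (λ x → l < toℕ x) (swap-r v (lo lt) (hi lt)) q))
... | yes refl | _ with l ≟ i
...   | yes e = inj₂ e
...   | no l≢i = inj₁ (exceed (hi lt) (subst (_≤ l) (sym (toℕ-hi lt)) (≤∧≢⇒< (subst (_≤ l) (toℕ-lo lt) p) (≢-sym l≢i)))
                      (subst (λ x → l < toℕ x) (swap-l v (lo lt) (hi lt)) q))

D-gen⇒≡ : ∀ {i l} (lt : suc i < n) → D l (gen lt) → l ≡ i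
D-gen⇒≡ lt d with D-swap⇒ {v = idₚ} lt d
... | inj₁ d' = contradiction d' ¬D-id
... | inj₂ e = e

SwapOf⇒gen : ∀ {i} (lt : suc i < n) {v w : Perm n} {p q} → toℕ p ≡ i → toℕ q ≡ suc i → SwapOf v w p q → w ≈ₚ swap (lo lt) (hi lt) v
SwapOf⇒gen lt {v} {w} {p} {q} ep eq s = SwapOf-unique {v = v} {w} {swap (lo lt) (hi lt) v}
  (subst₂ (SwapOf v w) (toℕ-injective (trans ep (sym (toℕ-lo lt)))) (toℕ-injective (trans eq (sym (toℕ-hi lt)))) s)
  (swap-SwapOf v (lo lt) (hi lt))

-- In the identity a point between `p` and `q` in position is so in value as well; hence a cover
-- exchanges neighbours.
atom⇒gen : {y : Perm n} → idₚ ⊲ y → ∃ λ i → Σ (suc i < n) λ lt → y ≈ₚ gen lt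
atom⇒gen {n} {y} (cover {p} {q} p<q _ s none) = toℕ p , lt , SwapOf⇒gen lt {idₚ} {y} refl q≡ s
  where
  lt : suc (toℕ p) < n
  lt = ≤-<-trans p<q (toℕ<n q)
  q≡ : toℕ q ≡ suc (toℕ p)
  q≡ with <-cmp (toℕ q) (suc (toℕ p))
  ... | tri≈ _ e _ = e
  ... | tri< l _ _ = contradiction p<q (<⇒≱ l)
  ... | tri> _ _ l = contradiction ((a , b) , (a , b)) (none (fromℕ< lt))
    where
    a : toℕ p < toℕ (fromℕ< lt)
    a = ≤-reflexive (sym (toℕ-fromℕ< lt))
    b : toℕ (fromℕ< lt) < toℕ q
    b = subst (_< toℕ q) (sym (toℕ-fromℕ< lt)) l

-- Three kinds of inversions that can be undone without losing the test, hence absent from a minimal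
-- `z`: undoing them keeps the witness `a`, or leaves a value above `j` at some position up to `i`.
module MinimalT {i j : ℕ} {z : Perm n} (m : IsMinimal (T i j) z) {a : Fin n} (a≤i : toℕ a ≤ i) (j<za : j < toℕ (z ∙ a)) where

  inversion-meets : ∀ {p q} → p <ᶠ q → z ∙ q <ᶠ z ∙ p → p ≢ a → q ≢ a → ⊥
  inversion-meets {p} {q} lt inv r s = m (lt , inv) (exceed a a≤i (subst (λ x → j < toℕ x) (sym (swap-o z p q (≢-sym r) (≢-sym s))) j<za))

  inversion-target> : ∀ {p q} → p <ᶠ q → z ∙ q <ᶠ z ∙ p → toℕ q ≤ i → j < toℕ (z ∙ p) → ⊥
  inversion-target> {p} {q} lt inv r s = m (lt , inv) (exceed q r (subst (λ x → j < toℕ x) (sym (swap-r z p q)) s))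

  inversion-value≤ : ∀ {p q} → p <ᶠ q → z ∙ q <ᶠ z ∙ p → toℕ p ≤ i → j < toℕ (z ∙ q) → ⊥
  inversion-value≤ {p} {q} lt inv r s = m (lt , inv) (exceed p r (subst (λ x → j < toℕ x) (sym (swap-l z p q)) s))

-- Some `a ≤ i` is sent above `i`, and some `q` above `i` is sent to at most `i`. By minimality,
-- exchanging them gives a `z'` that preserves both sides of `i`; an inversion of `z'` would yield
-- one of `z` that can be undone, so `z'` is the identity. Thus `z` only exchanges `a` and `q`, and
-- minimality pushes these to `i` and i + 1.
minimalD⇒gen : ∀ {i} {z : Perm n} → D i z → IsMinimal (D i) z → Σ (suc i < n) λ lt → z ≈ₚ gen lt
minimalD⇒gen {n} {i} {z} d@(exceed a a≤i i<za) m with D-flip d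
... | exceed b b≤i i<q = lt , SwapOf⇒gen lt {idₚ} {z} a≡i q≡ s
  where
  open MinimalT {z = z} m a≤i i<za
  q = z ∙⁻¹ b
  zq≤i : toℕ (z ∙ q) ≤ i
  zq≤i = subst (λ x → toℕ x ≤ i) (sym (inverseʳ z)) b≤i
  a<q : a <ᶠ q
  a<q = ≤-<-trans a≤i i<q
  q≢a : q ≢ a
  q≢a = ≢-sym (<⇒≢ᶠ a<q)
  zq<za : z ∙ q <ᶠ z ∙ a
  zq<za = ≤-<-trans zq≤i i<za
  z' = swap a q z
  z'a : z' ∙ a ≡ z ∙ q
  z'a = swap-l z a q
  z'q : z' ∙ q ≡ z ∙ a
  z'q = swap-r z a q
  z'o : ∀ {x} → x ≢ a → x ≢ q → z' ∙ x ≡ z ∙ x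
  z'o = swap-o z a q
  ¬Dz' : ¬ D i z'
  ¬Dz' = m (a<q , zq<za)
  low : ∀ {x} → toℕ x ≤ i → toℕ (z' ∙ x) ≤ i
  low {x} p = ≮⇒≥ λ l → ¬Dz' (exceed x p l)
  high : ∀ {x} → i < toℕ x → i < toℕ (z' ∙ x)
  high {x} p = ≰⇒> λ l → ¬Dz' (flip-D (exceed (z' ∙ x) l (subst (λ y → i < toℕ y) (sym (inverseˡ z')) p)))
  none : ∀ {p' q'} → ¬ IsInversion z' p' q'
  none {p'} {q'} (lt , inv) with toℕ p' ≤? i | toℕ q' ≤? i
  ... | no p'>i | yes q'≤i = <-asym lt (≤-<-trans q'≤i (≰⇒> p'>i))
  ... | yes p'≤i | no q'>i = <-asym inv (≤-<-trans (low p'≤i) (high (≰⇒> q'>i)))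
  ... | yes p'≤i | yes q'≤i with p' ≟ᶠ a | q' ≟ᶠ a
  ...   | yes refl | yes refl = n≮n _ lt
  ...   | no r | no s = inversion-meets lt (subst₂ _<ᶠ_ (z'o s (≢q q'≤i)) (z'o r (≢q p'≤i)) inv) r s
    where
    ≢q : ∀ {x} → toℕ x ≤ i → x ≢ q
    ≢q le refl = <⇒≱ i<q le
  ...   | no r | yes refl = inversion-meets (<-trans lt a<q) (subst₂ _<ᶠ_ z'a (z'o r (λ { refl → <⇒≱ i<q p'≤i })) inv) r q≢a
  ...   | yes refl | no s = inversion-target> lt
          (<-trans (subst₂ _<ᶠ_ (z'o s (λ { refl → <⇒≱ i<q q'≤i })) z'a inv) zq<za) q'≤i i<za
  none {p'} {q'} (lt , inv) | no p'>i | no q'>i with p' ≟ᶠ q | q' ≟ᶠ q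
  ...   | yes refl | yes refl = n≮n _ lt
  ...   | no r | no s = inversion-meets lt (subst₂ _<ᶠ_ (z'o (λ { refl → q'>i a≤i }) s) (z'o (λ { refl → p'>i a≤i }) r) inv)
                          (λ { refl → p'>i a≤i }) (λ { refl → q'>i a≤i })
  ...   | yes refl | no s = inversion-value≤ (<-trans a<q lt) (subst₂ _<ᶠ_ z'q' z'q inv) a≤i (subst (λ y → i < toℕ y) z'q' (high (≰⇒> q'>i)))
    where
    z'q' : z' ∙ q' ≡ z ∙ q'
    z'q' = z'o (λ { refl → q'>i a≤i }) s
  ...   | no r | yes refl = inversion-meets lt (<-trans zq<za (subst₂ _<ᶠ_ z'q (z'o p'≢a r) inv)) p'≢a q≢a
    where
    p'≢a : p' ≢ a
    p'≢a refl = p'>i a≤i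
  z'≈id = no-inversions⇒id z' none
  s : SwapOf idₚ z a q
  s = swapped (trans (sym z'q) (z'≈id q)) (trans (sym z'a) (z'≈id a)) λ {x} r t → trans (sym (z'o r t)) (z'≈id x)
  za = SwapOf.at-l s
  zo = λ {x} → SwapOf.away s {x}
  i<n : i < n
  i<n = <-trans i<q (toℕ<n q)
  a≡i : toℕ a ≡ i
  a≡i with toℕ a ≟ i
  ... | yes e = e
  -- Otherwise `z` fixes the position `i`, and exchanging it with `a` keeps the test.
  ... | no ne = ⊥-elim (inversion-target> a<x (subst₂ _<ᶠ_ (sym zx) (sym za) x<q) (≤-reflexive tx) i<za)
    where
    x = fromℕ< i<n
    tx : toℕ x ≡ i
    tx = toℕ-fromℕ< i<n
    a<x : a <ᶠ x
    a<x = subst (toℕ a <_) (sym tx) (≤∧≢⇒< a≤i ne)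
    x<q : x <ᶠ q
    x<q = subst (_< toℕ q) (sym tx) i<q
    zx : z ∙ x ≡ x
    zx = zo (≢-sym (<⇒≢ᶠ a<x)) (<⇒≢ᶠ x<q)
  lt : suc i < n
  lt = ≤-<-trans i<q (toℕ<n q)
  q≡ : toℕ q ≡ suc i
  q≡ with toℕ q ≟ suc i
  ... | yes e = e
  ... | no ne = ⊥-elim (inversion-value≤ a<x (subst₂ _<ᶠ_ (sym zx) (sym za) x<q) a≤i (subst (λ y → i < toℕ y) (sym zx) (≤-reflexive (sym tx))))
    where
    x = fromℕ< lt
    tx : toℕ x ≡ suc i
    tx = toℕ-fromℕ< lt
    a<x : a <ᶠ x
    a<x = subst (toℕ a <_) (sym tx) (s≤s a≤i)
    x<q : x <ᶠ q
    x<q = subst (_< toℕ q) (sym tx) (≤∧≢⇒< i<q (≢-sym ne))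
    zx : z ∙ x ≡ x
    zx = zo (≢-sym (<⇒≢ᶠ a<x)) (<⇒≢ᶠ x<q)

abstract
  D⇒gen≤ : ∀ {i} {w : Perm n} → D i w → Σ (suc i < n) λ lt → gen lt ≤B w
  D⇒gen≤ {i = i} {w} d =
    let z , z≤w , dz , m = minimal (D i) (T? i i) w d
        lt , e = minimalD⇒gen {z = z} dz m
    in lt , ≤B-respˡ e z≤w

gen≤⇒D : ∀ {i} {w : Perm n} (lt : suc i < n) → gen lt ≤B w → D i w
gen≤⇒D lt p = T-mono p (D-gen lt)

-- The position `x` = i + 1 lies between `a` and `q`. If z q < z x, the inversion (x, q) avoids `a`.
-- Otherwise `x` too is sent to at most `i`; then even after `a` and `q` are exchanged some `p ≤ i`
-- is sent above `i`, and the inversion (p, q) avoids `a`.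
minimalE⇒¬E-flip : ∀ {i} {z : Perm n} → E i z → IsMinimal (E i) z → ¬ E i (flip z)
minimalE⇒¬E-flip {n} {i} {z} (exceed a a≤i j<za) m (exceed b b≤i i+1<q) = go (Finₚ.<-cmp (z ∙ q) (z ∙ x))
  where
  open MinimalT {z = z} m a≤i j<za
  q = z ∙⁻¹ b
  x : Fin n
  x = fromℕ< (<-trans i+1<q (toℕ<n q))
  tx : toℕ x ≡ suc i
  tx = toℕ-fromℕ< _
  i<x : i < toℕ x
  i<x = ≤-reflexive (sym tx)
  zq≤i : toℕ (z ∙ q) ≤ i
  zq≤i = subst (λ y → toℕ y ≤ i) (sym (inverseʳ z)) b≤i
  a<x : a <ᶠ x
  a<x = ≤-<-trans a≤i i<x
  x<q : x <ᶠ q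
  x<q = subst (_< toℕ q) (sym tx) i+1<q
  a<q : a <ᶠ q
  a<q = <-trans a<x x<q
  x≢a = ≢-sym (<⇒≢ᶠ a<x)
  q≢a = ≢-sym (<⇒≢ᶠ a<q)
  x≢q = <⇒≢ᶠ x<q
  zq<za : z ∙ q <ᶠ z ∙ a
  zq<za = ≤-<-trans zq≤i (<⇒≤ j<za)
  z' = swap a q z
  go : _ → ⊥
  go (tri< lt _ _) = inversion-meets x<q lt x≢a q≢a
  go (tri≈ _ e _) = x≢q (sym (∙-inj z e))
  go (tri> _ _ zx<zq) with flip-D {w = z'} (exceed (z' ∙ x) z'x≤i (subst (λ y → i < toℕ y) (sym (inverseˡ z')) i<x))
    where
    z'x≤i : toℕ (z' ∙ x) ≤ i
    z'x≤i = subst (λ y → toℕ y ≤ i) (sym (swap-o z a q x≢a x≢q)) (≤-trans (<⇒≤ zx<zq) zq≤i)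
  ... | exceed p p≤i i<z'p = inversion-meets (≤-<-trans p≤i (<-trans i<x x<q)) (≤-<-trans zq≤i (subst (λ y → i < toℕ y) z'p i<z'p)) p≢a q≢a
    where
    p≢a : p ≢ a
    p≢a refl = <⇒≱ i<z'p (subst (λ y → toℕ y ≤ i) (sym (swap-l z a q)) zq≤i)
    z'p : z' ∙ p ≡ z ∙ p
    z'p = swap-o z a q p≢a (λ { refl → <⇒≱ (<-trans i<x x<q) p≤i })

abstract
  -- This `z` stands for the one product of s_i and s_(i+1) that `E i` detects: nothing below `z`
  -- passes the test for the other product.
  E-minimal : ∀ {i} {w : Perm n} → E i w → Σ (Perm n) λ z → (z ≤B w) × E i z × ¬ E i (flip z)
  E-minimal {i = i} {w} e =
    let z , z≤w , ez , m = minimal (E i) (T? i (suc i)) w e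
    in z , z≤w , ez , minimalE⇒¬E-flip ez m

-- A witness `a` for i + 1 that does not serve for `E i` is the position i + 1 itself. A value
-- `b ≤ i` at a position beyond `i` is then not at i + 1, hence beyond it.
D-D⇒E : ∀ {i} {z : Perm n} → D i z → D (suc i) z → E i z ⊎ E i (flip z)
D-D⇒E {i = i} {z} d (exceed a a≤ lt) with toℕ a ≤? i
... | yes a≤i = inj₁ (exceed a a≤i lt)
... | no a≰i with D-flip d
...   | exceed b b≤i i<q = inj₂ (exceed b b≤i (≤∧≢⇒< i<q λ e → <⇒≱ (<⇒≤ lt)
          (subst (λ y → toℕ y ≤ i) (trans (sym (inverseʳ z)) (cong (z ∙_) (toℕ-injective (trans (sym e) (sym (≤-antisym a≤ (≰⇒> a≰i))))))) b≤i)))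

-- Factorization at a point

FixesBelow FixesAbove : ℕ → Perm n → Set
FixesBelow d v = ∀ {x} → toℕ x < d → v ∙ x ≡ x
FixesAbove d u = ∀ {x} → d < toℕ x → u ∙ x ≡ x

module _ {d : ℕ} {x y : Perm n} {p q : Fin n} (p<q : p <ᶠ q) (xp<xq : x ∙ p <ᶠ x ∙ q) (s : SwapOf x y p q) where
  open SwapOf s

  -- Otherwise `y` fixes `p`, so the smaller value x p = y q is below `p` and fixed as well, which
  -- gives q = x p < p.
  swap-above : FixesBelow d y → d ≤ toℕ p
  swap-above f = ≮⇒≥ λ p<d →
    let xq≡p = trans (sym at-l) (f p<d)
        xp<p = subst (x ∙ p <ᶠ_) xq≡p xp<xq
        q≡xp = ∙-inj y (trans at-r (sym (f (<-trans xp<p p<d))))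
    in <-asym p<q (subst (_<ᶠ p) (sym q≡xp) xp<p)

  swap-below : FixesAbove d y → toℕ q ≤ d
  swap-below f = ≮⇒≥ λ d<q →
    let xp≡q = trans (sym at-r) (f d<q)
        q<xq = subst (_<ᶠ x ∙ q) xp≡q xp<xq
        p≡xq = ∙-inj y (trans at-l (sym (f (<-trans d<q q<xq))))
    in <-asym p<q (subst (q <ᶠ_) (sym p≡xq) q<xq)

FixesBelow-⊲ : ∀ {d} {x y : Perm n} → x ⊲ y → FixesBelow d y → FixesBelow d x
FixesBelow-⊲ {y = y} (cover p<q lt s _) f {m} m<d =
  let d≤p = swap-above p<q lt s f
      m<p = <-≤-trans m<d d≤p
  in trans (sym (SwapOf.away s (<⇒≢ᶠ m<p) (<⇒≢ᶠ (<-trans m<p p<q)))) (f m<d)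

FixesAbove-⊲ : ∀ {d} {x y : Perm n} → x ⊲ y → FixesAbove d y → FixesAbove d x
FixesAbove-⊲ (cover p<q lt s _) f {m} d<m =
  let q<m = ≤-<-trans (swap-below p<q lt s f) d<m
  in trans (sym (SwapOf.away s (≢-sym (<⇒≢ᶠ (<-trans p<q q<m))) (≢-sym (<⇒≢ᶠ q<m)))) (f d<m)

FixesBelow-≤ : ∀ {d} {x y : Perm n} → x ≤B y → FixesBelow d y → FixesBelow d x
FixesBelow-≤ (≤B-refl e) f {m} lt = trans (e m) (f lt)
FixesBelow-≤ (≤B-step {u} {v} c p) f = FixesBelow-⊲ (⋖⇒⊲ u v c) (FixesBelow-≤ p f)

FixesAbove-≤ : ∀ {d} {x y : Perm n} → x ≤B y → FixesAbove d y → FixesAbove d x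
FixesAbove-≤ (≤B-refl e) f {m} lt = trans (e m) (f lt)
FixesAbove-≤ (≤B-step {u} {v} c p) f = FixesAbove-⊲ (⋖⇒⊲ u v c) (FixesAbove-≤ p f)

FixesBelow-≥ : ∀ {d} (v : Perm n) → FixesBelow d v → ∀ {x} → d ≤ toℕ x → d ≤ toℕ (v ∙ x)
FixesBelow-≥ v f {x} d≤x = ≮⇒≥ λ lt → <⇒≱ lt (subst (λ y → _ ≤ toℕ y) (∙-inj v (sym (f lt))) d≤x)

FixesAbove-stable : ∀ {d} (u : Perm n) → FixesAbove d u → ∀ {x} → toℕ x ≤ d → toℕ (u ∙ x) ≤ d
FixesAbove-stable u f {x} x≤d = ≮⇒≥ λ lt → <⇒≱ lt (subst (λ y → toℕ y ≤ _) (∙-inj u (sym (f lt))) x≤d)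

FixesAbove-increasing : ∀ {d} (u : Perm n) → FixesAbove d u → ∀ {x y} → d ≤ toℕ x → x <ᶠ y → u ∙ x <ᶠ u ∙ y
FixesAbove-increasing {d = d} u f {x} {y} d≤x x<y = subst (u ∙ x <ᶠ_) (sym (f d<y)) ux<y
  where
  d<y = ≤-<-trans d≤x x<y
  ux<y : u ∙ x <ᶠ y
  ux<y with d <? toℕ x
  ... | yes d<x = subst (_<ᶠ y) (sym (f d<x)) x<y
  ... | no d≮x = ≤-<-trans (FixesAbove-stable u f (≮⇒≥ d≮x)) d<y

FixesAbove-increasing⁻¹ : ∀ {d} (u : Perm n) → FixesAbove d u → ∀ {x y} → d ≤ toℕ x → d ≤ toℕ y → u ∙ x <ᶠ u ∙ y → x <ᶠ y
FixesAbove-increasing⁻¹ u f {x} {y} d≤x d≤y lt with Finₚ.<-cmp x y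
... | tri< a _ _ = a
... | tri≈ _ refl _ = contradiction lt (n≮n _)
... | tri> _ _ a = contradiction lt (<-asym (FixesAbove-increasing u f d≤y a))

module _ {d : ℕ} {u v : Perm n} (fu : FixesAbove d u) (fv : FixesBelow d v) where

  record Factors (x : Perm n) : Set where
    field
      u' v' : Perm n
      eq    : x ≈ₚ (v' ∘ₚ u')
      u'≤u  : u' ≤B u
      v'≤v  : v' ≤B v
    fu' : FixesAbove d u'
    fu' = FixesAbove-≤ u'≤u fu
    fv' : FixesBelow d v'
    fv' = FixesBelow-≤ v'≤v fv

  -- A cover below u ∘ v lowers exactly one of the two factors, because u is increasing from d on and v only moves points from d on.
  factors-⊲ : {x y : Perm n} → x ⊲ y → y ≈ₚ (v ∘ₚ u) → Factors x
  factors-⊲ {x} {y} (cover {p} {q} p<q xp<xq s none) e with Finₚ.<-cmp (v ∙ p) (v ∙ q)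
  ... | tri≈ _ r _ = contradiction (∙-inj v r) (<⇒≢ᶠ p<q)
  -- The exchange takes place within `v`, at the same positions.
  ... | tri> _ _ vq<vp = record { u' = u ; v' = v' ; eq = x≈ ; u'≤u = refl≤B ; v'≤v = ⊲⇒≤B c }
    where
    open SwapOf s
    v' = swap p q v
    d≤p : d ≤ toℕ p
    d≤p = ≮⇒≥ λ p<d →
      let vq<p = subst (v ∙ q <ᶠ_) (fv p<d) vq<vp
          vq≡q = ∙-inj v (fv (<-trans vq<p p<d))
      in <-asym p<q (subst (_<ᶠ p) vq≡q vq<p)
    d≤v : ∀ {m} → p <ᶠ m → d ≤ toℕ (v ∙ m)
    d≤v p<m = FixesBelow-≥ v fv (≤-trans d≤p (<⇒≤ p<m))
    c : v' ⊲ v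
    c = cover p<q (subst₂ _<ᶠ_ (sym (swap-l v p q)) (sym (swap-r v p q)) vq<vp) (SwapOf-sym (swap-SwapOf v p q))
      λ m ((p<m , m<q) , (a , b)) →
        let m≢p = ≢-sym (<⇒≢ᶠ p<m)
            m≢q = <⇒≢ᶠ m<q
            v'm = swap-o v p q m≢p m≢q
            vq<vm = subst₂ _<ᶠ_ (swap-l v p q) v'm a
            vm<vp = subst₂ _<ᶠ_ v'm (swap-r v p q) b
            xm = trans (sym (e m)) (away m≢p m≢q)
        in none m ((p<m , m<q) ,
           ( subst₂ _<ᶠ_ (trans (sym (e q)) at-r) xm (FixesAbove-increasing u fu (d≤v p<q) vq<vm)
           , subst₂ _<ᶠ_ xm (trans (sym (e p)) at-l) (FixesAbove-increasing u fu (d≤v p<m) vm<vp)))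
    x≈ : x ≈ₚ (v' ∘ₚ u)
    x≈ = SwapOf-unique {v = y} {x} {v' ∘ₚ u} (SwapOf-sym s) (swapped
      (trans (cong (u ∙_) (swap-l v p q)) (sym (e q)))
      (trans (cong (u ∙_) (swap-r v p q)) (sym (e p)))
      λ {m} a b → trans (cong (u ∙_) (swap-o v p q a b)) (sym (e m)))
  -- The exchange takes place within `u`, at the images of the positions under `v`.
  ... | tri< P<Q _ _ = record { u' = u' ; v' = v ; eq = x≈ ; u'≤u = ⊲⇒≤B c ; v'≤v = refl≤B }
    where
    open SwapOf s
    P = v ∙ p
    Q = v ∙ q
    u' = swap P Q u
    uQ<uP : u ∙ Q <ᶠ u ∙ P
    uQ<uP = subst₂ _<ᶠ_ (trans (sym at-r) (e q)) (trans (sym at-l) (e p)) xp<xq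
    s' = swap-SwapOf u P Q
    Q≤d : toℕ Q ≤ d
    Q≤d = ≮⇒≥ λ d<Q → <-asym uQ<uP (lem d<Q)
      where
      lem : d < toℕ Q → u ∙ P <ᶠ u ∙ Q
      lem d<Q with d ≤? toℕ P
      ... | yes d≤P = FixesAbove-increasing u fu d≤P P<Q
      ... | no d≰P = subst (u ∙ P <ᶠ_) (sym (fu d<Q)) (≤-<-trans (FixesAbove-stable u fu (<⇒≤ (≰⇒> d≰P))) d<Q)
    P<d : toℕ P < d
    P<d = <-≤-trans P<Q Q≤d
    p≡P : p ≡ P
    p≡P = sym (∙-inj v (fv P<d))
    c : u' ⊲ u
    c = cover P<Q (subst₂ _<ᶠ_ (sym (swap-l u P Q)) (sym (swap-r u P Q)) uQ<uP) (SwapOf-sym s')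
      λ M ((P<M , M<Q) , (a , b)) →
        let M<d = <-≤-trans M<Q Q≤d
            p<M = subst (_<ᶠ M) (sym p≡P) P<M
            M<q = lem M M<d M<Q
            u'M = swap-o u P Q (≢-sym (<⇒≢ᶠ P<M)) (<⇒≢ᶠ M<Q)
            xM = trans (sym (trans (e M) (cong (u ∙_) (fv M<d)))) (away (≢-sym (<⇒≢ᶠ p<M)) (<⇒≢ᶠ M<q))
        in none M ((p<M , M<q) ,
           ( subst₂ _<ᶠ_ (trans (swap-l u P Q) (trans (sym (e q)) at-r)) (trans u'M xM) a
           , subst₂ _<ᶠ_ (trans u'M xM) (trans (swap-r u P Q) (trans (sym (e p)) at-l)) b))
      where
      -- `q` can differ from `Q` only if `Q` is the shared point `d`, and then `q` is not below `d`.
      lem : ∀ M → toℕ M < d → M <ᶠ Q → M <ᶠ q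
      lem M M<d M<Q with toℕ q <? d
      ... | yes q<d = subst (M <ᶠ_) (fv q<d) M<Q
      ... | no q≮d = <-≤-trans M<d (≮⇒≥ q≮d)
    x≈ : x ≈ₚ (v ∘ₚ u')
    x≈ = SwapOf-unique {v = y} {x} {v ∘ₚ u'} (SwapOf-sym s) (swapped
      (trans (swap-l u P Q) (sym (e q)))
      (trans (swap-r u P Q) (sym (e p)))
      λ {m} a b → trans (swap-o u P Q (a ∘ ∙-inj v) (b ∘ ∙-inj v)) (sym (e m)))

factors : ∀ {d} {u v : Perm n} (fu : FixesAbove d u) (fv : FixesBelow d v) {x y : Perm n} → x ≤B y → y ≈ₚ (v ∘ₚ u) → Factors {u = u} {v} fu fv x
factors {u = u} {v} fu fv (≤B-refl r) e = record { u' = u ; v' = v ; eq = λ x → trans (r x) (e x) ; u'≤u = refl≤B ; v'≤v = refl≤B }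
factors fu fv (≤B-step {a} {b} c p) e = record { u' = G.u' ; v' = G.v' ; eq = G.eq ; u'≤u = ≤B-trans G.u'≤u F.u'≤u ; v'≤v = ≤B-trans G.v'≤v F.v'≤v }
  where
  module F = Factors (factors fu fv p e)
  module G = Factors (factors-⊲ {u = F.u'} {F.v'} F.fu' F.fv' (⋖⇒⊲ a b c) F.eq)

-- `v` can be read off the composite: at a position from `d` on, a composite value above `d` is the
-- value of `v`, and any other composite value means that `v` takes the value `d` there.
factorization-unique : ∀ {d} {u v u₁ v₁ : Perm n} → FixesAbove d u → FixesBelow d v → FixesAbove d u₁ → FixesBelow d v₁ →
  (v ∘ₚ u) ≈ₚ (v₁ ∘ₚ u₁) → (u ≈ₚ u₁) × (v ≈ₚ v₁)
factorization-unique {n} {d} {u} {v} {u₁} {v₁} fu fv fu₁ fv₁ e =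
  (λ x → trans (cong (u ∙_) (sym (inverseʳ v))) (trans (e _) (cong (u₁ ∙_) (trans (sym (v≈ _)) (inverseʳ v))))) , v≈
  where
  value : ∀ {u v : Perm n} → FixesAbove d u → FixesBelow d v → ∀ x → d ≤ toℕ x → d < toℕ (u ∙ (v ∙ x)) → v ∙ x ≡ u ∙ (v ∙ x)
  value {u} {v} fu fv x d≤x lt = sym (∙-inj u (fu lt))
  value' : ∀ {u v : Perm n} → FixesAbove d u → FixesBelow d v → ∀ x → d ≤ toℕ x → ¬ (d < toℕ (u ∙ (v ∙ x))) → toℕ (v ∙ x) ≡ d
  value' {u} {v} fu fv x d≤x nlt = ≤-antisym (≮⇒≥ λ lt → nlt (subst (λ y → d < toℕ y) (sym (fu lt)) lt)) (FixesBelow-≥ v fv d≤x)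
  v≈ : v ≈ₚ v₁
  v≈ x with toℕ x <? d
  ... | yes x<d = trans (fv x<d) (sym (fv₁ x<d))
  ... | no x≮d with d <? toℕ (u ∙ (v ∙ x))
  ...   | yes lt = trans (value {u} {v} fu fv x (≮⇒≥ x≮d) lt)
                     (trans (e x) (sym (value {u₁} {v₁} fu₁ fv₁ x (≮⇒≥ x≮d) (subst (λ y → d < toℕ y) (e x) lt))))
  ...   | no nlt = toℕ-injective (trans (value' {u} {v} fu fv x (≮⇒≥ x≮d) nlt)
                     (sym (value' {u₁} {v₁} fu₁ fv₁ x (≮⇒≥ x≮d) (λ lt → nlt (subst (λ y → d < toℕ y) (sym (e x)) lt)))))

-- `v` fixes `P`, but may carry the other position away if `Q` is `d`. The points that come to lie
-- between have values above `d`, out of the range of the swap.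
∘ₚ-⊲ˡ : ∀ {d} {u' u v : Perm n} → FixesAbove d u → FixesBelow d v → u' ⊲ u → (v ∘ₚ u') ⊲ (v ∘ₚ u)
∘ₚ-⊲ˡ {n} {d} {u'} {u} {v} fu fv c@(cover {P} {Q} P<Q lt s@(swapped uP uQ uo) none) =
  cover {i = P} {q} p<q (subst₂ (λ a b → u' ∙ a <ᶠ u' ∙ b) (sym vP) (sym vq) lt)
    (swapped (trans (cong (u ∙_) vP) (trans uP (cong (u' ∙_) (sym vq))))
             (trans (cong (u ∙_) vq) (trans uQ (cong (u' ∙_) (sym vP))))
             λ a b → uo (λ r → a (∙-inj v (trans r (sym vP)))) (λ r → b (∙-inj v (trans r (sym vq)))))
    none'
  where
  fu' : FixesAbove d u'
  fu' = FixesAbove-⊲ c fu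
  q = v ∙⁻¹ Q
  vq : v ∙ q ≡ Q
  vq = inverseʳ v
  Q≤d : toℕ Q ≤ d
  Q≤d = swap-below P<Q lt s fu
  P<d = <-≤-trans P<Q Q≤d
  vP : v ∙ P ≡ P
  vP = fv P<d
  lem : ∀ M → toℕ M < d → M <ᶠ Q → M <ᶠ q
  lem M M<d M<Q with toℕ q <? d
  ... | yes q<d = subst (M <ᶠ_) (trans (sym vq) (fv q<d)) M<Q
  ... | no q≮d = <-≤-trans M<d (≮⇒≥ q≮d)
  p<q : P <ᶠ q
  p<q = lem P P<d P<Q
  none' : ∀ m → ¬ Between (v ∘ₚ u') P q m
  none' m ((P<m , m<q) , (a , b)) with toℕ m <? d
  ... | yes m<d = none m ((P<m , m<Q) , (subst₂ (λ a b → u' ∙ a <ᶠ u' ∙ b) vP (fv m<d) a , subst₂ (λ a b → u' ∙ a <ᶠ u' ∙ b) (fv m<d) vq b))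
    where
    m<Q : m <ᶠ Q
    m<Q with toℕ Q <? d
    ... | yes Q<d = subst (m <ᶠ_) (∙-inj v (trans vq (sym (fv Q<d)))) m<q
    ... | no Q≮d = <-≤-trans m<d (≮⇒≥ Q≮d)
  ... | no m≮d = <-asym b (subst (λ y → u' ∙ (v ∙ q) <ᶠ y) (sym (fu' d<vm)) (≤-<-trans (subst (λ y → toℕ (u' ∙ y) ≤ d) (sym vq) (FixesAbove-stable u' fu' Q≤d)) d<vm))
    where
    d≤m = ≮⇒≥ m≮d
    Q≡d : toℕ Q ≡ d
    Q≡d = ≤-antisym Q≤d (subst (λ y → d ≤ toℕ y) vq (FixesBelow-≥ v fv (≤-trans d≤m (<⇒≤ m<q))))
    d<vm : d < toℕ (v ∙ m)
    d<vm = ≤∧≢⇒< (FixesBelow-≥ v fv d≤m) λ r → <⇒≢ᶠ m<q (∙-inj v (toℕ-injective (trans (sym r) (trans (sym Q≡d) (cong toℕ (sym vq))))))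

-- From `d` on `u` is increasing, so it changes none of the comparisons that make up the cover.
∘ₚ-⊲ʳ : ∀ {d} {u v' v : Perm n} → FixesAbove d u → FixesBelow d v → v' ⊲ v → (v' ∘ₚ u) ⊲ (v ∘ₚ u)
∘ₚ-⊲ʳ {d = d} {u} {v'} {v} fu fv c@(cover {p} {q} p<q lt s@(swapped vp vq vo) none) =
  cover p<q (FixesAbove-increasing u fu (d≤v' ≤-refl) lt)
    (swapped (cong (u ∙_) vp) (cong (u ∙_) vq) λ a b → cong (u ∙_) (vo a b))
    λ m ((p<m , m<q) , (a , b)) → none m ((p<m , m<q) ,
      ( FixesAbove-increasing⁻¹ u fu (d≤v' ≤-refl) (d≤v' (<⇒≤ p<m)) a
      , FixesAbove-increasing⁻¹ u fu (d≤v' (<⇒≤ p<m)) (d≤v' (<⇒≤ p<q)) b))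
  where
  d≤p : d ≤ toℕ p
  d≤p = swap-above p<q lt s fv
  d≤v' : ∀ {m} → toℕ p ≤ toℕ m → d ≤ toℕ (v' ∙ m)
  d≤v' p≤m = FixesBelow-≥ v' (FixesBelow-⊲ c fv) (≤-trans d≤p p≤m)

∘ₚ-mono : ∀ {d} {u' u v' v : Perm n} → FixesAbove d u → FixesBelow d v → u' ≤B u → v' ≤B v → (v' ∘ₚ u') ≤B (v ∘ₚ u)
∘ₚ-mono {d = d} {u'} {u} {v'} {v} fu fv p q = ≤B-trans {v = v' ∘ₚ u} (left p fu) (right q fv)
  where
  fv' : FixesBelow d v'
  fv' = FixesBelow-≤ q fv
  left : ∀ {u' u} → u' ≤B u → FixesAbove d u → (v' ∘ₚ u') ≤B (v' ∘ₚ u)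
  left (≤B-refl e) fu = ≤B-refl λ x → e (v' ∙ x)
  left (≤B-step {a} {b} c p) fu = step (∘ₚ-⊲ˡ {u' = a} {b} {v'} (FixesAbove-≤ p fu) fv' (⋖⇒⊲ a b c)) (left p fu)
  right : ∀ {v' v} → v' ≤B v → FixesBelow d v → (v' ∘ₚ u) ≤B (v ∘ₚ u)
  right (≤B-refl e) fv = ≤B-refl λ x → cong (u ∙_) (e x)
  right (≤B-step {a} {b} c p) fv = step (∘ₚ-⊲ʳ {u = u} {a} {b} fu (FixesBelow-≤ p fv) (⋖⇒⊲ a b c)) (right p fv)

open PosetData

-- Isomorphisms of posets

-- The poset data carry no laws, so congruence has to be recorded for isomorphisms to compose.
record _≃_ (P Q : PosetData) : Set where
  field
    to        : Carrier P → Carrier Q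
    from      : Carrier Q → Carrier P
    to-cong   : ∀ {x y} → _≈ᴾ_ P x y → _≈ᴾ_ Q (to x) (to y)
    from-cong : ∀ {x y} → _≈ᴾ_ Q x y → _≈ᴾ_ P (from x) (from y)
    from-to   : ∀ x → _≈ᴾ_ P (from (to x)) x
    to-from   : ∀ y → _≈ᴾ_ Q (to (from y)) y
    to-mono   : ∀ {x y} → _≤ᴾ_ P x y → _≤ᴾ_ Q (to x) (to y)
    to-refl   : ∀ {x y} → _≤ᴾ_ Q (to x) (to y) → _≤ᴾ_ P x y

≃⇒≅ : ∀ {P Q} → P ≃ Q → P ≅ᴾ Q
≃⇒≅ f = record { to = to ; from = from ; from-to = from-to ; to-from = to-from ; to-mono = λ _ _ → to-mono ; to-refl = λ _ _ → to-refl }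
  where open _≃_ f

Transitive≈ : PosetData → Set
Transitive≈ P = ∀ x y z → _≈ᴾ_ P x y → _≈ᴾ_ P y z → _≈ᴾ_ P x z

≃-trans : ∀ {P Q R} → Transitive≈ P → Transitive≈ R → P ≃ Q → Q ≃ R → P ≃ R
≃-trans tP tR f g = record
  { to = G.to ∘ F.to ; from = F.from ∘ G.from ; to-cong = G.to-cong ∘ F.to-cong ; from-cong = F.from-cong ∘ G.from-cong
  ; from-to = λ x → tP _ _ _ (F.from-cong (G.from-to (F.to x))) (F.from-to x)
  ; to-from = λ y → tR _ _ _ (G.to-cong (F.to-from (G.from y))) (G.to-from y)
  ; to-mono = G.to-mono ∘ F.to-mono ; to-refl = F.to-refl ∘ G.to-refl }
  where
  module F = _≃_ f
  module G = _≃_ g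

_×ᴾ_ : PosetData → PosetData → PosetData
P ×ᴾ Q = record
  { Carrier = Carrier P × Carrier Q
  ; _≈ᴾ_ = λ x y → _≈ᴾ_ P (proj₁ x) (proj₁ y) × _≈ᴾ_ Q (proj₂ x) (proj₂ y)
  ; _≤ᴾ_ = λ x y → _≤ᴾ_ P (proj₁ x) (proj₁ y) × _≤ᴾ_ Q (proj₂ x) (proj₂ y) }

≃-×-^ : ∀ {P Q R r} → (∀ x → _≈ᴾ_ R x x) → P ≃ R → Q ≃ (R ^ᴾ r) → (P ×ᴾ Q) ≃ (R ^ᴾ suc r)
≃-×-^ {P} {Q} {R} {r} rR f g = record
  { to = λ { (p , q) Fin.zero → F.to p ; (p , q) (Fin.suc i) → G.to q i }
  ; from = λ h → F.from (h Fin.zero) , G.from (h ∘ Fin.suc)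
  ; to-cong = λ { (a , b) Fin.zero → F.to-cong a ; (a , b) (Fin.suc i) → G.to-cong b i }
  ; from-cong = λ e → F.from-cong (e Fin.zero) , G.from-cong (e ∘ Fin.suc)
  ; from-to = λ (p , q) → F.from-to p , G.from-to q
  ; to-from = λ { h Fin.zero → F.to-from (h Fin.zero) ; h (Fin.suc i) → G.to-from (h ∘ Fin.suc) i }
  ; to-mono = λ { (a , b) Fin.zero → F.to-mono a ; (a , b) (Fin.suc i) → G.to-mono b i }
  ; to-refl = λ e → F.to-refl (e Fin.zero) , G.to-refl (e ∘ Fin.suc) }
  where
  module F = _≃_ f
  module G = _≃_ g

B-trans≈ : {w : Perm n} → Transitive≈ (B w)
B-trans≈ x y z = ≈ₚ-trans {u = proj₁ x} {proj₁ y} {proj₁ z}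

B^-trans≈ : {w : Perm n} {r : ℕ} → Transitive≈ (B w ^ᴾ r)
B^-trans≈ _ _ _ e f i x = trans (e i x) (f i x)

≤B-resp₂ : {v v' w w' : Perm n} → v ≈ₚ v' → w ≈ₚ w' → v ≤B w → v' ≤B w'
≤B-resp₂ {v = v} {v'} {w} {w'} e f p = ≤B-respˡ {v = v} {v'} e (≤B-respʳ {w = w} {w'} f p)

B-cong : {v w : Perm n} → v ≈ₚ w → B v ≃ B w
B-cong {v = v} {w} e = record
  { to = λ (x , p) → x , ≤B-respʳ {w = v} {w} e p
  ; from = λ (x , p) → x , ≤B-respʳ {w = w} {v} (λ i → sym (e i)) p
  ; to-cong = id ; from-cong = id ; from-to = λ _ _ → refl ; to-from = λ _ _ → refl ; to-mono = id ; to-refl = id }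

B-flip : (w : Perm n) → B (flip w) ≃ B w
B-flip w = record
  { to = λ (x , p) → flip x , ≤B-respʳ {w = flip (flip w)} {w} (λ _ → refl) (≤B-flip p)
  ; from = λ (x , p) → flip x , ≤B-flip p
  ; to-cong = λ {x} {y} → flip-cong {v = proj₁ x} {proj₁ y}
  ; from-cong = λ {x} {y} → flip-cong {v = proj₁ x} {proj₁ y}
  ; from-to = λ _ _ → refl ; to-from = λ _ _ → refl
  ; to-mono = ≤B-flip
  ; to-refl = λ {x} {y} p → ≤B-resp₂ {v = flip (flip (proj₁ x))} {proj₁ x} {flip (flip (proj₁ y))} {proj₁ y} (λ _ → refl) (λ _ → refl) (≤B-flip p) }

-- The factors are found separately for each element, so congruence and monotonicity go through
-- their uniqueness. For the latter the smaller element is factored inside the factors of the larger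
-- one.
B-∘ₚ : ∀ {d} {u v : Perm n} → FixesAbove d u → FixesBelow d v → B (v ∘ₚ u) ≃ (B u ×ᴾ B v)
B-∘ₚ {n} {d} {u} {v} fu fv = record
  { to = λ X → let open Factors (fac X) in (u' , u'≤u) , (v' , v'≤v)
  ; from = λ ((u' , p) , (v' , q)) → (v' ∘ₚ u') , ∘ₚ-mono fu fv p q
  ; to-cong = λ {X} {Y} e → uniq X (Factors.u' (fac Y)) (Factors.v' (fac Y)) (Factors.u'≤u (fac Y)) (Factors.v'≤v (fac Y))
                   (λ x → trans (e x) (Factors.eq (fac Y) x))
  ; from-cong = λ { {(u₁ , _) , (v₁ , _)} {(u₂ , _) , (v₂ , _)} (e , f) x → trans (cong (u₁ ∙_) (f x)) (e (v₂ ∙ x)) }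
  ; from-to = λ X x → sym (Factors.eq (fac X) x)
  ; to-from = λ ((u' , p) , (v' , q)) → uniq ((v' ∘ₚ u') , ∘ₚ-mono fu fv p q) u' v' p q (λ _ → refl)
  ; to-mono = λ {X} {Y} le → mono X Y le
  ; to-refl = λ {X} {Y} (p , q) → ≤B-resp₂ {v = comp X} {proj₁ X} {comp Y} {proj₁ Y}
       (λ x → sym (Factors.eq (fac X) x)) (λ x → sym (Factors.eq (fac Y) x)) (∘ₚ-mono (Factors.fu' (fac Y)) (Factors.fv' (fac Y)) p q)
  }
  where
  fac : (X : Carrier (B (v ∘ₚ u))) → Factors {u = u} {v} fu fv (proj₁ X)
  fac (x , p) = factors fu fv p (λ _ → refl)
  comp : Carrier (B (v ∘ₚ u)) → Perm n
  comp X = Factors.v' (fac X) ∘ₚ Factors.u' (fac X)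
  uniq : (X : Carrier (B (v ∘ₚ u))) (u₁ v₁ : Perm n) → u₁ ≤B u → v₁ ≤B v → proj₁ X ≈ₚ (v₁ ∘ₚ u₁) →
         (Factors.u' (fac X) ≈ₚ u₁) × (Factors.v' (fac X) ≈ₚ v₁)
  uniq X u₁ v₁ p q e = factorization-unique {u = F.u'} {F.v'} {u₁} {v₁} F.fu' F.fv' (FixesAbove-≤ p fu) (FixesBelow-≤ q fv)
      (λ x → trans (sym (F.eq x)) (e x))
    where module F = Factors (fac X)
  mono : (X Y : Carrier (B (v ∘ₚ u))) → proj₁ X ≤B proj₁ Y →
         (Factors.u' (fac X) ≤B Factors.u' (fac Y)) × (Factors.v' (fac X) ≤B Factors.v' (fac Y))
  mono X Y le =
    ≤B-respˡ {v = G.u'} {F.u'} (λ x → sym (proj₁ same x)) G.u'≤u , ≤B-respˡ {v = G.v'} {F.v'} (λ x → sym (proj₂ same x)) G.v'≤v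
    where
    module F = Factors (fac X)
    module Y = Factors (fac Y)
    module G = Factors (factors {u = Y.u'} {Y.v'} Y.fu' Y.fv' le Y.eq)
    same = uniq X G.u' G.v' (≤B-trans G.u'≤u Y.u'≤u) (≤B-trans G.v'≤v Y.v'≤v) G.eq

-- Permutations of an interval

-- The `suc k'` positions from `c` to `top` carry the `k'` generators from s_c to s_(top - 1).
module Interval {n : ℕ} (c k' : ℕ) (fits : c + suc k' ≤ n) where

  k top : ℕ
  k = suc k'
  top = c + k'

  emb : Fin k → Fin n
  emb a = fromℕ< (<-≤-trans (+-monoʳ-< c (toℕ<n a)) fits)

  toℕ-emb : ∀ a → toℕ (emb a) ≡ c + toℕ a
  toℕ-emb a = toℕ-fromℕ< _

  emb-inj : ∀ {a b} → emb a ≡ emb b → a ≡ b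
  emb-inj {a} {b} e = toℕ-injective (+-cancelˡ-≡ c _ _ (trans (sym (toℕ-emb a)) (trans (cong toℕ e) (toℕ-emb b))))

  emb-≥ : ∀ a → c ≤ toℕ (emb a)
  emb-≥ a = subst (c ≤_) (sym (toℕ-emb a)) (m≤m+n c _)

  emb-≤ : ∀ a → toℕ (emb a) ≤ top
  emb-≤ a = subst (_≤ top) (sym (toℕ-emb a)) (+-monoʳ-≤ c (s≤s⁻¹ (toℕ<n a)))

  emb-< : ∀ {a b} → a <ᶠ b → emb a <ᶠ emb b
  emb-< {a} {b} lt = subst₂ _<_ (sym (toℕ-emb a)) (sym (toℕ-emb b)) (+-monoʳ-< c lt)

  emb-<⁻¹ : ∀ {a b} → emb a <ᶠ emb b → a <ᶠ b
  emb-<⁻¹ {a} {b} lt = +-cancelˡ-< c _ _ (subst₂ _<_ (toℕ-emb a) (toℕ-emb b) lt)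

  emb-hit : ∀ x → c ≤ toℕ x → toℕ x ≤ top → ∃ λ a → emb a ≡ x
  emb-hit x c≤x x≤top = fromℕ< lt , toℕ-injective (trans (toℕ-emb _) (trans (cong (c +_) (toℕ-fromℕ< lt)) (m+[n∸m]≡n c≤x)))
    where
    lt : toℕ x ∸ c < k
    lt = s≤s (≤-trans (∸-monoˡ-≤ c x≤top) (≤-reflexive (m+n∸m≡n c k')))

  abstract
    act : (Fin k → Fin k) → Fin n → Fin n
    act g x with any? (λ a → emb a ≟ᶠ x)
    ... | yes (a , _) = emb (g a)
    ... | no _ = x

    act-hit : ∀ g a → act g (emb a) ≡ emb (g a)
    act-hit g a with any? (λ b → emb b ≟ᶠ emb a)
    ... | yes (b , e) = cong (emb ∘ g) (emb-inj e)
    ... | no ne = contradiction (a , refl) ne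

    act-miss : ∀ g {x} → ¬ (∃ λ a → emb a ≡ x) → act g x ≡ x
    act-miss g {x} ne with any? (λ b → emb b ≟ᶠ x)
    ... | yes h = contradiction h ne
    ... | no _ = refl

  act-inverse : ∀ {g h} → (∀ a → g (h a) ≡ a) → ∀ x → act g (act h x) ≡ x
  act-inverse {g} {h} e x = at (any? (λ a → emb a ≟ᶠ x))
    where
    at : Dec (∃ λ a → emb a ≡ x) → act g (act h x) ≡ x
    at (yes (a , refl)) = trans (cong (act g) (act-hit h a)) (trans (act-hit g (h a)) (cong emb (e a)))
    at (no ne) = trans (cong (act g) (act-miss h ne)) (act-miss g ne)

  ext : Perm k → Perm n
  ext u = permutation (act (u ∙_)) (act (u ∙⁻¹_)) (act-inverse λ a → inverseʳ u) (act-inverse λ a → inverseˡ u)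

  ext-emb : ∀ u a → ext u ∙ emb a ≡ emb (u ∙ a)
  ext-emb u a = act-hit (u ∙_) a

  ext-below : ∀ u → FixesBelow c (ext u)
  ext-below u {x} lt = act-miss (u ∙_) λ { (a , refl) → <⇒≱ lt (emb-≥ a) }

  ext-above : ∀ u → FixesAbove top (ext u)
  ext-above u {x} lt = act-miss (u ∙_) λ { (a , refl) → <⇒≱ lt (emb-≤ a) }

  ≈-ext : ∀ {v : Perm n} u → FixesBelow c v → FixesAbove top v → (∀ a → v ∙ emb a ≡ emb (u ∙ a)) → v ≈ₚ ext u
  ≈-ext {v} u fb fa h x = at (c ≤? toℕ x) (toℕ x ≤? top)
    where
    at : Dec (c ≤ toℕ x) → Dec (toℕ x ≤ top) → v ∙ x ≡ ext u ∙ x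
    at (no l) _ = trans (fb (≰⇒> l)) (sym (ext-below u (≰⇒> l)))
    at (yes _) (no l) = trans (fa (≰⇒> l)) (sym (ext-above u (≰⇒> l)))
    at (yes l) (yes m) with emb-hit x l m
    ... | a , refl = trans (h a) (sym (ext-emb u a))

  ext-cong : ∀ {u v : Perm k} → u ≈ₚ v → ext u ≈ₚ ext v
  ext-cong {u} {v} e = ≈-ext {ext u} v (ext-below u) (ext-above u) λ a → trans (ext-emb u a) (cong emb (e a))

  ext-inj : ∀ {u v : Perm k} → ext u ≈ₚ ext v → u ≈ₚ v
  ext-inj {u} {v} e a = emb-inj (trans (sym (ext-emb u a)) (trans (e (emb a)) (ext-emb v a)))

  ext-id : ext idₚ ≈ₚ idₚ
  ext-id x = sym (≈-ext {idₚ} idₚ (λ _ → refl) (λ _ → refl) (λ _ → refl) x)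

  ⊲-ext : ∀ {u v : Perm k} → u ⊲ v → ext u ⊲ ext v
  ⊲-ext {u} {v} (cover {i} {j} i<j lt (swapped vi vj vo) none) = cover (emb-< i<j) (subst₂ _<ᶠ_ (sym (ext-emb u i)) (sym (ext-emb u j)) (emb-< lt))
    (swapped (trans (ext-emb v i) (trans (cong emb vi) (sym (ext-emb u j))))
             (trans (ext-emb v j) (trans (cong emb vj) (sym (ext-emb u i)))) away)
    none'
    where
    away : ∀ {x} → x ≢ emb i → x ≢ emb j → ext v ∙ x ≡ ext u ∙ x
    away {x} p q = at (c ≤? toℕ x) (toℕ x ≤? top)
      where
      at : Dec (c ≤ toℕ x) → Dec (toℕ x ≤ top) → ext v ∙ x ≡ ext u ∙ x
      at (no l) _ = trans (ext-below v (≰⇒> l)) (sym (ext-below u (≰⇒> l)))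
      at (yes _) (no l) = trans (ext-above v (≰⇒> l)) (sym (ext-above u (≰⇒> l)))
      at (yes l) (yes m) with emb-hit x l m
      ... | a , refl = trans (ext-emb v a) (trans (cong emb (vo (p ∘ cong emb) (q ∘ cong emb))) (sym (ext-emb u a)))
    none' : ∀ m → ¬ Between (ext u) (emb i) (emb j) m
    none' m ((a , b) , (p , q)) with emb-hit m (≤-trans (emb-≥ i) (<⇒≤ a)) (≤-trans (<⇒≤ b) (emb-≤ j))
    ... | m' , refl = none m' ((emb-<⁻¹ a , emb-<⁻¹ b) ,
            ( emb-<⁻¹ (subst₂ _<ᶠ_ (ext-emb u i) (ext-emb u m') p) , emb-<⁻¹ (subst₂ _<ᶠ_ (ext-emb u m') (ext-emb u j) q)))

  module _ {X Y : Perm n} (cov : X ⊲ Y) (fb : FixesBelow c Y) (fa : FixesAbove top Y) where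
    private
      open _⊲_ cov renaming (i to p; j to q; i<j to p<q; vi<vj to Xp<Xq)
      open SwapOf isSwap
      p∈ = emb-hit p (swap-above p<q Xp<Xq isSwap fb) (≤-trans (<⇒≤ p<q) (swap-below p<q Xp<Xq isSwap fa))
      q∈ = emb-hit q (≤-trans (swap-above p<q Xp<Xq isSwap fb) (<⇒≤ p<q)) (swap-below p<q Xp<Xq isSwap fa)
      i = proj₁ p∈
      j = proj₁ q∈
      ei = proj₂ p∈
      ej = proj₂ q∈
      ≢i : ∀ {a} → emb a ≢ p → a ≢ i
      ≢i r refl = r ei
      ≢j : ∀ {a} → emb a ≢ q → a ≢ j
      ≢j r refl = r ej
      ne : ∀ {a b} → a ≢ b → emb a ≢ emb b
      ne r e = r (emb-inj e)

    swap-ext : ∀ {V W : Perm n} {v} → SwapOf V W p q → V ≈ₚ ext v → SwapOf V (ext (swap i j v)) p q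
    swap-ext {V} {W} {v} s e = swapped
      (trans (cong (ext (swap i j v) ∙_) (sym ei)) (trans (ext-emb (swap i j v) i) (trans (cong emb (swap-l v i j)) (trans (sym (ext-emb v j)) (trans (cong (ext v ∙_) ej) (sym (e q)))))))
      (trans (cong (ext (swap i j v) ∙_) (sym ej)) (trans (ext-emb (swap i j v) j) (trans (cong emb (swap-r v i j)) (trans (sym (ext-emb v i)) (trans (cong (ext v ∙_) ei) (sym (e p)))))))
      λ {x} r t → trans (at x r t (c ≤? toℕ x) (toℕ x ≤? top)) (sym (e x))
      where
      at : ∀ x → x ≢ p → x ≢ q → Dec (c ≤ toℕ x) → Dec (toℕ x ≤ top) → ext (swap i j v) ∙ x ≡ ext v ∙ x
      at x _ _ (no l) _ = trans (ext-below (swap i j v) (≰⇒> l)) (sym (ext-below v (≰⇒> l)))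
      at x _ _ (yes _) (no l) = trans (ext-above (swap i j v) (≰⇒> l)) (sym (ext-above v (≰⇒> l)))
      at x r t (yes l) (yes m) with emb-hit x l m
      ... | a , refl = trans (ext-emb (swap i j v) a) (trans (cong emb (swap-o v i j (≢i r) (≢j t))) (sym (ext-emb v a)))

    reflect : ∀ {x y : Perm k} → X ≈ₚ ext x → Y ≈ₚ ext y → x ⊲ y
    reflect {x} {y} eX eY = cover (emb-<⁻¹ (subst₂ _<ᶠ_ (sym ei) (sym ej) p<q))
      (emb-<⁻¹ (subst₂ _<ᶠ_ (Xp i ei) (Xp j ej) Xp<Xq))
      (swapped (emb-inj (trans (sym (Yp i ei)) (trans at-l (Xp j ej)))) (emb-inj (trans (sym (Yp j ej)) (trans at-r (Xp i ei))))
        λ {a} r t → emb-inj (trans (sym (Yp a refl)) (trans (away (λ e → r (emb-inj (trans e (sym ei)))) (λ e → t (emb-inj (trans e (sym ej))))) (Xp a refl))))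
      λ m ((a , b) , (r , t)) → none (emb m) ((subst (_<ᶠ emb m) ei (emb-< a) , subst (emb m <ᶠ_) ej (emb-< b)) ,
        ( subst₂ _<ᶠ_ (sym (Xp i ei)) (sym (Xp m refl)) (emb-< r) , subst₂ _<ᶠ_ (sym (Xp m refl)) (sym (Xp j ej)) (emb-< t)))
      where
      Xp : ∀ a {z} → emb a ≡ z → X ∙ z ≡ emb (x ∙ a)
      Xp a refl = trans (eX (emb a)) (ext-emb x a)
      Yp : ∀ a {z} → emb a ≡ z → Y ∙ z ≡ emb (y ∙ a)
      Yp a refl = trans (eY (emb a)) (ext-emb y a)

    below-ext : ∀ {y : Perm k} → Y ≈ₚ ext y → Σ (Perm k) λ x → (X ≈ₚ ext x) × (x ⊲ y)
    below-ext {y} eY = x , X≈ , reflect X≈ eY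
      where
      x = swap i j y
      X≈ : X ≈ₚ ext x
      X≈ = SwapOf-unique {v = Y} {X} {ext x} (SwapOf-sym isSwap) (swap-ext {Y} {X} {y} (SwapOf-sym isSwap) eY)

    above-ext : ∀ {x : Perm k} → X ≈ₚ ext x → Σ (Perm k) λ y → (Y ≈ₚ ext y) × (x ⊲ y)
    above-ext {x} eX = y , Y≈ , reflect eX Y≈
      where
      y = swap i j x
      Y≈ : Y ≈ₚ ext y
      Y≈ = SwapOf-unique {v = X} {Y} {ext y} isSwap (swap-ext {X} {Y} {x} isSwap eX)

  ≤-ext : ∀ {u v : Perm k} → u ≤B v → ext u ≤B ext v
  ≤-ext {u} {v} (≤B-refl e) = ≤B-refl (ext-cong {u} {v} e)
  ≤-ext (≤B-step {a} {b} c p) = step (⊲-ext (⋖⇒⊲ a b c)) (≤-ext p)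

  ≤ext⇒ext : ∀ {X Y : Perm n} {y} → X ≤B Y → Y ≈ₚ ext y → Σ (Perm k) λ x → (X ≈ₚ ext x) × (x ≤B y)
  ≤ext⇒ext {X} {Y} {y} (≤B-refl e) eY = y , (λ x → trans (e x) (eY x)) , refl≤B
  ≤ext⇒ext {X} {Y} {y} (≤B-step {v = Z} c p) eY =
    let z , eZ , z≤y = ≤ext⇒ext {Z} {Y} {y} p eY
        x , eX , x⊲z = below-ext {X} {Z} (⋖⇒⊲ X Z c) (λ {x} l → trans (eZ x) (ext-below z l)) (λ {x} l → trans (eZ x) (ext-above z l)) {z} eZ
    in x , eX , step x⊲z z≤y

  abstract
    -- Climbing from `X` to `Y` by covers inside the interval raises both lengths in step, so they
    -- can be compared without counting the inversions of an extension.
    supported⇒ext : ∀ {X Y : Perm n} {x} → X ≤B Y → FixesBelow c Y → FixesAbove top Y → X ≈ₚ ext x → len X ≡ len x → Σ (Perm k) λ y → (Y ≈ₚ ext y) × (len Y ≡ len y)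
    supported⇒ext {X} {Y} {x} (≤B-refl e) fb fa eX l = x , (λ z → trans (sym (e z)) (eX z)) , trans (sym (len-cong {v = X} {Y} e)) l
    supported⇒ext {X} {Y} {x} (≤B-step {v = Z} c p) fb fa eX l =
      let z , eZ , x⊲z = above-ext {X} {Z} (⋖⇒⊲ X Z c) (FixesBelow-≤ p fb) (FixesAbove-≤ p fa) {x} eX
      in supported⇒ext {Z} {Y} {z} p fb fa eZ (trans (⊲⇒len (⋖⇒⊲ X Z c)) (trans (cong suc l) (sym (⊲⇒len x⊲z))))

  B-ext : ∀ u → B (ext u) ≃ B u
  B-ext u = record
    { to = λ X → x X , proj₂ (proj₂ (r X))
    ; from = λ (x , p) → ext x , ≤-ext p
    ; to-cong = λ {X} {Y} e → ext-inj {x X} {x Y} λ z → trans (sym (eq X z)) (trans (e z) (eq Y z))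
    ; from-cong = λ {X} {Y} → ext-cong {proj₁ X} {proj₁ Y}
    ; from-to = λ X z → sym (eq X z)
    ; to-from = λ X → ext-inj {x (ext (proj₁ X) , ≤-ext (proj₂ X))} {proj₁ X} λ z → sym (eq (ext (proj₁ X) , ≤-ext (proj₂ X)) z)
    ; to-mono = λ {X} {Y} p → let (x' , e , q) = ≤ext⇒ext {proj₁ X} {proj₁ Y} {x Y} p (eq Y) in
        ≤B-respˡ {v = x'} {x X} (ext-inj {x'} {x X} λ z → trans (sym (e z)) (eq X z)) q
    ; to-refl = λ {X} {Y} p → ≤B-resp₂ {v = ext (x X)} {proj₁ X} {ext (x Y)} {proj₁ Y} (λ z → sym (eq X z)) (λ z → sym (eq Y z)) (≤-ext p)
    }
    where
    r : (X : Σ (Perm n) (_≤B ext u)) → Σ (Perm k) λ x → (proj₁ X ≈ₚ ext x) × (x ≤B u)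
    r (X , p) = ≤ext⇒ext {X} {ext u} {u} p λ _ → refl
    x : Σ (Perm n) (_≤B ext u) → Perm k
    x X = proj₁ (r X)
    eq : ∀ X → proj₁ X ≈ₚ ext (x X)
    eq X = proj₁ (proj₂ (r X))

-- Block products

-- The upper bound is the lower bound for the conjugate by `opposite`.
increasing⇒id : (f : Fin n → Fin n) → (∀ {x y} → x <ᶠ y → f x <ᶠ f y) → ∀ x → f x ≡ x
increasing⇒id f inc x = toℕ-injective (≤-antisym upper (increasing-≥ f inc x))
  where
  upper : toℕ (f x) ≤ toℕ x
  upper = ≮⇒≥ λ lt → <⇒≱ (opposite-< lt)
    (subst (λ y → toℕ (opposite x) ≤ toℕ (opposite (f y))) (Finₚ.opposite-involutive x)
      (increasing-≥ (opposite ∘ f ∘ opposite) (λ l → opposite-< (inc (opposite-< l))) (opposite x)))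

occ-cong : {v w : Perm n} {k : ℕ} → v ≈ₚ w → Occurrence v k → Occurrence w k
occ-cong e (p , inc , dec) = p , inc , λ a b lt → subst₂ _<ᶠ_ (e (p b)) (e (p a)) (dec a b lt)

uniqueOcc-cong : {v w : Perm n} {k : ℕ} → v ≈ₚ w → EveryInversionInUniqueOcc v k → EveryInversionInUniqueOcc w k
uniqueOcc-cong {v = v} {w} e h i j (i<j , lt) =
  let o , i∈ , j∈ , unique = h i j (i<j , subst₂ _<ᶠ_ (sym (e j)) (sym (e i)) lt)
  in occ-cong {v = v} {w} e o , i∈ , j∈ , λ o' → unique (occ-cong {v = w} {v} (λ x → sym (e x)) o')

-- Inversion trades positions for values and so reads an occurrence backwards.
occ-flip : (w : Perm n) {k : ℕ} → Occurrence w k → Occurrence (flip w) k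
occ-flip w (p , inc , dec) = (λ a → w ∙ p (opposite a)) , (λ a b lt → dec _ _ (opposite-< lt))
  , λ a b lt → subst₂ _<ᶠ_ (sym (inverseˡ w)) (sym (inverseˡ w)) (inc _ _ (opposite-< lt))

occ-flip-∈ : (w : Perm n) {k : ℕ} (o : Occurrence w k) {i : Fin n} → InOcc w i o → InOcc (flip w) (w ∙ i) (occ-flip w o)
occ-flip-∈ w (p , _) (a , e) = opposite a , cong (w ∙_) (trans (cong p (Finₚ.opposite-involutive a)) e)

uniqueOcc-flip : (w : Perm n) {k : ℕ} → EveryInversionInUniqueOcc w k → EveryInversionInUniqueOcc (flip w) k
uniqueOcc-flip w h i j (i<j , lt) =
  let o , j∈ , i∈ , unique = h (w ∙⁻¹ j) (w ∙⁻¹ i) (lt , subst₂ _<ᶠ_ (sym (inverseʳ w)) (sym (inverseʳ w)) i<j)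
  in occ-flip w o , subst (λ x → InOcc (flip w) x (occ-flip w o)) (inverseʳ w) (occ-flip-∈ w o i∈)
   , subst (λ x → InOcc (flip w) x (occ-flip w o)) (inverseʳ w) (occ-flip-∈ w o j∈)
   , λ o' i∈' j∈' a → trans (sym (trans (inverseʳ w) (cong (proj₁ o') (Finₚ.opposite-involutive a))))
       (cong (w ∙_) (unique (occ-flip (flip w) o') (occ-flip-∈ (flip w) o' j∈') (occ-flip-∈ (flip w) o' i∈') (opposite a)))

-- The block consists of the entries at c, ..., d - 1 and one more, at the preimage of `d` under
-- `v`. Inversions of `w` that start before `d` stay inside the block; those that start later are
-- the inversions of `v`.
module BlockStep {n : ℕ} {c k' : ℕ} (fits : c + suc k' ≤ n) (v w : Perm n)
                 (fv : FixesBelow (c + k') v) (w≈ : w ≈ₚ (v ∘ₚ Interval.ext c k' fits (w₀ (suc k')))) where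
  open Interval c k' fits
  private
    u = ext (w₀ k)
    d = top

  w≡u : ∀ {x} → toℕ x < d → w ∙ x ≡ u ∙ x
  w≡u lt = trans (w≈ _) (cong (u ∙_) (fv lt))

  blk : Fin k → Fin n
  blk a = v ∙⁻¹ emb a

  fv⁻¹ : FixesBelow top (flip v)
  fv⁻¹ {x} lt = trans (cong (v ∙⁻¹_) (sym (fv lt))) (inverseˡ v)

  w-blk : ∀ a → w ∙ blk a ≡ emb (opposite a)
  w-blk a = trans (w≈ _) (trans (cong (u ∙_) (inverseʳ v)) (ext-emb (w₀ k) a))

  blk-low : ∀ {a} → toℕ (emb a) < d → blk a ≡ emb a
  blk-low = fv⁻¹

  blk-< : ∀ a b → a <ᶠ b → blk a <ᶠ blk b
  blk-< a b lt = subst (_<ᶠ blk b) (sym (blk-low ea<d)) (lem (toℕ (emb b) <? d))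
    where
    ea<d : toℕ (emb a) < d
    ea<d = <-≤-trans (emb-< lt) (emb-≤ b)
    lem : Dec (toℕ (emb b) < d) → emb a <ᶠ blk b
    lem (yes l) = subst (emb a <ᶠ_) (sym (blk-low l)) (emb-< lt)
    lem (no l) = <-≤-trans ea<d (FixesBelow-≥ (flip v) fv⁻¹ (≮⇒≥ l))

  blk-<⁻¹ : ∀ {a b} → blk a <ᶠ blk b → a <ᶠ b
  blk-<⁻¹ {a} {b} lt with Finₚ.<-cmp a b
  ... | tri< l _ _ = l
  ... | tri≈ _ refl _ = contradiction lt (n≮n _)
  ... | tri> _ _ l = contradiction lt (<-asym (blk-< b a l))

  block : Occurrence w k
  block = blk , blk-< , λ a b lt → subst₂ _<ᶠ_ (sym (w-blk b)) (sym (w-blk a)) (emb-< (opposite-< lt))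

  InBlock : Fin n → Set
  InBlock x = ∃ λ a → blk a ≡ x

  low-inversion : ∀ {i j} → IsInversion w i j → toℕ i < d → InBlock i × InBlock j
  low-inversion {i} {j} (i<j , lt) i<d = (proj₁ i∈ , trans (blk-low (subst (λ x → toℕ x < d) (sym (proj₂ i∈)) i<d)) (proj₂ i∈))
                                       , (proj₁ vj∈ , trans (cong (v ∙⁻¹_) (proj₂ vj∈)) (inverseˡ v))
    where
    vj≡j : ∀ {y} → toℕ y ≤ d → v ∙ j <ᶠ y → v ∙ j ≡ j
    vj≡j y≤d l = ∙-inj v (fv (<-≤-trans l y≤d))
    lt' : u ∙ (v ∙ j) <ᶠ u ∙ i
    lt' = subst₂ _<ᶠ_ (w≈ j) (w≡u i<d) lt
    c≤i : c ≤ toℕ i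
    c≤i = ≮⇒≥ λ i<c →
      let l = subst (u ∙ (v ∙ j) <ᶠ_) (ext-below (w₀ k) i<c) lt'
          uvj = ∙-inj u (ext-below (w₀ k) (<-trans l i<c))
          vj<i = subst (_<ᶠ i) uvj l
      in <-asym i<j (subst (_<ᶠ i) (vj≡j (<⇒≤ i<d) vj<i) vj<i)
    i∈ = emb-hit i c≤i (<⇒≤ i<d)
    vj≤d : toℕ (v ∙ j) ≤ d
    vj≤d = ≮⇒≥ λ d<vj → <⇒≱ d<vj (subst (λ y → toℕ y ≤ d) (ext-above (w₀ k) d<vj)
             (<⇒≤ (<-≤-trans lt' (FixesAbove-stable u (ext-above (w₀ k)) (<⇒≤ i<d)))))
    c≤vj : c ≤ toℕ (v ∙ j)
    c≤vj = ≮⇒≥ λ vj<c → let vj<i = <-≤-trans vj<c c≤i in <-asym i<j (subst (_<ᶠ i) (vj≡j (<⇒≤ i<d) vj<i) vj<i)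
    vj∈ = emb-hit (v ∙ j) c≤vj vj≤d

  InBlock-≥ : ∀ {x y} → InBlock x → InBlock y → d ≤ toℕ x → d ≤ toℕ y → x ≡ y
  InBlock-≥ (a , refl) (b , refl) p q = cong (v ∙⁻¹_) (toℕ-injective (trans (at-top a p) (sym (at-top b q))))
    where
    at-top : ∀ a → d ≤ toℕ (blk a) → toℕ (emb a) ≡ d
    at-top a p = ≤-antisym (emb-≤ a) (≮⇒≥ λ l → <⇒≱ l (subst (λ x → d ≤ toℕ x) (blk-low l) p))

  high-v⇒w : ∀ {i j} → d ≤ toℕ i → d ≤ toℕ j → v ∙ j <ᶠ v ∙ i → w ∙ j <ᶠ w ∙ i
  high-v⇒w p q lt = subst₂ _<ᶠ_ (sym (w≈ _)) (sym (w≈ _)) (FixesAbove-increasing u (ext-above (w₀ k)) (FixesBelow-≥ v fv q) lt)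

  high-w⇒v : ∀ {i j} → d ≤ toℕ i → d ≤ toℕ j → w ∙ j <ᶠ w ∙ i → v ∙ j <ᶠ v ∙ i
  high-w⇒v p q lt = FixesAbove-increasing⁻¹ u (ext-above (w₀ k)) (FixesBelow-≥ v fv q) (FixesBelow-≥ v fv p) (subst₂ _<ᶠ_ (w≈ _) (w≈ _) lt)

  High : {x : Perm n} → Occurrence x k → Set
  High o = ∀ t → d ≤ toℕ (proj₁ o t)

  high-occ-v⇒w : (o : Occurrence v k) → High {v} o → Occurrence w k
  high-occ-v⇒w (p , inc , dec) h = p , inc , λ a b lt → high-v⇒w (h a) (h b) (dec a b lt)

  high-occ-w⇒v : (o : Occurrence w k) → High {w} o → Occurrence v k
  high-occ-w⇒v (p , inc , dec) h = p , inc , λ a b lt → high-w⇒v (h a) (h b) (dec a b lt)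

  ordered : ∀ {x : Perm n} (o : Occurrence x k) {s t} → proj₁ o s <ᶠ proj₁ o t → s <ᶠ t
  ordered (p , inc , _) {s} {t} lt with Finₚ.<-cmp s t
  ... | tri< l _ _ = l
  ... | tri≈ _ refl _ = contradiction lt (n≮n _)
  ... | tri> _ _ l = contradiction lt (<-asym (inc t s l))

  high-v : (o : Occurrence v k) {i : Fin n} → InOcc v i o → d ≤ toℕ i → High {v} o
  high-v o@(p , inc , dec) (s , refl) d≤i t = ≮⇒≥ λ x<d →
    <⇒≱ x<d (≤-trans (FixesBelow-≥ v fv d≤i) (<⇒≤ (subst (v ∙ p s <ᶠ_) (fv x<d) (dec t s (ordered {v} o (<-≤-trans x<d d≤i))))))

  -- If an entry lay before `d`, its inversions with `i` and `j` would put both into the block,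
  -- which has only one position from `d` on.
  high-w : (o : Occurrence w k) {i j : Fin n} → InOcc w i o → InOcc w j o → i <ᶠ j → d ≤ toℕ i → High {w} o
  high-w o@(p , inc , dec) {i} {j} (s , refl) (s' , refl) i<j d≤i t = ≮⇒≥ λ x<d →
    let x<i = <-≤-trans x<d d≤i
        x<j = <-trans x<i i<j
        i∈ = proj₂ (low-inversion (x<i , dec t s (ordered {w} o x<i)) x<d)
        j∈ = proj₂ (low-inversion (x<j , dec t s' (ordered {w} o x<j)) x<d)
    in <⇒≢ᶠ i<j (InBlock-≥ i∈ j∈ d≤i (≤-trans d≤i (<⇒≤ i<j)))

  v-inversion-high : ∀ {i j} → IsInversion v i j → d ≤ toℕ i
  v-inversion-high {i} {j} (i<j , lt) = ≮⇒≥ λ i<d →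
    let vj<i = subst (v ∙ j <ᶠ_) (fv i<d) lt
        vj≡j = ∙-inj v (fv (<-trans vj<i i<d))
    in <-asym i<j (subst (_<ᶠ i) vj≡j vj<i)

  uniqueOcc-v⇒w : EveryInversionInUniqueOcc v k → EveryInversionInUniqueOcc w k
  uniqueOcc-v⇒w h i j inv@(i<j , lt) = go (toℕ i <? d)
    where
    go : Dec (toℕ i < d) → _
    go (yes i<d) = block , proj₁ ij , proj₂ ij , unique
      where
      ij = low-inversion inv i<d
      unique : (o' : Occurrence w k) → InOcc w i o' → InOcc w j o' → ∀ a → proj₁ o' a ≡ blk a
      -- All entries of `o'` lie in the block, and an increasing self-map of the `k` indices is the
      -- identity.
      unique o'@(p , inc , dec) (s , ps) (s' , ps') t = trans (sym (proj₂ (all∈ t))) (cong blk (increasing⇒id f f-inc t))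
        where
        all∈ : ∀ t → InBlock (p t)
        all∈ t with Finₚ.<-cmp t s
        ... | tri≈ _ refl _ = subst InBlock (sym ps) (proj₁ ij)
        ... | tri< l _ _ = proj₁ (low-inversion (inc t s l , dec t s l) (<-trans (inc t s l) (subst (λ x → toℕ x < d) (sym ps) i<d)))
        ... | tri> _ _ l = proj₂ (low-inversion (inc s t l , dec s t l) (subst (λ x → toℕ x < d) (sym ps) i<d))
        f : Fin k → Fin k
        f t = proj₁ (all∈ t)
        f-inc : ∀ {x y} → x <ᶠ y → f x <ᶠ f y
        f-inc {x} {y} l = blk-<⁻¹ (subst₂ _<ᶠ_ (sym (proj₂ (all∈ x))) (sym (proj₂ (all∈ y))) (inc x y l))
    go (no i≮d) =
      let d≤i = ≮⇒≥ i≮d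
          o , i∈ , j∈ , unique = h i j (i<j , high-w⇒v d≤i (≤-trans d≤i (<⇒≤ i<j)) lt)
      in high-occ-v⇒w o (high-v o i∈ d≤i) , i∈ , j∈ ,
         λ o' i∈' j∈' → unique (high-occ-w⇒v o' (high-w o' i∈' j∈' i<j d≤i)) i∈' j∈'

  uniqueOcc-w⇒v : EveryInversionInUniqueOcc w k → EveryInversionInUniqueOcc v k
  uniqueOcc-w⇒v h i j inv@(i<j , lt) =
    let d≤i = v-inversion-high inv
        o , i∈ , j∈ , unique = h i j (i<j , high-v⇒w d≤i (≤-trans d≤i (<⇒≤ i<j)) lt)
    in high-occ-w⇒v o (high-w o i∈ j∈ i<j d≤i) , i∈ , j∈ ,
       λ o' i∈' j∈' → unique (high-occ-v⇒w o' (high-v o' i∈' d≤i)) i∈' j∈'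

-- Products, in some order, of longest elements of disjoint intervals of k - 1 consecutive generators, with k = k' + 1.
data BlockProduct (k' : ℕ) {n : ℕ} (w : Perm n) : Set where
  unit : w ≈ₚ idₚ → BlockProduct k' w
  cons : ∀ {c} (fits : c + suc k' ≤ n) (v : Perm n) → FixesBelow (c + k') v →
         w ≈ₚ (v ∘ₚ Interval.ext c k' fits (w₀ (suc k'))) → BlockProduct k' v → BlockProduct k' w
  inverse : (v : Perm n) → w ≈ₚ flip v → BlockProduct k' v → BlockProduct k' w

BlockProduct⇒≃ : ∀ {k'} {w : Perm n} → BlockProduct k' w → Σ ℕ λ r → B w ≃ (B (w₀ (suc k')) ^ᴾ r)
BlockProduct⇒≃ {w = w} (unit e) = 0 , record
  { to = λ _ () ; from = λ _ → w , refl≤B ; to-cong = λ _ () ; from-cong = λ _ _ → refl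
  ; from-to = λ (x , p) → ≤B-antisym (least x) p ; to-from = λ _ () ; to-mono = λ _ () ; to-refl = λ { {x , p} {y , _} _ → ≤B-trans p (least y) } }
  where
  least : ∀ x → w ≤B x
  least x = ≤B-respˡ {v = idₚ} {w} (λ i → sym (e i)) (id-least x)
BlockProduct⇒≃ {k' = k'} {w} (cons {c} fits v fv e b) =
  let r , f = BlockProduct⇒≃ b
  in suc r , ≃-trans {P = B w} {Q = B (v ∘ₚ ext (w₀ k))} {R = P ^ᴾ suc r} (B-trans≈ {w = w}) (B^-trans≈ {w = w₀ k} {suc r}) (B-cong {v = w} {v ∘ₚ ext (w₀ k)} e)
       (≃-trans {P = B (v ∘ₚ ext (w₀ k))} {Q = B (ext (w₀ k)) ×ᴾ B v} {R = P ^ᴾ suc r} (B-trans≈ {w = v ∘ₚ ext (w₀ k)}) (B^-trans≈ {w = w₀ k} {suc r})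
         (B-∘ₚ (ext-above (w₀ k)) fv) (≃-×-^ {P = B (ext (w₀ k))} {Q = B v} {R = P} (λ _ _ → refl) (B-ext (w₀ k)) f))
  where
  open Interval c k' fits
  P = B (w₀ k)
BlockProduct⇒≃ {k' = k'} {w} (inverse v e b) =
  let r , f = BlockProduct⇒≃ b
  in r , ≃-trans {P = B w} {Q = B (flip v)} {R = P ^ᴾ r} (B-trans≈ {w = w}) (B^-trans≈ {w = w₀ (suc k')} {r}) (B-cong {v = w} {flip v} e)
       (≃-trans {P = B (flip v)} {Q = B v} {R = P ^ᴾ r} (B-trans≈ {w = flip v}) (B^-trans≈ {w = w₀ (suc k')} {r}) (B-flip v) f)
  where
  P = B (w₀ (suc k'))

BlockProduct⇒uniqueOcc : ∀ {k'} {w : Perm n} → BlockProduct k' w → EveryInversionInUniqueOcc w (suc k')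
BlockProduct⇒uniqueOcc (unit e) i j (i<j , lt) = contradiction i<j (<-asym (subst₂ _<ᶠ_ (e j) (e i) lt))
BlockProduct⇒uniqueOcc {w = w} (cons fits v fv e b) = BlockStep.uniqueOcc-v⇒w fits v w fv e (BlockProduct⇒uniqueOcc b)
BlockProduct⇒uniqueOcc {w = w} (inverse v e b) = uniqueOcc-cong {v = flip v} {w} (λ x → sym (e x)) (uniqueOcc-flip v (BlockProduct⇒uniqueOcc b))

-- From unique occurrences to block products

-- The last position of the interval is exempt from `rev`, as the remaining factor may move it.
-- Since `u` is an involution, composing with it removes the block.
module Strip {n : ℕ} {c k' : ℕ} (fits : c + suc k' ≤ n) (w : Perm n) (fw : FixesBelow c w)
             (rev : ∀ a → toℕ a < k' → w ∙ Interval.emb c k' fits a ≡ Interval.emb c k' fits (opposite a)) where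
  open Interval c k' fits
  private
    u = ext (w₀ k)

  u∘u : ∀ x → u ∙ (u ∙ x) ≡ x
  u∘u = act-inverse Finₚ.opposite-involutive

  rest : Perm n
  rest = w ∘ₚ u

  rest-fixes : FixesBelow top rest
  rest-fixes {x} lt = at (c ≤? toℕ x)
    where
    at : Dec (c ≤ toℕ x) → u ∙ (w ∙ x) ≡ x
    at (no l) = trans (cong (u ∙_) (fw (≰⇒> l))) (ext-below (w₀ k) (≰⇒> l))
    at (yes l) with emb-hit x l (<⇒≤ lt)
    ... | a , refl = trans (cong (u ∙_) (rev a (+-cancelˡ-< c _ _ (subst (_< top) (toℕ-emb a) lt))))
                       (trans (ext-emb (w₀ k) (opposite a)) (cong emb (Finₚ.opposite-involutive a)))

  w≈ : w ≈ₚ (rest ∘ₚ u)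
  w≈ x = sym (u∘u (w ∙ x))

-- Applied once to the values and once to the positions of an occurrence, after both are shown to
-- have no gaps.
consecutive : ∀ {m} (f : Fin (suc m) → ℕ) → (∀ {a b} → a <ᶠ b → f a < f b) →
  (∀ y b → f 0F ≤ y → y ≤ f b → ∃ λ a → f a ≡ y) → ∀ a → f a ≡ f 0F + toℕ a
consecutive f inc closed 0F = sym (+-identityʳ _)
consecutive {suc m} f inc closed (Fin.suc a) = trans (consecutive (f ∘ Fin.suc) (λ l → inc (s≤s l)) closed' a)
    (trans (cong (_+ toℕ a) f1) (sym (+-suc (f 0F) (toℕ a))))
  where
  f0<f1 : f 0F < f 1F
  f0<f1 = inc (s≤s z≤n)
  f1≤ : ∀ b → f 1F ≤ f (Fin.suc b)
  f1≤ 0F = ≤-refl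
  f1≤ (Fin.suc b) = <⇒≤ (inc (s≤s (s≤s z≤n)))
  closed' : ∀ y b → f 1F ≤ y → y ≤ f (Fin.suc b) → ∃ λ a → f (Fin.suc a) ≡ y
  closed' y b p q with closed y (Fin.suc b) (≤-trans (<⇒≤ f0<f1) p) q
  ... | 0F , e = contradiction (<-≤-trans f0<f1 p) (≤⇒≯ (≤-reflexive (sym e)))
  ... | Fin.suc a , e = a , e
  f1 : f 1F ≡ suc (f 0F)
  f1 with closed (suc (f 0F)) 1F (n≤1+n _) f0<f1
  ... | 0F , e = contradiction (sym e) 1+n≢n
  ... | Fin.suc a , e = ≤-antisym (≤-trans (f1≤ a) (≤-reflexive e)) f0<f1

module UniqueOcc {n K : ℕ} (w : Perm n) (h : EveryInversionInUniqueOcc w (3 + K)) where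

  k : ℕ
  k = 3 + K

  -- A strict partial order on positions whose chains are the decreasing subsequences.
  infix 4 _≺_
  _≺_ : Fin n → Fin n → Set
  x ≺ y = IsInversion w x y

  ≺-trans : ∀ {x y z} → x ≺ y → y ≺ z → x ≺ z
  ≺-trans (a , b) (c , d) = <-trans a c , <-trans d b

  Chain : ∀ {m} → (Fin m → Fin n) → Set
  Chain p = ∀ {a b} → a <ᶠ b → p a ≺ p b

  chain : ∀ {m} (o : Occurrence w m) → Chain (proj₁ o)
  chain (p , inc , dec) {a} {b} lt = inc a b lt , dec a b lt

  unchain : ∀ {m} (p : Fin m → Fin n) → Chain p → Occurrence w m
  unchain p c = p , (λ a b lt → proj₁ (c lt)) , (λ a b lt → proj₂ (c lt))

  chain-≼ : ∀ {m} {p : Fin m → Fin n} → Chain p → ∀ {a b z} → toℕ a ≤ toℕ b → p b ≺ z → p a ≺ z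
  chain-≼ {p = p} c {a} {b} le q with Finₚ.<-cmp a b
  ... | tri< l _ _ = ≺-trans (c l) q
  ... | tri≈ _ refl _ = q
  ... | tri> _ _ l = contradiction le (<⇒≱ l)

  chain-<⁻¹ : ∀ {m} {p : Fin m → Fin n} → Chain p → ∀ {a b} → p a <ᶠ p b → a <ᶠ b
  chain-<⁻¹ {p = p} c {a} {b} lt with Finₚ.<-cmp a b
  ... | tri< l _ _ = l
  ... | tri≈ _ refl _ = contradiction lt (n≮n _)
  ... | tri> _ _ l = contradiction lt (<-asym (proj₁ (c l)))

  occ-unique : ∀ {x y} → x ≺ y → (o o' : Occurrence w k) → InOcc w x o → InOcc w y o → InOcc w x o' → InOcc w y o' →
    ∀ a → proj₁ o a ≡ proj₁ o' a
  occ-unique {x} {y} xy o o' x∈ y∈ x∈' y∈' a =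
    let _ , _ , _ , unique = h x y xy in trans (unique o x∈ y∈ a) (sym (unique o' x∈' y∈' a))

  comparable : (o : Occurrence w k) → ∀ {x y} → InOcc w x o → InOcc w y o → x <ᶠ y → w ∙ y <ᶠ w ∙ x
  comparable o (a , refl) (b , refl) lt = proj₂ (chain o (chain-<⁻¹ (chain o) lt))

  punchIn-< : ∀ {m} (j : Fin (suc m)) {a b} → a <ᶠ b → punchIn j a <ᶠ punchIn j b
  punchIn-< j {a} {b} lt = ≤∧≢⇒< (Finₚ.punchIn-mono-≤ j a b (<⇒≤ lt)) λ e → <⇒≢ᶠ lt (Finₚ.punchIn-injective j a b (toℕ-injective e))

  -- Dropping the second or the third entry of a longer sequence gives two occurrences through the first and the fourth.
  no-longer : {q : Fin (suc k) → Fin n} → ¬ Chain q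
  no-longer {q} c = <⇒≢ᶠ (proj₁ (c {1F} {2F} (s≤s (s≤s z≤n))))
    (sym (occ-unique (c {0F} {3F} (s≤s z≤n)) (drop 1F) (drop 2F) (0F , refl) (2F , refl) (0F , refl) (2F , refl) 1F))
    where
    drop : Fin (suc k) → Occurrence w k
    drop j = unchain (q ∘ punchIn j) λ lt → c (punchIn-< j lt)

  -- Follows `o` up to the common point and `o'` after it, with indices shifted by `δ`. For `δ` = 1
  -- this yields a chain of k + 1 points, for `δ` = 0 another occurrence.
  module Splice (o o' : Occurrence w k) {b b' : Fin k} (meet : proj₁ o b ≡ proj₁ o' b') (δ : ℕ) (b'+δ≤b : toℕ b' + δ ≤ toℕ b)
                {m : ℕ} (m≤ : m ≤ k + δ) where
    private
      p = proj₁ o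
      p' = proj₁ o'

    at : (a : Fin m) → Dec (toℕ a ≤ toℕ b) → Fin n
    at a (yes le) = p (fromℕ< (≤-<-trans le (toℕ<n b)))
    at a (no gt) = p' (fromℕ< {toℕ a ∸ δ} (m<n+o⇒m∸n<o (toℕ a) δ (subst (toℕ a <_) (+-comm k δ) (<-≤-trans (toℕ<n a) m≤))))

    splice : Fin m → Fin n
    splice a = at a (toℕ a ≤? toℕ b)

    splice-chain : Chain splice
    splice-chain {a₁} {a₂} lt = go (toℕ a₁ ≤? toℕ b) (toℕ a₂ ≤? toℕ b)
      where
      δ≤ : ∀ {a : Fin m} → ¬ (toℕ a ≤ toℕ b) → δ ≤ toℕ a
      δ≤ gt = ≤-trans (m≤n+m δ (toℕ b')) (≤-trans b'+δ≤b (<⇒≤ (≰⇒> gt)))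
      go : (d₁ : Dec (toℕ a₁ ≤ toℕ b)) (d₂ : Dec (toℕ a₂ ≤ toℕ b)) → at a₁ d₁ ≺ at a₂ d₂
      go (yes l) (yes l') = chain o (subst₂ _<_ (sym (toℕ-fromℕ< _)) (sym (toℕ-fromℕ< _)) lt)
      go (no g) (yes l) = contradiction (≤-trans (<⇒≤ lt) l) g
      go (no g) (no g') = chain o' (subst₂ _<_ (sym (toℕ-fromℕ< _)) (sym (toℕ-fromℕ< _)) (∸-monoˡ-< lt (δ≤ g)))
      go (yes l) (no g) = chain-≼ (chain o) {b = b} (subst (_≤ toℕ b) (sym (toℕ-fromℕ< _)) l)
        (subst (_≺ at a₂ (no g)) (sym meet) (chain o' (subst (toℕ b' <_) (sym (toℕ-fromℕ< _))
          (m+n≤o⇒m≤o∸n (suc (toℕ b')) (≤-<-trans b'+δ≤b (≰⇒> g))))))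

    splice-low : ∀ {a} {a' : Fin k} → toℕ a ≡ toℕ a' → toℕ a ≤ toℕ b → splice a ≡ p a'
    splice-low {a} {a'} e le = go (toℕ a ≤? toℕ b)
      where
      go : (d : Dec (toℕ a ≤ toℕ b)) → at a d ≡ p a'
      go (yes _) = cong p (toℕ-injective (trans (toℕ-fromℕ< _) e))
      go (no g) = contradiction le g

    splice-high : ∀ {a} {a' : Fin k} → toℕ a ∸ δ ≡ toℕ a' → ¬ (toℕ a ≤ toℕ b) → splice a ≡ p' a'
    splice-high {a} {a'} e gt = go (toℕ a ≤? toℕ b)
      where
      go : (d : Dec (toℕ a ≤ toℕ b)) → at a d ≡ p' a'
      go (yes l) = contradiction l gt
      go (no _) = cong p' (toℕ-injective (trans (toℕ-fromℕ< _) e))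

  -- If the indices differed, the longer of the two initial parts followed by the longer of the two
  -- remainders would exceed `k` points.
  same-index : (o o' : Occurrence w k) {b b' : Fin k} → proj₁ o b ≡ proj₁ o' b' → b ≡ b'
  same-index o o' {b} {b'} e with Finₚ.<-cmp b b'
  ... | tri≈ _ r _ = r
  ... | tri> _ _ l = ⊥-elim (no-longer (Splice.splice-chain o o' e 1 (≤-trans (≤-reflexive (+-comm (toℕ b') 1)) l) {suc k} (≤-reflexive (+-comm 1 k))))
  ... | tri< l _ _ = ⊥-elim (no-longer (Splice.splice-chain o' o (sym e) 1 (≤-trans (≤-reflexive (+-comm (toℕ b) 1)) l) {suc k} (≤-reflexive (+-comm 1 k))))

  -- The occurrence through `y` and `z` has `y` at the same index as `o`, so it can continue `o`
  -- from `y` on. The result contains `x` and `y`, hence is `o`.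
  extend-up : ∀ {x y z} (o : Occurrence w k) → InOcc w x o → InOcc w y o → x ≺ y → y ≺ z → InOcc w z o
  extend-up {x} {y} {z} o (a , refl) (b , refl) xy yz with h y z yz
  ... | o₂ , (b₂ , e₂) , (c , refl) , _ with same-index o o₂ (sym e₂)
  ...   | refl = c , trans (sym (occ-unique xy (unchain splice splice-chain) o (a , splice-low {a} refl (<⇒≤ a<b)) (b , splice-low {b} refl ≤-refl) (a , refl) (b , refl) c))
                     (splice-high {c} refl (<⇒≱ b<c))
    where
    a<b : a <ᶠ b
    a<b = chain-<⁻¹ (chain o) (proj₁ xy)
    b<c : b <ᶠ c
    b<c = chain-<⁻¹ (chain o₂) (subst (_<ᶠ proj₁ o₂ c) (sym e₂) (proj₁ yz))
    open Splice o o₂ (sym e₂) 0 (≤-reflexive (+-identityʳ _)) {k} (≤-reflexive (sym (+-identityʳ k)))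

  ∈-resp : ∀ {x} (o o' : Occurrence w k) → (∀ a → proj₁ o a ≡ proj₁ o' a) → InOcc w x o → InOcc w x o'
  ∈-resp o o' e (a , r) = a , trans (sym (e a)) r

  -- The occurrence through `x` and `y` extends to `z`, so it shares `y` and `z` with `o` and is
  -- `o`.
  extend-down : ∀ {x y z} (o : Occurrence w k) → InOcc w y o → InOcc w z o → x ≺ y → y ≺ z → InOcc w x o
  extend-down {x} {y} {z} o y∈ z∈ xy yz =
    let o' , x∈' , y∈' , _ = h x y xy
    in ∈-resp o' o (occ-unique yz o' o y∈' (extend-up o' x∈' y∈' xy yz) y∈ z∈) x∈'

  extend-middle : ∀ {x y z} (o : Occurrence w k) → InOcc w x o → InOcc w z o → x ≺ y → y ≺ z → InOcc w y o
  extend-middle {x} {y} {z} o x∈ z∈ xy yz =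
    let o' , x∈' , y∈' , _ = h x y xy
    in ∈-resp o' o (occ-unique (≺-trans xy yz) o' o x∈' (extend-up o' x∈' y∈' xy yz) x∈ z∈) y∈'

  -- The occurrence through `c` and `l` starts at `c`. If `l` is its second entry, the third one
  -- forces `p` into it; otherwise its second entry, compared with `e` in position, forces `p` or
  -- `e` into it. But `p` is incomparable to `c`, and `e` to `l`.
  avoids-3412 : ∀ {c p e l} → (∀ {x} → ¬ (x ≺ c)) → c <ᶠ p → w ∙ c <ᶠ w ∙ p → e <ᶠ l → w ∙ e <ᶠ w ∙ l →
    c ≺ l → p ≺ e → p ≺ l → ⊥
  avoids-3412 {c} {p} {e} {l} c-min c<p wc<wp e<l we<wl cl pe pl with h c l cl
  ... | o@(q , _) , (Fin.suc s , refl) , _ , _ = c-min (chain o {0F} {Fin.suc s} (s≤s z≤n))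
  ... | o@(q , _) , (0F , refl) , (0F , refl) , _ = n≮n _ (proj₁ cl)
  ... | o@(q , _) , c∈@(0F , refl) , l∈@(1F , refl) , _ =
    let m' = 2F
        p∈ = extend-down o l∈ (m' , refl) pl (chain o {1F} {m'} (s≤s (s≤s z≤n)))
    in <-asym wc<wp (comparable o c∈ p∈ c<p)
  ... | o@(q , _) , c∈@(0F , refl) , l∈@(Fin.suc (Fin.suc t) , refl) , _ = go (Finₚ.<-cmp m e)
    where
    i₁ : Fin k
    i₁ = 1F
    m = q i₁
    cm : q 0F ≺ m
    cm = chain o (s≤s z≤n)
    ml : m ≺ q (Fin.suc (Fin.suc t))
    ml = chain o (s≤s (s≤s z≤n))
    go : _ → ⊥
    go (tri< m<e _ _) = <-asym we<wl (comparable o (extend-up o c∈ (i₁ , refl) cm (m<e , <-trans we<wl (proj₂ ml))) l∈ e<l)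
    go (tri≈ _ refl _) = <-asym we<wl (proj₂ ml)
    go (tri> _ _ e<m) = <-asym wc<wp (comparable o c∈ (extend-down o (i₁ , refl) l∈ (<-trans (proj₁ pe) e<m , <-trans (proj₂ cm) wc<wp) ml) c<p)

  module Leftmost (x₀ : Fin n) (fw : FixesBelow (toℕ x₀) w) (moved : w ∙ x₀ ≢ x₀) where

    c : ℕ
    c = toℕ x₀

    e : Fin n
    e = w ∙⁻¹ x₀

    we : w ∙ e ≡ x₀
    we = inverseʳ w

    fw⁻¹ : FixesBelow c (flip w)
    fw⁻¹ {x} lt = trans (cong (w ∙⁻¹_) (sym (fw lt))) (inverseˡ w)

    x₀<wx₀ : x₀ <ᶠ w ∙ x₀
    x₀<wx₀ = ≤∧≢⇒< (FixesBelow-≥ w fw ≤-refl) (λ r → moved (sym (toℕ-injective r)))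

    x₀<e : x₀ <ᶠ e
    x₀<e = ≤∧≢⇒< (FixesBelow-≥ (flip w) fw⁻¹ ≤-refl) (λ r → moved (trans (cong (w ∙_) (toℕ-injective r)) we))

    x₀≺e : x₀ ≺ e
    x₀≺e = x₀<e , subst (_<ᶠ w ∙ x₀) (sym we) x₀<wx₀

    x₀-min : ∀ {x} → ¬ (x ≺ x₀)
    x₀-min (x<x₀ , lt) = <-asym x₀<wx₀ (<-trans (subst (w ∙ x₀ <ᶠ_) (fw x<x₀) lt) x<x₀)

    e-max : ∀ {x} → ¬ (e ≺ x)
    e-max {x} (e<x , lt) =
      let wx<x₀ = subst (w ∙ x <ᶠ_) we lt
          x≡wx = trans (sym (inverseˡ w)) (fw⁻¹ wx<x₀)
      in <-asym (<-trans x₀<e e<x) (subst (_<ᶠ x₀) (sym x≡wx) wx<x₀)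

    -- If this failed for `w` and for its inverse, the two failures would form a pattern 3412
    -- starting at `x₀`.
    NoLow : Set
    NoLow = ∀ {l} → e <ᶠ l → w ∙ l <ᶠ w ∙ x₀ → ⊥

    low⇒no-high : ∀ {l p} → e <ᶠ l → w ∙ l <ᶠ w ∙ x₀ → x₀ <ᶠ p → p <ᶠ e → w ∙ x₀ <ᶠ w ∙ p → ⊥
    low⇒no-high {l} {p} e<l wl<wx₀ x₀<p p<e wx₀<wp = avoids-3412 x₀-min x₀<p wx₀<wp e<l
      (subst (_<ᶠ w ∙ l) (sym we) (≤∧≢⇒< (FixesBelow-≥ w fw (<⇒≤ x₀<l)) λ r → <⇒≢ᶠ e<l (∙-inj w (trans we (toℕ-injective r)))))
      (x₀<l , wl<wx₀) (p<e , subst (_<ᶠ w ∙ p) (sym we) (<-trans x₀<wx₀ wx₀<wp)) (<-trans p<e e<l , <-trans wl<wx₀ wx₀<wp)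
      where
      x₀<l = <-trans x₀<e e<l

    module _ (no-low : NoLow) where
      private
        o = proj₁ (h x₀ e x₀≺e)
        p = proj₁ o
        x₀∈ = proj₁ (proj₂ (h x₀ e x₀≺e))
        e∈ = proj₁ (proj₂ (proj₂ (h x₀ e x₀≺e)))
        last : Fin k
        last = opposite 0F

      p0 : p 0F ≡ x₀
      p0 with x₀∈
      ... | 0F , r = r
      ... | Fin.suc a , r = contradiction (subst (p 0F ≺_) r (chain o {0F} {Fin.suc a} (s≤s z≤n))) x₀-min

      p-last : p last ≡ e
      p-last = at (proj₁ e∈ ≟ᶠ last)
        where
        at : Dec (proj₁ e∈ ≡ last) → p last ≡ e
        at (yes r) = trans (cong p (sym r)) (proj₂ e∈)
        at (no r) = ⊥-elim (e-max (subst (_≺ p last) (proj₂ e∈) (chain o (≤∧≢⇒< le (λ q → r (toℕ-injective q))))))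
          where
          le : toℕ (proj₁ e∈) ≤ toℕ last
          le = subst (toℕ (proj₁ e∈) ≤_) (sym (Finₚ.opposite-prop {k} 0F)) (s≤s⁻¹ (toℕ<n (proj₁ e∈)))

      w-plast : toℕ (w ∙ p last) ≡ c
      w-plast = cong toℕ (trans (cong (w ∙_) p-last) we)

      -- By `no-low` such a point lies between `x₀` and `e` in position as well, so that
      -- `extend-middle` applies.
      values-covered : ∀ {x} → c ≤ toℕ (w ∙ x) → toℕ (w ∙ x) ≤ toℕ (w ∙ x₀) → InOcc w x o
      values-covered {x} lo hi = at (x ≟ᶠ x₀) (Finₚ.<-cmp x e)
        where
        at : Dec (x ≡ x₀) → _ → InOcc w x o
        at (yes refl) _ = x₀∈
        at (no _) (tri≈ _ refl _) = e∈
        at (no r) (tri> _ _ e<x) = ⊥-elim (no-low e<x (≤∧≢⇒< hi λ q → r (∙-inj w (toℕ-injective q))))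
        at (no r) (tri< x<e x≢e _) = extend-middle o x₀∈ e∈
          (≤∧≢⇒< x≥c (λ q → r (sym (toℕ-injective q))) , ≤∧≢⇒< hi λ q → r (∙-inj w (toℕ-injective q)))
          (x<e , subst (_<ᶠ w ∙ x) (sym we) (≤∧≢⇒< lo λ q → x≢e (∙-inj w (trans (sym (toℕ-injective q)) (sym we)))))
          where
          x≥c : c ≤ toℕ x
          x≥c = subst (λ y → c ≤ toℕ y) (inverseˡ w) (FixesBelow-≥ (flip w) fw⁻¹ lo)

      value : ∀ a → toℕ (w ∙ p (opposite a)) ≡ c + toℕ a
      value a = trans (consecutive (λ a → toℕ (w ∙ p (opposite a))) (λ lt → proj₂ (chain o (opposite-< lt))) closed a) (cong (_+ toℕ a) w-plast)
        where
        ≤top : ∀ b → toℕ (w ∙ p b) ≤ toℕ (w ∙ x₀)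
        ≤top 0F = ≤-reflexive (cong (toℕ ∘ (w ∙_)) p0)
        ≤top (Fin.suc b) = ≤-trans (<⇒≤ (proj₂ (chain o {0F} {Fin.suc b} (s≤s z≤n)))) (≤-reflexive (cong (toℕ ∘ (w ∙_)) p0))
        closed : ∀ y b → toℕ (w ∙ p last) ≤ y → y ≤ toℕ (w ∙ p (opposite b)) → ∃ λ a → toℕ (w ∙ p (opposite a)) ≡ y
        closed y b lo hi =
          let y<n = ≤-<-trans hi (toℕ<n _)
              wx = inverseʳ w {fromℕ< y<n}
              toℕwx = trans (cong toℕ wx) (toℕ-fromℕ< y<n)
              a , r = values-covered {w ∙⁻¹ fromℕ< y<n} (≤-trans (≤-reflexive (sym w-plast)) (≤-trans lo (≤-reflexive (sym toℕwx))))
                        (≤-trans (≤-reflexive toℕwx) (≤-trans hi (≤top _)))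
          in opposite a , trans (cong (λ b → toℕ (w ∙ p b)) (Finₚ.opposite-involutive a)) (trans (cong (λ x → toℕ (w ∙ x)) r) toℕwx)

      -- The last index is left out, since `e` may lie far to the right. A skipped position holds
      -- either a value covered above or one exceeding that of `x₀`; in the latter case it starts a
      -- decreasing sequence with two later entries, and `extend-down` applies.
      position : ∀ (a : Fin (2 + K)) → toℕ (p (inject₁ a)) ≡ c + toℕ a
      position a = trans (consecutive (λ a → toℕ (p (inject₁ a))) (λ {a} {b} lt → proj₁ (chain o (inject-< lt))) closed a) (cong (λ x → toℕ x + toℕ a) p0)
        where
        inject-< : ∀ {a b : Fin (2 + K)} → a <ᶠ b → inject₁ a <ᶠ inject₁ b
        inject-< {a} {b} = subst₂ _<_ (sym (Finₚ.toℕ-inject₁ a)) (sym (Finₚ.toℕ-inject₁ b))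
        inject-last : ∀ (b : Fin (2 + K)) → inject₁ b <ᶠ last
        inject-last b = subst₂ _<_ (sym (Finₚ.toℕ-inject₁ b)) (sym (Finₚ.opposite-prop {k} 0F)) (toℕ<n b)
        closed : ∀ y b → toℕ (p 0F) ≤ y → y ≤ toℕ (p (inject₁ b)) → ∃ λ a → toℕ (p (inject₁ a)) ≡ y
        closed y b lo hi = go (x ≟ᶠ z)
          where
          y<n = ≤-<-trans hi (toℕ<n _)
          x = fromℕ< y<n
          tx : toℕ x ≡ y
          tx = toℕ-fromℕ< y<n
          z = p (inject₁ b)
          c≤x : c ≤ toℕ x
          c≤x = subst₂ _≤_ (cong toℕ p0) (sym tx) lo
          z≺e : z ≺ p last
          z≺e = chain o (inject-last b)
          wz≤ : toℕ (w ∙ z) ≤ toℕ (w ∙ x₀)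
          wz≤ = ≤-trans (at (inject₁ b)) (≤-reflexive (cong (toℕ ∘ (w ∙_)) p0))
            where
            at : ∀ b → toℕ (w ∙ p b) ≤ toℕ (w ∙ p 0F)
            at 0F = ≤-refl
            at (Fin.suc b) = <⇒≤ (proj₂ (chain o {0F} {Fin.suc b} (s≤s z≤n)))
          x∈ : x <ᶠ z → InOcc w x o
          x∈ x<z with toℕ (w ∙ x) ≤? toℕ (w ∙ x₀)
          ... | yes le = values-covered (FixesBelow-≥ w fw c≤x) le
          ... | no gt = extend-down o (inject₁ b , refl) (last , refl) (x<z , ≤-<-trans wz≤ (≰⇒> gt)) z≺e
          go : Dec (x ≡ z) → ∃ λ a → toℕ (p (inject₁ a)) ≡ y
          go (yes r) = b , trans (cong toℕ (sym r)) tx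
          go (no r) with x∈ (≤∧≢⇒< (subst (_≤ toℕ z) (sym tx) hi) (λ q → r (toℕ-injective q)))
          ... | a , q = Fin.lower₁ a ne , trans (cong toℕ (trans (cong p (Finₚ.inject₁-lower₁ a ne)) q)) tx
            where
            a<b : a <ᶠ inject₁ b
            a<b = chain-<⁻¹ (chain o) (subst (_<ᶠ z) (sym q) (≤∧≢⇒< (subst (_≤ toℕ z) (sym tx) hi) (λ q → r (toℕ-injective q))))
            ne : 2 + K ≢ toℕ a
            ne s = <⇒≢ (<-trans a<b (subst (toℕ (inject₁ b) <_) (Finₚ.opposite-prop {k} 0F) (inject-last b))) (sym s)

      fits : c + suc (2 + K) ≤ n
      fits = subst (_≤ n) (trans (cong suc (value last)) (trans (cong (λ m → suc (c + m)) (Finₚ.opposite-prop {k} 0F)) (sym (+-suc c (2 + K))))) (toℕ<n _)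

      open Interval c (2 + K) fits using (emb; toℕ-emb)

      reversed : ∀ a → toℕ a < 2 + K → w ∙ emb a ≡ emb (opposite a)
      reversed a lt = toℕ-injective (trans (cong (λ x → toℕ (w ∙ x)) emb≡) (trans (trans (cong (λ b → toℕ (w ∙ p b)) (sym (Finₚ.opposite-involutive a))) (value (opposite a))) (sym (toℕ-emb (opposite a)))))
        where
        ne : 2 + K ≢ toℕ a
        ne s = <⇒≢ lt (sym s)
        a' = Fin.lower₁ a ne
        emb≡ : emb a ≡ p a
        emb≡ = toℕ-injective (trans (toℕ-emb a) (trans (cong (λ b → c + b) (sym (Finₚ.toℕ-lower₁ a ne))) (trans (sym (position a')) (cong (toℕ ∘ p) (Finₚ.inject₁-lower₁ a ne)))))

fixes-all⇒id : ∀ {c} (w : Perm n) → FixesBelow c w → n ≤ c → w ≈ₚ idₚ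
fixes-all⇒id w f le x = f (<-≤-trans (toℕ<n x) le)

FixesBelow-suc : (w : Perm n) (x : Fin n) → FixesBelow (toℕ x) w → w ∙ x ≡ x → FixesBelow (suc (toℕ x)) w
FixesBelow-suc w x f e {y} lt with <-cmp (toℕ y) (toℕ x)
... | tri< l _ _ = f l
... | tri≈ _ r _ rewrite toℕ-injective r = e
... | tri> _ _ l = contradiction lt (≤⇒≯ l)

FixesBelow-flip : ∀ {c} (w : Perm n) → FixesBelow c w → FixesBelow c (flip w)
FixesBelow-flip w f lt = trans (cong (w ∙⁻¹_) (sym (f lt))) (inverseˡ w)

uniqueOcc⇒BlockProduct : ∀ {K} (w : Perm n) → EveryInversionInUniqueOcc w (3 + K) → BlockProduct (2 + K) w
uniqueOcc⇒BlockProduct {n} {K} w h = go n 0 w h (λ ()) (m≤m+n n 0)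
  where
  -- The points below `c` are known to be fixed, and `c` grows in every round, so `n` rounds
  -- suffice.
  go : ∀ fuel c (w : Perm n) → EveryInversionInUniqueOcc w (3 + K) → FixesBelow c w → n ≤ fuel + c → BlockProduct (2 + K) w
  go zero c w h fw le = unit (fixes-all⇒id w fw le)
  go (suc fuel) c w h fw le = at (c <? n)
    where
    le' : ∀ {d} → c < d → n ≤ fuel + d
    le' {d} lt = ≤-trans le (≤-trans (≤-reflexive (sym (+-suc fuel c))) (+-monoʳ-≤ fuel lt))
    strip : (w : Perm n) → EveryInversionInUniqueOcc w (3 + K) → FixesBelow c w → (fits : c + suc (2 + K) ≤ n) →
      (let open Interval c (2 + K) fits using (emb)) → (∀ a → toℕ a < 2 + K → w ∙ emb a ≡ emb (opposite a)) → BlockProduct (2 + K) w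
    strip w h fw fits rev = cons fits rest rest-fixes w≈
      (go fuel (c + (2 + K)) rest (BlockStep.uniqueOcc-w⇒v fits rest w rest-fixes w≈ h) rest-fixes (le' (m<m+n c (s≤s z≤n))))
      where open Strip fits w fw rev
    at : Dec (c < n) → BlockProduct (2 + K) w
    at (no c≮n) = unit (fixes-all⇒id w fw (≮⇒≥ c≮n))
    at (yes c<n) = moved? x₀ refl (w ∙ x₀ ≟ᶠ x₀)
      where
      x₀ = fromℕ< c<n
      moved? : (x : Fin n) → x ≡ x₀ → Dec (w ∙ x ≡ x) → BlockProduct (2 + K) w
      moved? x refl (yes e) = go fuel (suc c) w h (λ {y} lt → FixesBelow-suc w x₀ fx e (subst (λ z → toℕ y < suc z) (sym (toℕ-fromℕ< c<n)) lt)) (le' ≤-refl)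
        where
        fx : FixesBelow (toℕ x₀) w
        fx {y} lt = fw (subst (toℕ y <_) (toℕ-fromℕ< c<n) lt)
      moved? x refl (no ne) = low? (any? λ l → (L.e <ᶠ? l) ×-dec (w ∙ l <ᶠ? w ∙ x₀))
        where
        tx : toℕ x₀ ≡ c
        tx = toℕ-fromℕ< c<n
        fx : FixesBelow (toℕ x₀) w
        fx {y} lt = fw (subst (toℕ y <_) tx lt)
        ne' : flip w ∙ x₀ ≢ x₀
        ne' r = ne (trans (cong (w ∙_) (sym r)) (inverseʳ w))
        module L = UniqueOcc.Leftmost w h x₀ fx ne
        module L' = UniqueOcc.Leftmost (flip w) (uniqueOcc-flip w h) x₀ (FixesBelow-flip w fx) ne'
        low? : Dec (∃ λ l → (L.e <ᶠ l) × (w ∙ l <ᶠ w ∙ x₀)) → BlockProduct (2 + K) w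
        low? (no none) = use {toℕ x₀} tx (L.fits nl) (L.reversed nl)
          where
          nl : L.NoLow
          nl {l} p q = none (l , p , q)
          use : ∀ {c'} → c' ≡ c → (fits : c' + suc (2 + K) ≤ n) → (let open Interval c' (2 + K) fits using (emb)) →
            (∀ a → toℕ a < 2 + K → w ∙ emb a ≡ emb (opposite a)) → BlockProduct (2 + K) w
          use refl = strip w h fw
        low? (yes (l , e<l , wl<wx₀)) = inverse (flip w) (λ _ → refl) (use {toℕ x₀} tx (L'.fits nl) (L'.reversed nl))
          where
          nl : L'.NoLow
          nl {p} b<p lt = L.low⇒no-high e<l wl<wx₀
            (≤∧≢⇒< (FixesBelow-≥ (flip w) (FixesBelow-flip w fx) (<⇒≤ (<-trans L.x₀<wx₀ b<p)))
              (λ r → <⇒≢ᶠ b<p (trans (cong (w ∙_) (toℕ-injective r)) (inverseʳ w))))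
            lt (subst (w ∙ x₀ <ᶠ_) (sym (inverseʳ w)) b<p)
          use : ∀ {c'} → c' ≡ c → (fits : c' + suc (2 + K) ≤ n) → (let open Interval c' (2 + K) fits using (emb)) →
            (∀ a → toℕ a < 2 + K → flip w ∙ emb a ≡ emb (opposite a)) → BlockProduct (2 + K) (flip w)
          use refl = strip (flip w) (uniqueOcc-flip w h) (FixesBelow-flip w fw)

-- From blocks of the support to block products

-- The hypothesis on `E` says that positions before `top` hold values of at most `top`. Under this
-- bound the reversal is already extremal and survives every cover on the way up to `w`.
w₀-ext-reverses : ∀ {c K} (fits : c + suc (2 + K) ≤ n) (let open Interval c (2 + K) fits) {w : Perm n} →
  ext (w₀ k) ≤B w → FixesBelow c w → ¬ E (c + (1 + K)) w → ∀ a → toℕ a < 2 + K → w ∙ emb a ≡ emb (opposite a)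
w₀-ext-reverses {n} {c} {K} fits {w} p fw ne = go p fw ne (λ a _ → ext-emb (w₀ k) a)
  where
  open Interval c (2 + K) fits
  Reverses : Perm n → Set
  Reverses v = ∀ a → toℕ a < 2 + K → v ∙ emb a ≡ emb (opposite a)
  -- Raising the value at emb a is impossible: it stays at most top, and the larger such values sit further left.
  cover-reverses : ∀ {X Z} → X ⊲ Z → FixesBelow c Z → ¬ E (c + (1 + K)) Z → Reverses X → Reverses Z
  cover-reverses {X} {Z} (cover {p} {q} p<q Xp<Xq s _) fz ne rev a a<k' = trans (SwapOf.away s ≢p (λ r → ≢q (sym r))) (rev a a<k')
    where
    top≡ : top ≡ suc (c + (1 + K))
    top≡ = +-suc c (1 + K)
    p-high : ¬ (toℕ p < top)
    p-high p<top = go' (emb-hit p (swap-above p<q Xp<Xq s fz) (<⇒≤ p<top))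
      where
      go' : (∃ λ b → emb b ≡ p) → ⊥
      go' (b , refl) = go'' (emb-hit (X ∙ q) (≤-trans (emb-≥ (opposite b)) (<⇒≤ lt)) Xq≤top)
        where
        b<k' : toℕ b < 2 + K
        b<k' = +-cancelˡ-< c _ _ (subst (_< top) (toℕ-emb b) p<top)
        lt : emb (opposite b) <ᶠ X ∙ q
        lt = subst (_<ᶠ X ∙ q) (rev b b<k') Xp<Xq
        Xq≤top : toℕ (X ∙ q) ≤ top
        Xq≤top = ≮⇒≥ λ l → ne (exceed (emb b) (s≤s⁻¹ (subst (toℕ (emb b) <_) top≡ p<top)) (subst₂ _<_ top≡ (cong toℕ (sym (SwapOf.at-l s))) l))
        go'' : (∃ λ b' → emb b' ≡ X ∙ q) → ⊥
        go'' (b' , r) = <-asym p<q (subst (_<ᶠ emb b) (∙-inj X (trans (rev (opposite b') (<-trans a'<b b<k')) (trans (cong emb (Finₚ.opposite-involutive b')) r))) (emb-< a'<b))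
          where
          a'<b : opposite b' <ᶠ b
          a'<b = subst (opposite b' <ᶠ_) (Finₚ.opposite-involutive b) (opposite-< (emb-<⁻¹ (subst (emb (opposite b) <ᶠ_) (sym r) lt)))
    ea<top : toℕ (emb a) < top
    ea<top = subst (_< top) (sym (toℕ-emb a)) (+-monoʳ-< c a<k')
    ≢p : emb a ≢ p
    ≢p refl = p-high ea<top
    ≢q : q ≢ emb a
    ≢q refl = p-high (<-trans p<q ea<top)
  go : ∀ {X w} → X ≤B w → FixesBelow c w → ¬ E (c + (1 + K)) w → Reverses X → Reverses w
  go (≤B-refl e) fw ne rev a lt = trans (sym (e (emb a))) (rev a lt)
  go (≤B-step {X} {Z} cov p) fw ne rev = go p fw ne (cover-reverses (⋖⇒⊲ X Z cov) (FixesBelow-≤ p fw) (ne ∘ T-mono p) rev)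

FixesBelow⇒¬D : ∀ {d i} {v : Perm n} → FixesBelow d v → D i v → d ≤ i
FixesBelow⇒¬D fv (exceed a a≤i lt) = ≮⇒≥ λ i<d → <⇒≱ lt (subst (λ x → toℕ x ≤ _) (sym (fv (≤-<-trans a≤i i<d))) a≤i)

-- I lists the left ends c of intervals of generators c, …, c + K + 1 that partition the support of w.
record Blocks {n : ℕ} (K : ℕ) (I : ℕ → Set) (w : Perm n) : Set where
  field
    fits     : ∀ {c} → I c → c + suc (2 + K) ≤ n
    longest≤ : ∀ {c} (p : I c) → Interval.ext c (2 + K) (fits p) (w₀ (3 + K)) ≤B w
    end      : ∀ {c} → I c → E (c + (1 + K)) w → ¬ E (c + (1 + K)) (flip w)
    separate : ∀ {c c'} → I c → I c' → c < c' → c + (2 + K) ≤ c'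
    covers   : ∀ {i} → D i w → ∃ λ c → I c × (c ≤ i) × (i < c + (2 + K))

Blocks-flip : ∀ {K I} {w : Perm n} → Blocks K I w → Blocks K I (flip w)
Blocks-flip {K = K} {w = w} b = record
  { fits = fits
  ; longest≤ = λ {c} p → let u = Interval.ext c (2 + K) (fits p) (w₀ (3 + K)) in ≤B-respˡ {v = flip u} {u} (λ _ → refl) (≤B-flip (longest≤ p))
  ; end = λ p e e' → end p (T-cong {v = flip (flip w)} {w} (λ _ → refl) e') e
  ; separate = separate
  ; covers = λ d → covers (flip-D d) }
  where open Blocks b

Blocks-rest : ∀ {K I c} {w v : Perm n} (b : Blocks K I w) (Ic : I c) → FixesBelow (c + (2 + K)) v →
  w ≈ₚ (v ∘ₚ Interval.ext c (2 + K) (Blocks.fits b Ic) (w₀ (3 + K))) → Blocks K (λ c' → I c' × c + (2 + K) ≤ c') v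
Blocks-rest {n} {K} {I} {c} {w} {v} b Ic fv w≈ = record
  { fits = λ (p , _) → fits p
  ; longest≤ = λ (p , le) → below p le
  ; end = λ {c'} (p , le) e e' → end p (E-w (≤-trans le (m≤m+n c' _)) e) (E-flip-w (≤-trans le (m≤m+n c' _)) e')
  ; separate = λ (p , _) (q , _) → separate p q
  ; covers = λ {i} dv →
      let d≤i = FixesBelow⇒¬D fv dv
          c' , p , c'≤i , i<c' = covers (T-w ≤-refl d≤i dv)
      in c' , (p , after {i} p d≤i c'≤i i<c') , c'≤i , i<c' }
  where
  open Blocks b
  d = c + (2 + K)
  open Interval c (2 + K) (fits Ic) using (ext; ext-above; ext-below)
  u = ext (w₀ (3 + K))
  T-w : ∀ {i j} → i ≤ j → d ≤ i → T i j v → T i j w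
  T-w i≤j d≤i (exceed a a≤i lt) = exceed a a≤i (subst (λ x → _ < toℕ x) (sym (trans (w≈ a) (ext-above (w₀ (3 + K)) (≤-<-trans (≤-trans d≤i i≤j) lt)))) lt)
  E-w : ∀ {i} → d ≤ i → E i v → E i w
  E-w = T-w (n≤1+n _)
  E-flip-w : ∀ {i} → d ≤ i → E i (flip v) → E i (flip w)
  E-flip-w {i} d≤i (exceed a a≤i lt) = exceed (u ∙ a) ua≤i (subst (λ x → suc i < toℕ x) (trans (sym (inverseˡ w)) (cong (w ∙⁻¹_) (trans (w≈ _) (cong (u ∙_) (inverseʳ v))))) lt)
    where
    ua≤i : toℕ (u ∙ a) ≤ i
    ua≤i = at (toℕ a ≤? d)
      where
      at : Dec (toℕ a ≤ d) → toℕ (u ∙ a) ≤ i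
      at (yes le) = ≤-trans (FixesAbove-stable u (ext-above (w₀ (3 + K))) le) d≤i
      at (no gt) = subst (λ x → toℕ x ≤ i) (sym (ext-above (w₀ (3 + K)) (≰⇒> gt))) a≤i
  after : ∀ {i c'} → I c' → d ≤ i → c' ≤ i → i < c' + (2 + K) → d ≤ c'
  after {i} {c'} p d≤i c'≤i i<c' with <-cmp c c'
  ... | tri< l _ _ = separate Ic p l
  ... | tri≈ _ refl _ = contradiction d≤i (<⇒≱ i<c')
  ... | tri> _ _ l = contradiction (≤-trans (separate p Ic l) (≤-trans (m≤m+n c _) d≤i)) (<⇒≱ i<c')
  -- The later longest element fixes the points below `d`, so by uniqueness its factors are the
  -- identity and itself.
  below : ∀ {c'} (p : I c') → d ≤ c' → Interval.ext c' (2 + K) (fits p) (w₀ (3 + K)) ≤B v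
  below {c'} p d≤c' = ≤B-respˡ {v = F.v'} {X} (λ x → sym (proj₂ same x)) F.v'≤v
    where
    X = Interval.ext c' (2 + K) (fits p) (w₀ (3 + K))
    module F = Factors (factors {u = u} {v} (ext-above (w₀ (3 + K))) fv (longest≤ p) w≈)
    same = factorization-unique {u = idₚ} {X} {F.u'} {F.v'} (λ _ → refl)
      (λ lt → Interval.ext-below c' (2 + K) (fits p) (w₀ (3 + K)) (<-≤-trans lt d≤c')) F.fu' F.fv' F.eq

Blocks⇒BlockProduct : ∀ {K I} (w : Perm n) → Blocks K I w → BlockProduct (2 + K) w
Blocks⇒BlockProduct {n} {K} {I} w b = go n 0 w b (λ ()) (m≤m+n n 0)
  where
  go : ∀ fuel c {I} (w : Perm n) → Blocks K I w → FixesBelow c w → n ≤ fuel + c → BlockProduct (2 + K) w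
  go zero c w b fw le = unit (fixes-all⇒id w fw le)
  go (suc fuel) c {I} w b fw le = at (c <? n)
    where
    le' : ∀ {d} → c < d → n ≤ fuel + d
    le' {d} lt = ≤-trans le (≤-trans (≤-reflexive (sym (+-suc fuel c))) (+-monoʳ-≤ fuel lt))
    at : Dec (c < n) → BlockProduct (2 + K) w
    at (no c≮n) = unit (fixes-all⇒id w fw (≮⇒≥ c≮n))
    at (yes c<n) = moved? (w ∙ x₀ ≟ᶠ x₀)
      where
      x₀ = fromℕ< c<n
      tx : toℕ x₀ ≡ c
      tx = toℕ-fromℕ< c<n
      fx : FixesBelow (toℕ x₀) w
      fx {y} lt = fw (subst (toℕ y <_) tx lt)
      moved? : Dec (w ∙ x₀ ≡ x₀) → BlockProduct (2 + K) w
      moved? (yes e) = go fuel (suc c) w b (λ {y} lt → FixesBelow-suc w x₀ fx e (subst (λ z → toℕ y < suc z) (sym tx) lt)) (le' ≤-refl)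
      moved? (no ne) = first (Blocks.covers b (exceed x₀ (≤-reflexive tx) (subst (_< toℕ (w ∙ x₀)) tx
                              (≤∧≢⇒< (FixesBelow-≥ w fx ≤-refl) (λ r → ne (sym (toℕ-injective r)))))))
        where
        first : (∃ λ c' → I c' × (c' ≤ c) × (c < c' + (2 + K))) → BlockProduct (2 + K) w
        first (c' , p , c'≤c , _) = at-c c'≡c p
          where
          open Blocks b
          -- An interval starting before `c` would have a longest element that moves a point fixed
          -- by `w`.
          c'≡c : c' ≡ c
          c'≡c = decidable-stable (c' ≟ c) λ ne' →
            let open Interval c' (2 + K) (fits p)
                e0<c = subst (_< c) (sym (trans (toℕ-emb Fin.zero) (+-identityʳ c'))) (≤∧≢⇒< c'≤c ne')
                e = emb-inj (trans (sym (ext-emb (w₀ k) Fin.zero)) (FixesBelow-≤ (longest≤ p) fw e0<c))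
            in 1+n≢0 (trans (sym (Finₚ.opposite-prop {k} Fin.zero)) (cong toℕ e))
          at-c : ∀ {c'} → c' ≡ c → I c' → BlockProduct (2 + K) w
          at-c refl p = end? (T? (c + (1 + K)) (suc (c + (1 + K))) w)
            where
            strip : (w : Perm n) (b : Blocks K I w) → FixesBelow c w → ¬ E (c + (1 + K)) w → BlockProduct (2 + K) w
            strip w b fw ne = cons (Blocks.fits b p) rest rest-fixes w≈
                (go fuel (c + (2 + K)) rest (Blocks-rest {w = w} {rest} b p rest-fixes w≈) rest-fixes (le' (m<m+n c (s≤s z≤n))))
              where open Strip (Blocks.fits b p) w fw (w₀-ext-reverses (Blocks.fits b p) (Blocks.longest≤ b p) fw ne)
            end? : Dec (E (c + (1 + K)) w) → BlockProduct (2 + K) w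
            end? (no ne) = strip w b fw ne
            end? (yes e) = inverse (flip w) (λ _ → refl) (strip (flip w) (Blocks-flip b) (FixesBelow-flip w fw) (end p e))

-- The second level of the Bruhat order

gen-cong : ∀ {i j} → i ≡ j → (p : suc i < n) (q : suc j < n) → gen p ≈ₚ gen q
gen-cong {n} refl p q x = cong (λ l → gen {n} l ∙ x) (≤-irrelevant p q)

-- Either `p` is raised, or w q < w p ≤ p < q, so that the value at `q` sits to the right of its own
-- place.
inversion⇒D : {w : Perm n} {p q : Fin n} → IsInversion w p q → ∃ λ (m : Fin n) → D (toℕ m) w
inversion⇒D {w = w} {p} {q} (p<q , wq<wp) with toℕ p <? toℕ (w ∙ p)
... | yes lt = p , exceed p ≤-refl lt
... | no nlt = w ∙ q , flip-D (exceed (w ∙ q) ≤-refl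
      (<-trans (<-≤-trans wq<wp (≮⇒≥ nlt)) (subst (toℕ p <_) (cong toℕ (sym (inverseˡ w))) p<q)))

D⇒suc< : ∀ {i} {w : Perm n} → D i w → suc i < n
D⇒suc< (exceed a _ lt) = ≤-<-trans lt (toℕ<n _)

¬D⇒FixesBelow : ∀ {c} (w : Perm n) → (∀ {i} → i < c → ¬ D i w) → FixesBelow c w
¬D⇒FixesBelow w none {x} x<c = toℕ-injective (≤-antisym wx≤x (subst (λ y → toℕ y ≤ toℕ (w ∙ x)) (inverseˡ w)
    (≮⇒≥ λ lt → none (≤-<-trans wx≤x x<c) (flip-D (exceed (w ∙ x) ≤-refl lt)))))
  where
  wx≤x : toℕ (w ∙ x) ≤ toℕ x
  wx≤x = ≮⇒≥ λ lt → none x<c (exceed x ≤-refl lt)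

¬D⇒FixesAbove : ∀ {d} (w : Perm n) → (∀ {i} → d ≤ i → ¬ D i w) → FixesAbove d w
¬D⇒FixesAbove {n} {d} w none {x} d<x = toℕ-injective (≤-antisym (≮⇒≥ λ lt → none (<⇒≤ d<x) (exceed x ≤-refl lt)) (≮⇒≥ (lem (toℕ x) refl d<x)))
  where
  lem : ∀ x' → x' ≡ toℕ x → d < x' → ¬ (toℕ (w ∙ x) < toℕ x)
  lem (suc i) e d<x' lt = none (s≤s⁻¹ d<x') (flip-D (exceed (w ∙ x) (s≤s⁻¹ (subst (toℕ (w ∙ x) <_) (sym e) lt))
    (≤-reflexive (trans e (cong toℕ (sym (inverseˡ w)))))))

E⇒D-suc : ∀ {i} {w : Perm n} → E i w → D (suc i) w
E⇒D-suc (exceed a a≤i lt) = exceed a (≤-trans a≤i (n≤1+n _)) lt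

E⇒D : ∀ {i} {w : Perm n} → E i w → D i w
E⇒D (exceed a a≤i lt) = exceed a a≤i (<-trans ≤-refl lt)

-- The cover swaps neighbours, since every generator across which it reaches enters the support.
cover-over-gen : ∀ {i j} (li : suc i < n) (lj : suc j < n) {Y : Perm n} → i ≢ j → i ≢ suc j → j ≢ suc i →
  gen li ⊲ Y → (∀ {l} → D l Y → (l ≡ i) ⊎ (l ≡ j)) → Y ≈ₚ swap (lo lj) (hi lj) (gen li)
cover-over-gen {n} {i} {j} li lj {Y} i≢j i≢sj j≢si cov@(cover {p} {q} p<q sp<sq s none) supp = SwapOf⇒gen lj {gen li} {Y} p≡j q≡ s
  where
  reach : ∀ {l} → toℕ p ≤ l → l < toℕ q → (l ≡ i) ⊎ (l ≡ j)
  reach {l} p≤l l<q = at (l ≟ i) (q ≟ᶠ hi li) (q ≟ᶠ lo li)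
    where
    via : l < toℕ (gen li ∙ q) → (l ≡ i) ⊎ (l ≡ j)
    via lt = supp (exceed p p≤l (subst (λ y → l < toℕ y) (sym (SwapOf.at-l s)) lt))
    at : Dec (l ≡ i) → Dec (q ≡ hi li) → Dec (q ≡ lo li) → (l ≡ i) ⊎ (l ≡ j)
    at (yes e) _ _ = inj₁ e
    at (no l≢i) (yes refl) _ = via (subst (λ y → l < toℕ y) (sym (swap-r idₚ (lo li) (hi li)))
      (subst (l <_) (sym (toℕ-lo li)) (≤∧≢⇒< (s≤s⁻¹ (subst (l <_) (toℕ-hi li) l<q)) l≢i)))
    at (no _) (no _) (yes refl) = via (subst (λ y → l < toℕ y) (sym (swap-l idₚ (lo li) (hi li))) (<-trans l<q (lo<hi li)))
    at (no _) (no a) (no b) = via (subst (λ y → l < toℕ y) (sym (swap-o idₚ (lo li) (hi li) b a)) l<q)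
  q≡sp : toℕ q ≡ suc (toℕ p)
  q≡sp with toℕ q ≟ suc (toℕ p)
  ... | yes e = e
  ... | no ne with reach ≤-refl p<q | reach (n≤1+n _) (≤∧≢⇒< p<q (λ e → ne (sym e)))
  ...   | inj₁ a | inj₁ b = contradiction (trans b (sym a)) 1+n≢n
  ...   | inj₂ a | inj₂ b = contradiction (trans b (sym a)) 1+n≢n
  ...   | inj₁ a | inj₂ b = contradiction (trans (sym b) (cong suc a)) j≢si
  ...   | inj₂ a | inj₁ b = contradiction (trans (sym b) (cong suc a)) i≢sj
  p≡j : toℕ p ≡ j
  p≡j with reach ≤-refl p<q
  ... | inj₂ e = e
  ... | inj₁ e = contradiction sp<sq (<-asym (subst₂ _<ᶠ_
        (sym (trans (cong (gen li ∙_) q≡hi) (swap-r idₚ (lo li) (hi li)))) (sym (trans (cong (gen li ∙_) p≡lo) (swap-l idₚ (lo li) (hi li)))) (lo<hi li)))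
    where
    p≡lo : p ≡ lo li
    p≡lo = toℕ-injective (trans e (sym (toℕ-lo li)))
    q≡hi : q ≡ hi li
    q≡hi = toℕ-injective (trans q≡sp (trans (cong suc e) (sym (toℕ-hi li))))
  q≡ : toℕ q ≡ suc j
  q≡ = trans q≡sp (cong suc p≡j)

-- y₁ = s_m s_(m+1) and y₂ = s_(m+1) s_m, both obtained by a cover from s = s_m.
module ConsecutiveGens {k m : ℕ} (l₁ : suc m < k) (l₂ : suc (suc m) < k) where

  s y₁ y₂ : Perm k
  s = gen l₁
  y₁ = swap (lo l₂) (hi l₂) s
  y₂ = swap (lo l₁) (hi l₂) s

  lo₂≡hi₁ : lo l₂ ≡ hi l₁
  lo₂≡hi₁ = toℕ-injective (trans (toℕ-lo l₂) (sym (toℕ-hi l₁)))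

  hi₁<hi₂ : hi l₁ <ᶠ hi l₂
  hi₁<hi₂ = subst (_<ᶠ hi l₂) lo₂≡hi₁ (lo<hi l₂)

  lo₁<hi₂ : lo l₁ <ᶠ hi l₂
  lo₁<hi₂ = <-trans (lo<hi l₁) hi₁<hi₂

  s-lo₁ : s ∙ lo l₁ ≡ hi l₁
  s-lo₁ = swap-l idₚ (lo l₁) (hi l₁)

  s-hi₁ : s ∙ hi l₁ ≡ lo l₁
  s-hi₁ = swap-r idₚ (lo l₁) (hi l₁)

  s-hi₂ : s ∙ hi l₂ ≡ hi l₂
  s-hi₂ = swap-o idₚ (lo l₁) (hi l₁) (≢-sym (<⇒≢ᶠ lo₁<hi₂)) (≢-sym (<⇒≢ᶠ hi₁<hi₂))

  s⊲y₁ : s ⊲ y₁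
  s⊲y₁ = swap-gen-⊲ s l₂ (subst₂ _<ᶠ_ (sym (trans (cong (s ∙_) lo₂≡hi₁) s-hi₁)) (sym s-hi₂) lo₁<hi₂)

  s⊲y₂ : s ⊲ y₂
  s⊲y₂ = cover lo₁<hi₂ (subst₂ _<ᶠ_ (sym s-lo₁) (sym s-hi₂) hi₁<hi₂) (swap-SwapOf s (lo l₁) (hi l₂)) none
    where
    none : ∀ a → ¬ Between s (lo l₁) (hi l₂) a
    none a ((lo<a , a<hi) , (p , _)) = <-asym p (subst₂ _<ᶠ_ (sym (trans (cong (s ∙_) a≡) s-hi₁)) (sym s-lo₁) (lo<hi l₁))
      where
      a≡ : a ≡ hi l₁
      a≡ = toℕ-injective (≤-antisym (s≤s⁻¹ (subst (toℕ a <_) (trans (toℕ-hi l₂) (cong suc (sym (toℕ-hi l₁)))) a<hi))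
                                    (subst (_≤ toℕ a) (trans (cong suc (toℕ-lo l₁)) (sym (toℕ-hi l₁))) lo<a))

  supp-y₁ : ∀ {l} → D l y₁ → (l ≡ m) ⊎ (l ≡ suc m)
  supp-y₁ d = [ (λ d' → inj₁ (D-gen⇒≡ l₁ d')) , inj₂ ]′ (D-swap⇒ {v = s} l₂ d)

  supp-y₂ : ∀ {l} → D l y₂ → (l ≡ m) ⊎ (l ≡ suc m)
  supp-y₂ {l} (exceed a a≤l lt) = at (a ≟ᶠ lo l₁) (a ≟ᶠ hi l₁) (a ≟ᶠ hi l₂)
    where
    at : Dec (a ≡ lo l₁) → Dec (a ≡ hi l₁) → Dec (a ≡ hi l₂) → (l ≡ m) ⊎ (l ≡ suc m)
    at (yes refl) _ _ = range (l ≟ m)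
      where
      m≤l : m ≤ l
      m≤l = subst (_≤ l) (toℕ-lo l₁) a≤l
      l≤sm : l ≤ suc m
      l≤sm = s≤s⁻¹ (subst (l <_) (trans (cong toℕ (trans (swap-l s (lo l₁) (hi l₂)) s-hi₂)) (toℕ-hi l₂)) lt)
      range : Dec (l ≡ m) → (l ≡ m) ⊎ (l ≡ suc m)
      range (yes e) = inj₁ e
      range (no ne) = inj₂ (≤-antisym l≤sm (≤∧≢⇒< m≤l (λ e → ne (sym e))))
    at (no _) (yes refl) _ = contradiction (<-≤-trans (subst (λ y → l < toℕ y)
      (trans (swap-o s (lo l₁) (hi l₂) (≢-sym (<⇒≢ᶠ (lo<hi l₁))) (<⇒≢ᶠ hi₁<hi₂)) s-hi₁) lt) (<⇒≤ (lo<hi l₁))) (≤⇒≯ a≤l)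
    at (no _) (no _) (yes refl) = contradiction (<-≤-trans (subst (λ y → l < toℕ y) (trans (swap-r s (lo l₁) (hi l₂)) s-lo₁) lt) (<⇒≤ hi₁<hi₂)) (≤⇒≯ a≤l)
    at (no a≢lo) (no a≢hi) (no a≢hi₂) = contradiction (subst (λ y → l < toℕ y)
      (trans (swap-o s (lo l₁) (hi l₂) a≢lo a≢hi₂) (swap-o idₚ (lo l₁) (hi l₁) a≢lo a≢hi)) lt) (≤⇒≯ a≤l)

  y₁≉y₂ : ¬ (y₁ ≈ₚ y₂)
  y₁≉y₂ e = <⇒≢ᶠ hi₁<hi₂ (trans (sym (trans (swap-o s (lo l₂) (hi l₂) (<⇒≢ᶠ (subst (lo l₁ <ᶠ_) (sym lo₂≡hi₁) (lo<hi l₁))) (<⇒≢ᶠ lo₁<hi₂)) s-lo₁))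
                (trans (e (lo l₁)) (trans (swap-l s (lo l₁) (hi l₂)) s-hi₂)))

-- An injective sequence with steps of size one cannot turn, so its image is an interval. It is
-- applied to the indices of the generators matched to s_0, s_1, ... of one factor.
module Path (N' : ℕ) (f : (m : ℕ) → m < 2 + N' → ℕ)
  (adjacent : ∀ m l₁ l₂ → (f (suc m) l₂ ≡ suc (f m l₁)) ⊎ (f m l₁ ≡ suc (f (suc m) l₂)))
  (f-inj : ∀ {m m'} l l' → f m l ≡ f m' l' → m ≡ m') where

  N : ℕ
  N = 2 + N'

  f-irr : ∀ {m} (l l' : m < N) → f m l ≡ f m l'
  f-irr {m} l l' = cong (f m) (≤-irrelevant l l')

  private
    l0 : 0 < N
    l0 = s≤s z≤n
    l1 : 1 < N
    l1 = s≤s (s≤s z≤n)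

  IsInterval : ℕ → Set
  IsInterval c = (∀ m l → (c ≤ f m l) × (f m l < c + N)) × (∀ {i} → c ≤ i → i < c + N → ∃ λ m → Σ (m < N) λ l → f m l ≡ i)

  ascending : f 1 l1 ≡ suc (f 0 l0) → IsInterval (f 0 l0)
  ascending e = (λ m l → subst (f 0 l0 ≤_) (sym (closed m l)) (m≤m+n _ m) , subst (_< f 0 l0 + N) (sym (closed m l)) (+-monoʳ-< (f 0 l0) l))
              , λ {i} c≤i i<c+N → i ∸ f 0 l0 , m<n+o⇒m∸n<o i (f 0 l0) i<c+N , trans (closed _ _) (m+[n∸m]≡n c≤i)
    where
    up : ∀ m l₁ l₂ → f (suc m) l₂ ≡ suc (f m l₁)
    up zero l₁ l₂ = trans (f-irr l₂ l1) (trans e (cong suc (f-irr l0 l₁)))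
    up (suc m) l₁ l₂ with adjacent (suc m) l₁ l₂
    ... | inj₁ r = r
    ... | inj₂ r = contradiction (f-inj (<⇒≤ l₁) l₂ (suc-injective (trans (sym (up m (<⇒≤ l₁) l₁)) r))) (λ q → m≢1+m+n m {1} (trans q (cong suc (+-comm 1 m))))
    closed : ∀ m l → f m l ≡ f 0 l0 + m
    closed zero l = trans (f-irr l l0) (sym (+-identityʳ _))
    closed (suc m) l = trans (up m (<⇒≤ l) l) (trans (cong suc (closed m (<⇒≤ l))) (sym (+-suc _ m)))

  descending : f 0 l0 ≡ suc (f 1 l1) → ∃ IsInterval
  descending e = c , (λ m l → +-cancelʳ-≤ m c (f m l) (≤-trans (+-monoʳ-≤ c (s≤s⁻¹ l)) (≤-reflexive (trans (closed last l-last) (sym (closed m l)))))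
                            , ≤-<-trans (≤-trans (m≤m+n _ m) (≤-reflexive (trans (closed m l) (sym (closed last l-last))))) (+-monoʳ-< c ≤-refl))
                 , λ {i} c≤i i<c+N →
                     let i≤f0 = ≤-trans (s≤s⁻¹ (subst (i <_) (+-suc c last) i<c+N)) (≤-reflexive (closed last l-last))
                         lt = m<n+o⇒m∸n<o (f 0 l0) i (≤-<-trans (≤-trans (≤-reflexive (sym (closed last l-last))) (+-monoˡ-≤ last c≤i)) (+-monoʳ-< i ≤-refl))
                     in f 0 l0 ∸ i , lt , +-cancelʳ-≡ (f 0 l0 ∸ i) _ i (trans (closed _ lt) (sym (m+[n∸m]≡n i≤f0)))
    where
    last : ℕ
    last = suc N'
    l-last : last < N
    l-last = ≤-refl
    c = f last l-last
    down : ∀ m l₁ l₂ → f m l₁ ≡ suc (f (suc m) l₂)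
    down zero l₁ l₂ = trans (f-irr l₁ l0) (trans e (cong suc (f-irr l1 l₂)))
    down (suc m) l₁ l₂ with adjacent (suc m) l₁ l₂
    ... | inj₂ r = r
    ... | inj₁ r = contradiction (f-inj (<⇒≤ l₁) l₂ (trans (down m (<⇒≤ l₁) l₁) (sym r))) (λ q → m≢1+m+n m {1} (trans q (cong suc (+-comm 1 m))))
    closed : ∀ m l → f m l + m ≡ f 0 l0
    closed zero l = trans (+-identityʳ _) (f-irr l l0)
    closed (suc m) l = trans (+-suc _ m) (trans (cong (_+ m) (sym (down m (<⇒≤ l) l))) (closed m (<⇒≤ l)))

  abstract
    interval : ∃ IsInterval
    interval with adjacent 0 l0 l1
    ... | inj₁ e = f 0 l0 , ascending e
    ... | inj₂ e = descending e

-- From powers to blocks of the support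

pick : ∀ {A : Set} {k} → Dec A → Perm k → Perm k → Perm k
pick d x y = if does d then x else y

pick-yes : ∀ {A : Set} {k} (d : Dec A) {x y : Perm k} → A → pick d x y ≡ x
pick-yes d a rewrite dec-true d a = refl

pick-no : ∀ {A : Set} {k} (d : Dec A) {x y : Perm k} → ¬ A → pick d x y ≡ y
pick-no d na rewrite dec-false d na = refl

≤-split : {X Y : Perm n} → X ≤B Y → (X ≈ₚ Y) ⊎ Σ (Perm n) λ Z → (X ⊲ Z) × (Z ≤B Y)
≤-split (≤B-refl e) = inj₁ e
≤-split (≤B-step {X} {Z} c p) = inj₂ (Z , ⋖⇒⊲ X Z c , p)

≤id⇒≈id : {x : Perm n} → x ≤B idₚ → x ≈ₚ idₚ
≤id⇒≈id {x = x} p = ≤B-antisym {v = x} {idₚ} p (id-least x)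

module Power {n K r : ℕ} (w : Perm n) (iso : B w ≅ᴾ (B (w₀ (3 + K)) ^ᴾ r)) where

  k : ℕ
  k = 3 + K

  open _≅ᴾ_ iso

  Tuple : Set
  Tuple = Fin r → Perm k

  infix 4 _≤ᵗ_
  _≤ᵗ_ : Tuple → Tuple → Set
  g ≤ᵗ h = ∀ i → g i ≤B h i

  abstract
    -- Everything lies below the longest element, so bare tuples can stand for the elements of the
    -- power.
    elements : Tuple → Carrier (B (w₀ k) ^ᴾ r)
    elements g i = g i , w₀-greatest (g i)

    Φ : Tuple → Perm n
    Φ g = proj₁ (from (elements g))

    Φ≤w : ∀ g → Φ g ≤B w
    Φ≤w g = proj₂ (from (elements g))

    Φ-mono : ∀ {g h} → g ≤ᵗ h → Φ g ≤B Φ h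
    Φ-mono {g} {h} le = to-refl (from (elements g)) (from (elements h)) λ i →
      ≤B-resp₂ {v = g i} {proj₁ (to (from (elements g)) i)} {h i} {proj₁ (to (from (elements h)) i)}
        (λ x → sym (to-from (elements g) i x)) (λ x → sym (to-from (elements h) i x)) (le i)

    Φ-refl : ∀ {g h} → Φ g ≤B Φ h → g ≤ᵗ h
    Φ-refl {g} {h} le i = ≤B-resp₂ {v = proj₁ (to (from (elements g)) i)} {g i} {proj₁ (to (from (elements h)) i)} {h i}
      (to-from (elements g) i) (to-from (elements h) i) (to-mono (from (elements g)) (from (elements h)) le i)

    -- Congruence is not a field of `_≅ᴾ_`; it follows from monotonicity and antisymmetry.
    Φ-cong : ∀ {g h} → (∀ i → g i ≈ₚ h i) → Φ g ≈ₚ Φ h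
    Φ-cong {g} {h} e = ≤B-antisym {v = Φ g} {Φ h} (Φ-mono {g} {h} λ i → ≈⇒≤B (e i)) (Φ-mono {h} {g} λ i → ≈⇒≤B (λ x → sym (e i x)))

    Φ-inj : ∀ {g h} → Φ g ≈ₚ Φ h → ∀ i → g i ≈ₚ h i
    Φ-inj {g} {h} e i = ≤B-antisym {v = g i} {h i} (Φ-refl {g} {h} (≈⇒≤B e) i) (Φ-refl {h} {g} (≈⇒≤B (λ x → sym (e x))) i)

    Ψ : ∀ {X} → X ≤B w → Tuple
    Ψ {X} p i = proj₁ (to (X , p) i)

    ΦΨ : ∀ {X} (p : X ≤B w) → Φ (Ψ p) ≈ₚ X
    ΦΨ {X} p = ≤B-antisym {v = Φ (Ψ p)} {X}
      (to-refl Y (X , p) λ i → ≈⇒≤B (to-from (elements (Ψ p)) i))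
      (to-refl (X , p) Y λ i → ≈⇒≤B (λ x → sym (to-from (elements (Ψ p)) i x)))
      where
        Y : Carrier (B w)
        Y = from (elements (Ψ p))

  Φ≤⇒≤Ψ : ∀ {g X} (p : X ≤B w) → Φ g ≤B X → g ≤ᵗ Ψ p
  Φ≤⇒≤Ψ {g} {X} p le = Φ-refl {g} {Ψ p} (≤B-respʳ {w = X} {Φ (Ψ p)} (λ x → sym (ΦΨ p x)) le)

  ≤Ψ⇒Φ≤ : ∀ {g X} (p : X ≤B w) → g ≤ᵗ Ψ p → Φ g ≤B X
  ≤Ψ⇒Φ≤ {g} {X} p le = ≤B-respʳ {w = Φ (Ψ p)} {X} (ΦΨ p) (Φ-mono {g} {Ψ p} le)

  ≤Φ⇒Ψ≤ : ∀ {g X} (p : X ≤B w) → X ≤B Φ g → Ψ p ≤ᵗ g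
  ≤Φ⇒Ψ≤ {g} {X} p le = Φ-refl {Ψ p} {g} (≤B-respˡ {v = X} {Φ (Ψ p)} (λ x → sym (ΦΨ p x)) le)

  bottom : Tuple
  bottom _ = idₚ

  Φ-bottom : Φ bottom ≈ₚ idₚ
  Φ-bottom = ≤id⇒≈id (≤Ψ⇒Φ≤ {bottom} (id-least w) λ i → id-least _)

  single : Fin r → Perm k → Tuple
  single t x i = pick (i ≟ᶠ t) x idₚ

  single-at : ∀ t x → single t x t ≡ x
  single-at t x = pick-yes (t ≟ᶠ t) refl

  single-off : ∀ t x {i} → i ≢ t → single t x i ≡ idₚ
  single-off t x {i} ne = pick-no (i ≟ᶠ t) ne

  single-≤ : ∀ {t x g} → x ≤B g t → single t x ≤ᵗ g
  single-≤ {t} {x} {g} p i with i ≟ᶠ t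
  ... | yes refl = p
  ... | no _ = id-least (g i)

  single-≤⁻¹ : ∀ {t x g} → single t x ≤ᵗ g → x ≤B g t
  single-≤⁻¹ {t} {x} {g} p = subst (_≤B g t) (single-at t x) (p t)

  single-mono : ∀ t {x y} → x ≤B y → single t x ≤ᵗ single t y
  single-mono t {x} {y} p = single-≤ {t} {x} {single t y} (subst (x ≤B_) (sym (single-at t y)) p)

  ≤single : ∀ t {x g} → g ≤ᵗ single t x → (g t ≤B x) × (∀ {i} → i ≢ t → g i ≈ₚ idₚ)
  ≤single t {x} {g} p = subst (g t ≤B_) (single-at t x) (p t) , λ {i} ne → ≤id⇒≈id (subst (g i ≤B_) (single-off t x ne) (p i))

  ≈single : ∀ t {x} {g : Tuple} → g t ≈ₚ x → (∀ {i} → i ≢ t → g i ≈ₚ idₚ) → ∀ i → g i ≈ₚ single t x i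
  ≈single t {x} {g} e o i with i ≟ᶠ t
  ... | yes refl = e
  ... | no ne = o ne

  Φ-single-inj : ∀ t {x y} → Φ (single t x) ≈ₚ Φ (single t y) → x ≈ₚ y
  Φ-single-inj t {x} {y} e = subst₂ _≈ₚ_ (single-at t x) (single-at t y) (Φ-inj {single t x} {single t y} e t)

  -- Let `Z` be the first step from the lower image up to the higher one. Its tuple is trivial off
  -- `t`, and its entry at `t` lies between `x` and `y`, hence equals one of them; it is not `x`,
  -- since `Z` lies strictly above.
  Φ-single-⊲ : ∀ t {x y} → x ⊲ y → Φ (single t x) ⊲ Φ (single t y)
  Φ-single-⊲ t {x} {y} x⊲y = [ same , between ]′ (≤-split (Φ-mono {single t x} {single t y} (single-mono t (⊲⇒≤B x⊲y))))
    where
    X = Φ (single t x)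
    Y = Φ (single t y)
    same : X ≈ₚ Y → X ⊲ Y
    same e = contradiction (Φ-single-inj t e) (⊲⇒≉ x⊲y)
    between : (Σ (Perm n) λ Z → (X ⊲ Z) × (Z ≤B Y)) → X ⊲ Y
    between (Z , X⊲Z , Z≤Y) = [ at-bottom , at-top ]′ (⊲-nothing-between x⊲y x≤zt zt≤y)
      where
      p : Z ≤B w
      p = ≤B-trans Z≤Y (Φ≤w (single t y))
      x≤zt : x ≤B Ψ p t
      x≤zt = single-≤⁻¹ {t} {x} {Ψ p} (Φ≤⇒≤Ψ {single t x} p (⊲⇒≤B X⊲Z))
      zt≤y : Ψ p t ≤B y
      zt≤y = proj₁ (≤single t {y} {Ψ p} (≤Φ⇒Ψ≤ {single t y} p Z≤Y))
      off : ∀ {i} → i ≢ t → Ψ p i ≈ₚ idₚ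
      off = proj₂ (≤single t {y} {Ψ p} (≤Φ⇒Ψ≤ {single t y} p Z≤Y))
      Z≈ : ∀ {v} → Ψ p t ≈ₚ v → Z ≈ₚ Φ (single t v)
      Z≈ {v} e i = trans (sym (ΦΨ p i)) (Φ-cong {Ψ p} {single t v} (≈single t {v} {Ψ p} e off) i)
      at-top : Ψ p t ≈ₚ y → X ⊲ Y
      at-top e = ⊲-resp {v = X} {X} {Z} {Y} (λ _ → refl) (Z≈ e) X⊲Z
      at-bottom : x ≈ₚ Ψ p t → X ⊲ Y
      at-bottom e = contradiction (λ i → sym (Z≈ (λ j → sym (e j)) i)) (⊲⇒≉ X⊲Z)

  Φ-single-id : ∀ t → Φ (single t idₚ) ≈ₚ idₚ
  Φ-single-id t x = trans (Φ-cong {single t idₚ} {bottom} (λ i y → cong (_∙ y) (const (i ≟ᶠ t))) x) (Φ-bottom x)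
    where
    const : ∀ {A : Set} (d : Dec A) → pick d (idₚ {k}) idₚ ≡ idₚ
    const (yes _) = refl
    const (no _) = refl

  Φ-single-len : ∀ t {x y} → x ≤B y → len (Φ (single t x)) ≡ len x → len (Φ (single t y)) ≡ len y
  Φ-single-len t {x} {y} (≤B-refl e) l = trans (len-cong {v = Φ (single t y)} {Φ (single t x)} λ i → sym (Φ-cong {single t x} {single t y} (λ j → pick-cong (j ≟ᶠ t)) i))
      (trans l (len-cong {v = x} {y} e))
    where
    pick-cong : ∀ {A : Set} (d : Dec A) → pick d x idₚ ≈ₚ pick d y idₚ
    pick-cong (yes _) = e
    pick-cong (no _) _ = refl
  Φ-single-len t {x} {y} (≤B-step {v = z} c p) l = Φ-single-len t p (trans (⊲⇒len (Φ-single-⊲ t (⋖⇒⊲ x z c))) (trans (cong suc l) (sym (⊲⇒len (⋖⇒⊲ x z c)))))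

  abstract
    atom : ∀ t {m} (l : suc m < k) → ∃ λ i → Σ (suc i < n) λ l' → Φ (single t (gen l)) ≈ₚ gen l'
    atom t l = atom⇒gen (⊲-resp {v = Φ (single t idₚ)} {idₚ} {Φ (single t (gen l))} {Φ (single t (gen l))} (Φ-single-id t) (λ _ → refl) (Φ-single-⊲ t (id⊲gen l)))

  -- The index of the generator below `w` that matches s_m in the factor `t`.
  α : Fin r → ∀ m → suc m < k → ℕ
  α t m l = proj₁ (atom t l)

  α< : ∀ t m l → suc (α t m l) < n
  α< t m l = proj₁ (proj₂ (atom t l))

  α≈ : ∀ t m l → Φ (single t (gen l)) ≈ₚ gen (α< t m l)
  α≈ t m l = proj₂ (proj₂ (atom t l))

  α-irr : ∀ t {m} (l l' : suc m < k) → α t m l ≡ α t m l'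
  α-irr t l l' = cong (α t _) (≤-irrelevant l l')

  Ψ-D⇒D : ∀ {Z t m} (p : Z ≤B w) (l : suc m < k) → D m (Ψ p t) → D (α t m l) Z
  Ψ-D⇒D {Z} {t} {m} p l d =
    let l' , g≤ = D⇒gen≤ d
        gen≤ = ≤B-respˡ {v = gen l'} {gen l} (gen-cong refl l' l) g≤
        Φ≤ = ≤Ψ⇒Φ≤ {single t (gen l)} p (single-≤ {t} {gen l} {Ψ p} gen≤)
    in gen≤⇒D (α< t m l) (≤B-respˡ {v = Φ (single t (gen l))} {gen (α< t m l)} (α≈ t m l) Φ≤)

  D⇒gen≤Ψ : ∀ {Z t m} (p : Z ≤B w) (l : suc m < k) → D (α t m l) Z → gen l ≤B Ψ p t
  D⇒gen≤Ψ {Z} {t} {m} p l d =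
    let l' , g≤ = D⇒gen≤ d
        Φ≤ = ≤B-respˡ {v = gen l'} {Φ (single t (gen l))} (λ i → trans (gen-cong refl l' (α< t m l) i) (sym (α≈ t m l i))) g≤
    in single-≤⁻¹ {t} {gen l} {Ψ p} (Φ≤⇒≤Ψ {single t (gen l)} p Φ≤)

  -- The tuple of s_i is not trivial, so some s_m lies below one of its entries. The generator
  -- matched to that s_m lies below s_i, hence is s_i.
  support : ∀ {g i} → D i (Φ g) → ∃ λ t → ∃ λ m → Σ (suc m < k) λ l → (α t m l ≡ i) × D m (g t)
  support {g} {i} d = found (any? λ t → any? λ (m : Fin k) → T? (toℕ m) (toℕ m) (Ψ p t))
    where
    li = proj₁ (D⇒gen≤ d)
    gen≤Φ = proj₂ (D⇒gen≤ d)
    p : gen li ≤B w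
    p = ≤B-trans gen≤Φ (Φ≤w g)
    found : Dec (∃ λ t → ∃ λ (m : Fin k) → D (toℕ m) (Ψ p t)) → ∃ λ t → ∃ λ m → Σ (suc m < k) λ l → (α t m l ≡ i) × D m (g t)
    found (yes (t , m , dm)) = t , toℕ m , l , D-gen⇒≡ li (Ψ-D⇒D p l dm) , T-mono (≤Φ⇒Ψ≤ {g} p gen≤Φ t) dm
      where
      l = D⇒suc< dm
    found (no none) = contradiction (T-cong {v = gen li} {idₚ} (λ x → trans (sym (ΦΨ p x)) (trans (Φ-cong {Ψ p} {bottom} trivial x) (Φ-bottom x))) (D-gen li)) ¬D-id
      where
      trivial : ∀ t → Ψ p t ≈ₚ idₚ
      trivial t = no-inversions⇒id (Ψ p t) λ inv → none (t , inversion⇒D inv)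

  Φ-D : ∀ {g t m} (l : suc m < k) → D m (g t) → D (α t m l) (Φ g)
  Φ-D {g} {t} {m} l d = gen≤⇒D (α< t m l) (≤B-respˡ {v = Φ (single t (gen l))} {gen (α< t m l)} (α≈ t m l)
      (Φ-mono {single t (gen l)} {g} (single-≤ {t} {gen l} {g} (≤B-respˡ {v = gen l'} {gen l} (gen-cong refl l' l) gen≤))))
    where
    l' = proj₁ (D⇒gen≤ d)
    gen≤ = proj₂ (D⇒gen≤ d)

  support-single : ∀ {t x i} → D i (Φ (single t x)) → ∃ λ m → Σ (suc m < k) λ l → (α t m l ≡ i) × D m x
  support-single {t} {x} {i} d = go (support {single t x} d)
    where
    go : (∃ λ t' → ∃ λ m → Σ (suc m < k) λ l → (α t' m l ≡ i) × D m (single t x t')) → ∃ λ m → Σ (suc m < k) λ l → (α t m l ≡ i) × D m x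
    go (t' , m , l , e , dm) with t' ≟ᶠ t
    ... | yes refl = m , l , e , dm
    ... | no _ = contradiction dm ¬D-id

  α-inj : ∀ {t t' m m'} (l : suc m < k) (l' : suc m' < k) → α t m l ≡ α t' m' l' → (t ≡ t') × (m ≡ m')
  α-inj {t} {t'} {m} {m'} l l' e = t≡t' (t ≟ᶠ t')
    where
    same : Φ (single t (gen l)) ≈ₚ Φ (single t' (gen l'))
    same x = trans (α≈ t m l x) (trans (gen-cong e (α< t m l) (α< t' m' l') x) (sym (α≈ t' m' l' x)))
    D-t : D m (single t (gen l) t)
    D-t = subst (D m) (sym (single-at t (gen l))) (D-gen l)
    D-t' : D m (single t' (gen l') t)
    D-t' = T-cong {v = single t (gen l) t} {single t' (gen l') t} (Φ-inj {single t (gen l)} {single t' (gen l')} same t) D-t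
    t≡t' : Dec (t ≡ t') → (t ≡ t') × (m ≡ m')
    t≡t' (yes refl) = refl , D-gen⇒≡ l' (subst (D m) (single-at t (gen l')) D-t')
    t≡t' (no ne) = contradiction (subst (D m) (single-off t' (gen l') ne) D-t') ¬D-id

  -- Otherwise Φ would send the two covers s_m s_(m+1) and s_(m+1) s_m of s_m to the same permutation s_i s_j.
  α-adjacent : ∀ t m (l₁ : suc m < k) (l₂ : suc (suc m) < k) → (α t (suc m) l₂ ≡ suc (α t m l₁)) ⊎ (α t m l₁ ≡ suc (α t (suc m) l₂))
  α-adjacent t m l₁ l₂ = decide (j ≟ suc i) (i ≟ suc j)
    where
    open ConsecutiveGens l₁ l₂
    i = α t m l₁
    j = α t (suc m) l₂
    li = α< t m l₁
    lj = α< t (suc m) l₂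
    image : ∀ {y} → s ⊲ y → (∀ {l} → D l y → (l ≡ m) ⊎ (l ≡ suc m)) → j ≢ suc i → i ≢ suc j → Φ (single t y) ≈ₚ swap (lo lj) (hi lj) (gen li)
    image {y} c supp a b = cover-over-gen li lj (λ e → 1+n≢n (sym (proj₂ (α-inj l₁ l₂ e)))) b a
      (⊲-resp {v = Φ (single t s)} {gen li} {Φ (single t y)} {Φ (single t y)} (α≈ t m l₁) (λ _ → refl) (Φ-single-⊲ t c)) supp'
      where
      supp' : ∀ {l} → D l (Φ (single t y)) → (l ≡ i) ⊎ (l ≡ j)
      supp' {l} d = go (support-single {t} {y} d)
        where
        go : (∃ λ m' → Σ (suc m' < k) λ l' → (α t m' l' ≡ l) × D m' y) → (l ≡ i) ⊎ (l ≡ j)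
        go (m' , l' , e , dm) with supp dm
        ... | inj₁ refl = inj₁ (trans (sym e) (α-irr t l' l₁))
        ... | inj₂ refl = inj₂ (trans (sym e) (α-irr t l' l₂))
    decide : Dec (j ≡ suc i) → Dec (i ≡ suc j) → (j ≡ suc i) ⊎ (i ≡ suc j)
    decide (yes e) _ = inj₁ e
    decide _ (yes e) = inj₂ e
    decide (no a) (no b) = ⊥-elim (y₁≉y₂ (Φ-single-inj t λ x → trans (image s⊲y₁ supp-y₁ a b x) (sym (image s⊲y₂ supp-y₂ a b x))))

  module _ (t : Fin r) where

    private
      module P = Path K (λ m l → α t m (s≤s l)) (λ m l₁ l₂ → α-adjacent t m (s≤s l₁) (s≤s l₂)) (λ l l' e → proj₂ (α-inj (s≤s l) (s≤s l') e))

    left : ℕ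
    left = proj₁ P.interval

    α-left : ∀ m l → (left ≤ α t m l) × (α t m l < left + (2 + K))
    α-left m l = subst (λ i → (left ≤ i) × (i < left + (2 + K))) (α-irr t (s≤s (s≤s⁻¹ l)) l) (proj₁ (proj₂ P.interval) m (s≤s⁻¹ l))

    left-α : ∀ {i} → left ≤ i → i < left + (2 + K) → ∃ λ m → Σ (suc m < k) λ l → α t m l ≡ i
    left-α a b = let m , l , e = proj₂ (proj₂ P.interval) a b in m , s≤s l , e

    left-fits : left + suc (2 + K) ≤ n
    left-fits =
      let m , l , e = left-α {left + (1 + K)} (m≤m+n left _) (+-monoʳ-< left ≤-refl)
      in subst (_≤ n) (trans (cong (λ i → suc (suc i)) e) (sym (trans (+-suc left (2 + K)) (cong suc (+-suc left (1 + K)))))) (α< t m l)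

    open Interval left (2 + K) left-fits using (ext; ext-id; ext-cong; supported⇒ext)

    private
      u : Perm n
      u = Φ (single t (w₀ k))

      support-u : ∀ {i} → D i u → (left ≤ i) × (i < left + (2 + K))
      support-u d = let m , l , e , _ = support-single {t} {w₀ k} d in subst (λ i → (left ≤ i) × (i < left + (2 + K))) e (α-left m l)

      û = supported⇒ext {idₚ} {u} {idₚ} (id-least u)
        (¬D⇒FixesBelow u λ i<c d → <⇒≱ i<c (proj₁ (support-u d))) (¬D⇒FixesAbove u λ d≤i d → <⇒≱ (proj₂ (support-u d)) d≤i)
        (λ x → sym (ext-id x)) (trans (len-id {n}) (sym (len-id {k})))

      len-u : len u ≡ len (w₀ k)
      len-u = Φ-single-len t {idₚ} {w₀ k} (w₀-greatest idₚ) (trans (len-cong {v = Φ (single t idₚ)} {idₚ} (Φ-single-id t)) (trans (len-id {n}) (sym (len-id {k}))))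

      û≈w₀ : proj₁ û ≈ₚ w₀ k
      û≈w₀ = ≤B-len≥⇒≈ {v = proj₁ û} {w₀ k} (w₀-greatest (proj₁ û)) (≤-reflexive (trans (sym len-u) (proj₂ (proj₂ û))))

    -- The image `u` of the longest element in coordinate `t` moves only points of the interval, so
    -- it is an extension. What it extends has the length of the longest element and therefore is
    -- the longest element.
    longest-below : ext (w₀ k) ≤B w
    longest-below = ≤B-respˡ {v = u} {ext (w₀ k)} (λ x → trans (proj₁ (proj₂ û) x) (ext-cong {proj₁ û} {w₀ k} û≈w₀ x)) (Φ≤w (single t (w₀ k)))

  -- Otherwise the join of s_i and s_(i+1), which belong to different blocks, would lie below both of their products, and no permutation does.
  left-end : ∀ t → E (left t + (1 + K)) w → ¬ E (left t + (1 + K)) (flip w)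
  left-end t e e' = contra (left-α t {i} (m≤m+n _ _) (+-monoʳ-< (left t) ≤-refl)) (support {Ψ refl≤B} (T-cong {v = w} {Φ (Ψ refl≤B)} (λ x → sym (ΦΨ refl≤B x)) (E⇒D-suc e)))
    where
    i = left t + (1 + K)
    contra : (∃ λ m → Σ (suc m < k) λ l → α t m l ≡ i) → (∃ λ t' → ∃ λ m' → Σ (suc m' < k) λ l' → (α t' m' l' ≡ suc i) × _) → ⊥
    contra (m , l , αi) (t' , m' , l' , αi' , _) = [ E-G , E-flip-G ]′ (D-D⇒E D-G D-suc-G)
      where
      -- `i` is the last index of its interval, so i + 1 belongs to another one.
      t'≢t : t' ≢ t
      t'≢t refl = <⇒≱ (proj₂ (α-left t m' l')) (≤-reflexive (trans (+-suc (left t) (1 + K)) (sym αi')))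
      -- The two nontrivial entries sit in different coordinates, so this tuple is the join of the
      -- two atoms.
      join : Tuple
      join j = pick (j ≟ᶠ t) (gen l) (pick (j ≟ᶠ t') (gen l') idₚ)
      join-t : join t ≡ gen l
      join-t = pick-yes (t ≟ᶠ t) refl
      join-t' : join t' ≡ gen l'
      join-t' = trans (pick-no (t' ≟ᶠ t) t'≢t) (pick-yes (t' ≟ᶠ t') refl)
      join-≤ : ∀ {g} → gen l ≤B g t → gen l' ≤B g t' → join ≤ᵗ g
      join-≤ {g} a b j = at (j ≟ᶠ t) (j ≟ᶠ t')
        where
        at : (d : Dec (j ≡ t)) (d' : Dec (j ≡ t')) → pick d (gen l) (pick d' (gen l') idₚ) ≤B g j
        at (yes refl) _ = a
        at (no _) (yes refl) = b
        at (no _) (no _) = id-least (g j)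
      G : Perm n
      G = Φ join
      G≤ : ∀ {Z} (p : Z ≤B w) → D i Z → D (suc i) Z → G ≤B Z
      G≤ {Z} p d d' = ≤Ψ⇒Φ≤ {join} p (join-≤ (D⇒gen≤Ψ p l (subst (λ j → D j Z) (sym αi) d)) (D⇒gen≤Ψ p l' (subst (λ j → D j Z) (sym αi') d')))
      D-G : D i G
      D-G = subst (λ j → D j G) αi (Φ-D {join} {t} l (subst (D m) (sym join-t) (D-gen l)))
      D-suc-G : D (suc i) G
      D-suc-G = subst (λ j → D j G) αi' (Φ-D {join} {t'} l' (subst (D m') (sym join-t') (D-gen l')))
      z₁ = E-minimal e
      z₂ = E-minimal e'
      G≤z₁ : G ≤B proj₁ z₁
      G≤z₁ = G≤ (proj₁ (proj₂ z₁)) (E⇒D (proj₁ (proj₂ (proj₂ z₁)))) (E⇒D-suc (proj₁ (proj₂ (proj₂ z₁))))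
      G≤z₂ : G ≤B flip (proj₁ z₂)
      G≤z₂ = G≤ (≤B-respʳ {w = flip (flip w)} {w} (λ _ → refl) (≤B-flip (proj₁ (proj₂ z₂))))
        (D-flip (E⇒D (proj₁ (proj₂ (proj₂ z₂))))) (D-flip (E⇒D-suc (proj₁ (proj₂ (proj₂ z₂)))))
      E-G : E i G → ⊥
      E-G x = proj₂ (proj₂ (proj₂ z₂)) (T-mono G≤z₂ x)
      E-flip-G : E i (flip G) → ⊥
      E-flip-G x = proj₂ (proj₂ (proj₂ z₁)) (T-mono (≤B-flip G≤z₁) x)

  blocks : Blocks K (λ c → ∃ λ t → left t ≡ c) w
  blocks = record
    { fits = λ { (t , refl) → left-fits t }
    ; longest≤ = λ { (t , refl) → longest-below t }
    ; end = λ { (t , refl) → left-end t }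
    ; separate = λ { (t , refl) (t' , refl) lt → ≮⇒≥ λ l → meet t t' lt l }
    ; covers = λ d →
        let t , m , l , e , _ = support {Ψ refl≤B} (T-cong {v = w} {Φ (Ψ refl≤B)} (λ x → sym (ΦΨ refl≤B x)) d)
            a , b = α-left t m l
        in left t , (t , refl) , subst (left t ≤_) e a , subst (_< left t + (2 + K)) e b }
    where
    meet : ∀ t t' → left t < left t' → left t' < left t + (2 + K) → ⊥
    meet t t' lt l =
      -- The generator at the left end of the second interval would belong to both factors.
      let m , p , e = left-α t (<⇒≤ lt) l
          m' , p' , e' = left-α t' ≤-refl (m<m+n (left t') (s≤s z≤n))
          t≡t' = proj₁ (α-inj p p' (trans e (sym e')))
      in <⇒≢ lt (cong left t≡t')

theorem6p5 : (n : ℕ) (w : Perm n) →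
    (Σ ℕ λ k → (3 ≤ k) × (Σ ℕ λ r → B w ≅ᴾ (B (w₀ k) ^ᴾ r)))
    ⇔ (Σ ℕ λ k → (3 ≤ k) × EveryInversionInUniqueOcc w k)
theorem6p5 n w = mk⇔
  (λ { (suc (suc (suc K)) , 3≤k , r , iso) → 3 + K , 3≤k , BlockProduct⇒uniqueOcc (Blocks⇒BlockProduct w (Power.blocks {K = K} {r} w iso))
     ; (suc (suc zero) , s≤s (s≤s ()) , _) ; (suc zero , s≤s () , _) })
  (λ { (suc (suc (suc K)) , 3≤k , h) → let r , f = BlockProduct⇒≃ (uniqueOcc⇒BlockProduct w h) in
         3 + K , 3≤k , r , ≃⇒≅ {P = B w} {B (w₀ (3 + K)) ^ᴾ r} f
     ; (suc (suc zero) , s≤s (s≤s ()) , _) ; (suc zero , s≤s () , _) })
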